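{- Let $E/\mathbf{Q}$ be an elliptic curve, $p$ an odd prime not dividing the conductor of $E$, and $m$ an integer coprime to $p$. If the Parity Conjecture holds, then there exist infinitely many squarefree integers $d\equiv m\pmod p$ such that the quadratic twist $E_d$ has positive rank.
   Context: Squarefree integers may be negative and are nonzero. For an elliptic curve $E: y^2=g(x)$ over $\mathbf{Q}$ and a squarefree integer $d$, $E_d: dy^2=g(x)$ denotes the quadratic twist of $E$ by $d$; its rank is the rank of $E_d(\mathbf{Q})$. The Parity Conjecture is used in the following form, for quadratic twists: Let $E$ be an elliptic curve over $\mathbf{Q}$ with conductor $N_E$, and let $d$ be a squarefree integer coprime to $2N_E$. Then $(-1)^{\operatorname{rank} E_d(\mathbf{Q})}=(-1)^{\operatorname{rank} E(\mathbf{Q})}\cdot\chi_d(-N_E)$, where $\chi_d$ is the quadratic Dirichlet character associated to the field $\mathbf{Q}(\sqrt d)$. Here, if $D$ is the discriminant of $\mathbf{Q}(\sqrt d)$, $\chi_d$ is given by the Kronecker symbol $\chi_d(n)=\left(\frac{D}{n}\right)$. -}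

module Defs where

open import Algebra.Bundles.Raw using (RawMonoid)
import Algebra.Definitions.RawMonoid as RawMonoidDefs
open import Data.Bool using (if_then_else_)
open import Data.Fin using (Fin; toℕ)
open import Data.Fin.Properties using (any?)
open import Data.Integer as ℤ using (ℤ; +_; -[1+_]; 0ℤ; 1ℤ; -1ℤ; ∣_∣)
open import Data.Integer.Coprimality using (Coprime)
open import Data.Integer.Divisibility using (_∣_)
open import Data.Integer.DivMod using (_%ℕ_)
open import Data.List using (List; map; foldr)
open import Data.List.Membership.Propositional using (_∉_)
open import Data.Nat as ℕ using (ℕ; zero; suc)
import Data.Nat.Divisibility as ℕ
open import Data.Nat.Primality using (Prime)
open import Data.Nat.Primality.Factorisation using (factorise; factors)
open import Data.Product using (Σ-syntax; ∃-syntax; _×_; _,_)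
open import Data.Rational.Properties using (_≟_; *-inverseˡ; *-assoc; *-identityˡ; *-identityʳ; *-zeroʳ)
open import Data.Rational.Solver using (module +-*-Solver)
open import Data.Vec.Functional using (Vector; _∷_)
open import Relation.Binary.PropositionalEquality
open import Relation.Nullary using (¬_; yes; no; does)

Squarefree : ℤ → Set
Squarefree d = d ≢ 0ℤ × (∀ k → k ℤ.* k ∣ d → ∣ k ∣ ≡ 1)

-- No finite list exhausts P.
Infinite : (ℤ → Set) → Set
Infinite P = ∀ (L : List ℤ) → ∃[ d ] d ∉ L × P d

-- Valuation p a v says that p ^ v is the exact power of p dividing a;
-- it holds for no v when a = 0 and p ≠ 1.
Valuation : ℕ → ℤ → ℕ → Set
Valuation p a v = (+ (p ℕ.^ v) ∣ a) × ¬ (+ (p ℕ.^ suc v) ∣ a)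

-- (a/p) for an odd prime p
legendre : ℤ → ℕ → ℤ
legendre a p =
  if does (p ℕ.∣? ∣ a ∣) then 0ℤ
  else if does (any? λ (x : Fin p) → p ℕ.∣? ∣ + (toℕ x ℕ.* toℕ x) ℤ.- a ∣) then 1ℤ
  else -1ℤ

kronecker₂ : ℤ → ℤ
kronecker₂ a with a %ℕ 8
... | 1 = 1ℤ
... | 3 = -1ℤ
... | 5 = -1ℤ
... | 7 = 1ℤ
... | _ = 0ℤ

kroneckerPrime : ℤ → ℕ → ℤ
kroneckerPrime a 2 = kronecker₂ a
kroneckerPrime a p = legendre a p

-- (a/-1)
kroneckerUnit : ℤ → ℤ
kroneckerUnit (+ _)    = 1ℤ
kroneckerUnit -[1+ _ ] = -1ℤ

kroneckerPositive : ℤ → (n : ℕ) → .{{ℕ.NonZero n}} → ℤ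
kroneckerPositive a n = foldr ℤ._*_ 1ℤ (map (kroneckerPrime a) (factors (factorise n)))

kronecker : ℤ → ℤ → ℤ
kronecker a (+ zero)    = if does (∣ a ∣ ℕ.≟ 1) then 1ℤ else 0ℤ
kronecker a (+ (suc n)) = kroneckerPositive a (suc n)
kronecker a -[1+ n ]    = kroneckerUnit a ℤ.* kroneckerPositive a (suc n)

-- Meaningful for squarefree d
fieldDiscriminant : ℤ → ℤ
fieldDiscriminant d = if does (d %ℕ 4 ℕ.≟ 1) then d else + 4 ℤ.* d

χ : ℤ → ℤ → ℤ
χ d n = kronecker (fieldDiscriminant d) n

-- y² + a₁ x y + a₃ y = x³ + a₂ x² + a₄ x + a₆
record Weierstrass : Set where
  field
    a₁ a₂ a₃ a₄ a₆ : ℤ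

  open import Data.Integer using (_+_; _-_; _*_; -_)

  b₂ b₄ b₆ b₈ Δ : ℤ
  b₂ = a₁ * a₁ + + 4 * a₂
  b₄ = + 2 * a₄ + a₁ * a₃
  b₆ = a₃ * a₃ + + 4 * a₆
  b₈ = a₁ * a₁ * a₆ + + 4 * a₂ * a₆ - a₁ * a₃ * a₄ + a₂ * a₃ * a₃ - a₄ * a₄
  Δ  = - (b₂ * b₂ * b₈) - + 8 * b₄ * b₄ * b₄ - + 27 * b₆ * b₆ + + 9 * b₂ * b₄ * b₆

  -- Discriminants of T³ + a₂ T² + a₄ T + a₆ and of a₂ T² + a₄ T + a₆
  cubicDisc quadraticDisc : ℤ
  cubicDisc     = a₂ * a₂ * a₄ * a₄ - + 4 * a₄ * a₄ * a₄ - + 4 * a₂ * a₂ * a₂ * a₆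
                    - + 27 * a₆ * a₆ + + 18 * a₂ * a₄ * a₆
  quadraticDisc = a₄ * a₄ - + 4 * a₂ * a₆

open import Data.Rational as ℚ using (ℚ; 0ℚ; 1ℚ; _+_; _-_; _*_; -_; _÷_; 1/_; ≢-nonZero)

ι : ℤ → ℚ
ι n = n ℚ./ 1

discriminant : ℚ → ℚ → ℚ → ℚ
discriminant a b c =
  a * a * b * b - ι (+ 4) * (b * b * b) - ι (+ 4) * (a * a * a * c)
    - ι (+ 27) * (c * c) + ι (+ 18) * (a * b * c)

record EllipticCurve : Set where
  field
    a b c           : ℚ
    discriminant≢0 : discriminant a b c ≢ 0ℚ

-- The curve δ y² = x³ + a x² + b x + c
record Model : Set where
  constructor model
  field
    δ a b c : ℚ

  g g′ : ℚ → ℚ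
  g x  = x * x * x + a * (x * x) + b * x + c
  g′ x = ι (+ 3) * (x * x) + ι (+ 2) * (a * x) + b

curve : EllipticCurve → Model
curve E = model 1ℚ a b c where open EllipticCurve E

twist : EllipticCurve → ℤ → Model
twist E d = model (ι d) a b c where open EllipticCurve E

private
  cubic : ℚ → ℚ → ℚ → ℚ → ℚ
  cubic A B C x = x * x * x + A * (x * x) + B * x + C

  cancel : ∀ {s t} → s ≢ 0ℚ → s * t ≡ 0ℚ → t ≡ 0ℚ
  cancel {s} {t} s≢0 st≡0 = begin
    t                ≡⟨ *-identityˡ t ⟨
    1ℚ * t           ≡⟨ cong (_* t) (*-inverseˡ s) ⟨
    (1/ s * s) * t   ≡⟨ *-assoc (1/ s) s t ⟩
    1/ s * (s * t)   ≡⟨ cong (1/ s *_) st≡0 ⟩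
    1/ s * 0ℚ        ≡⟨ *-zeroʳ (1/ s) ⟩
    0ℚ               ∎
    where
    open ≡-Reasoning
    instance
      _ = ≢-nonZero s≢0

  ÷-* : ∀ s t → (t≢0 : t ≢ 0ℚ) → (s ÷ t) {{≢-nonZero t≢0}} * t ≡ s
  ÷-* s t t≢0 = trans (*-assoc s (1/ t) t) (trans (cong (s *_) (*-inverseˡ t)) (*-identityʳ s))
    where
    instance
      _ = ≢-nonZero t≢0

  open +-*-Solver

  difference : ∀ {s t} → s - t ≡ 0ℚ → s ≡ t
  difference {s} {t} e = begin
    s            ≡⟨ solve 2 (λ s t → s := (s :- t) :+ t) refl s t ⟩
    (s - t) + t  ≡⟨ cong (_+ t) e ⟩
    0ℚ + t       ≡⟨ solve 1 (λ t → con 0ℚ :+ t := t) refl t ⟩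
    t            ∎
    where open ≡-Reasoning

  difference₀ : ∀ {s t} → s ≡ t → s - t ≡ 0ℚ
  difference₀ {s} refl = solve 1 (λ s → s :- s := con 0ℚ) refl s

  thirdRoot : ∀ A B C x₁ x₂ → x₂ - x₁ ≢ 0ℚ →
    cubic A B C x₁ ≡ 0ℚ → cubic A B C x₂ ≡ 0ℚ → cubic A B C (- A - x₁ - x₂) ≡ 0ℚ
  thirdRoot A B C x₁ x₂ ne e₁ e₂ = cancel ne (begin
    (x₂ - x₁) * cubic A B C x₃
      ≡⟨ solve 5 (λ A B C x₁ x₂ →
           let F = λ x → x :* x :* x :+ A :* (x :* x) :+ B :* x :+ C
               x₃ = :- A :- x₁ :- x₂ in
           (x₂ :- x₁) :* F x₃ := F x₂ :* (x₃ :- x₁) :- F x₁ :* (x₃ :- x₂))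
           refl A B C x₁ x₂ ⟩
    cubic A B C x₂ * (x₃ - x₁) - cubic A B C x₁ * (x₃ - x₂)
      ≡⟨ cong₂ (λ s t → s * (x₃ - x₁) - t * (x₃ - x₂)) e₂ e₁ ⟩
    0ℚ * (x₃ - x₁) - 0ℚ * (x₃ - x₂)
      ≡⟨ solve 2 (λ s t → con 0ℚ :* s :- con 0ℚ :* t := con 0ℚ) refl (x₃ - x₁) (x₃ - x₂) ⟩
    0ℚ ∎)
    where
    open ≡-Reasoning
    x₃ = - A - x₁ - x₂

  residualRoot : ∀ A B C x₁ →
    cubic A B C x₁ ≡ 0ℚ → ι (+ 3) * (x₁ * x₁) + ι (+ 2) * (A * x₁) + B ≡ 0ℚ →
    cubic A B C (- A - x₁ - x₁) ≡ 0ℚ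
  residualRoot A B C x₁ e e′ = begin
    cubic A B C x₃
      ≡⟨ solve 4 (λ A B C x₁ →
           let F = λ x → x :* x :* x :+ A :* (x :* x) :+ B :* x :+ C
               x₃ = :- A :- x₁ :- x₁ in
           F x₃ := F x₁ :+ (x₃ :- x₁) :* (con (ι (+ 3)) :* (x₁ :* x₁) :+ con (ι (+ 2)) :* (A :* x₁) :+ B))
           refl A B C x₁ ⟩
    cubic A B C x₁ + (x₃ - x₁) * (ι (+ 3) * (x₁ * x₁) + ι (+ 2) * (A * x₁) + B)
      ≡⟨ cong₂ (λ s t → s + (x₃ - x₁) * t) e e′ ⟩
    0ℚ + (x₃ - x₁) * 0ℚ
      ≡⟨ solve 1 (λ s → con 0ℚ :+ s :* con 0ℚ := con 0ℚ) refl (x₃ - x₁) ⟩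
    0ℚ ∎
    where
    open ≡-Reasoning
    x₃ = - A - x₁ - x₁

module _ (M : Model) where
  open Model M

  -- Points of the projective closure; O is the point at infinity.
  data Point : Set where
    O      : Point
    affine : (x y : ℚ) → .(δ * (y * y) ≡ g x) → Point

module _ {M : Model} where
  open Model M

  private
    -- Coefficients of g(x) − δ (l (x − x₁) + y₁)², whose roots are the
    -- abscissae of the points on the line through (x₁ , y₁) of slope l.
    A′ B′ C′ : (l x₁ y₁ : ℚ) → ℚ
    A′ l x₁ y₁ = a - δ * (l * l)
    B′ l x₁ y₁ = b - ι (+ 2) * (δ * (l * (y₁ - l * x₁)))
    C′ l x₁ y₁ = c - δ * ((y₁ - l * x₁) * (y₁ - l * x₁))

    restrict : ∀ l x₁ y₁ x →
      cubic (A′ l x₁ y₁) (B′ l x₁ y₁) (C′ l x₁ y₁) x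
        ≡ g x - δ * ((l * (x - x₁) + y₁) * (l * (x - x₁) + y₁))
    restrict l x₁ y₁ x = solve 8 (λ δ a b c l x₁ y₁ x →
      let n = y₁ :- l :* x₁
          h = l :* (x :- x₁) :+ y₁ in
      x :* x :* x :+ (a :- δ :* (l :* l)) :* (x :* x)
        :+ (b :- con (ι (+ 2)) :* (δ :* (l :* n))) :* x :+ (c :- δ :* (n :* n))
      := (x :* x :* x :+ a :* (x :* x) :+ b :* x :+ c) :- δ :* (h :* h))
      refl δ a b c l x₁ y₁ x

    onLine : ∀ l x₁ y₁ x {y} → l * (x - x₁) + y₁ ≡ y → δ * (y * y) ≡ g x →
      cubic (A′ l x₁ y₁) (B′ l x₁ y₁) (C′ l x₁ y₁) x ≡ 0ℚ
    onLine l x₁ y₁ x refl e = trans (restrict l x₁ y₁ x) (difference₀ (sym e))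

    base : ∀ l x₁ y₁ → l * (x₁ - x₁) + y₁ ≡ y₁
    base = solve 3 (λ l x y → l :* (x :- x) :+ y := y) refl

    third : (l x₁ x₂ : ℚ) → ℚ
    third l x₁ x₂ = δ * (l * l) - a - x₁ - x₂

    closed : ∀ l x₁ y₁ x₂ →
      cubic (A′ l x₁ y₁) (B′ l x₁ y₁) (C′ l x₁ y₁) (- A′ l x₁ y₁ - x₁ - x₂) ≡ 0ℚ →
      let x₃ = third l x₁ x₂
          y₃ = - (l * (x₃ - x₁) + y₁) in
      δ * (y₃ * y₃) ≡ g x₃
    closed l x₁ y₁ x₂ e = begin
      δ * ((- h) * (- h)) ≡⟨ solve 2 (λ δ h → δ :* ((:- h) :* (:- h)) := δ :* (h :* h)) refl δ h ⟩
      δ * (h * h)         ≡⟨ difference (trans (sym (restrict l x₁ y₁ x₃)) (trans (cong (cubic (A′ l x₁ y₁) (B′ l x₁ y₁) (C′ l x₁ y₁)) eq) e)) ⟨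
      g x₃                ∎
      where
      open ≡-Reasoning
      x₃ = third l x₁ x₂
      h  = l * (x₃ - x₁) + y₁
      eq : x₃ ≡ - A′ l x₁ y₁ - x₁ - x₂
      eq = solve 5 (λ δ a l x₁ x₂ →
             δ :* (l :* l) :- a :- x₁ :- x₂ := :- (a :- δ :* (l :* l)) :- x₁ :- x₂)
             refl δ a l x₁ x₂

    chord-closed : ∀ l x₁ y₁ x₂ y₂ → x₂ - x₁ ≢ 0ℚ → l * (x₂ - x₁) ≡ y₂ - y₁ →
      δ * (y₁ * y₁) ≡ g x₁ → δ * (y₂ * y₂) ≡ g x₂ →
      let x₃ = third l x₁ x₂
          y₃ = - (l * (x₃ - x₁) + y₁) in
      δ * (y₃ * y₃) ≡ g x₃
    chord-closed l x₁ y₁ x₂ y₂ ne slope e₁ e₂ =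
      closed l x₁ y₁ x₂ (thirdRoot (A′ l x₁ y₁) (B′ l x₁ y₁) (C′ l x₁ y₁) x₁ x₂ ne
        (onLine l x₁ y₁ x₁ (base l x₁ y₁) e₁)
        (onLine l x₁ y₁ x₂ (trans (cong (_+ y₁) slope) (solve 2 (λ s t → (s :- t) :+ t := s) refl y₂ y₁)) e₂))

    tangent-closed : ∀ l x₁ y₁ y₂ → δ * (y₁ + y₂) ≢ 0ℚ → l * (δ * (y₁ + y₂)) ≡ g′ x₁ →
      δ * (y₁ * y₁) ≡ g x₁ → δ * (y₂ * y₂) ≡ g x₁ →
      let x₃ = third l x₁ x₁
          y₃ = - (l * (x₃ - x₁) + y₁) in
      δ * (y₃ * y₃) ≡ g x₃
    tangent-closed l x₁ y₁ y₂ ne slope e₁ e₂ =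
      closed l x₁ y₁ x₁ (residualRoot (A′ l x₁ y₁) (B′ l x₁ y₁) (C′ l x₁ y₁) x₁ (onLine l x₁ y₁ x₁ (base l x₁ y₁) e₁) derivative)
      where
      open ≡-Reasoning
      y₁≡y₂ : y₁ ≡ y₂
      y₁≡y₂ = difference (cancel ne (begin
        δ * (y₁ + y₂) * (y₁ - y₂)
          ≡⟨ solve 3 (λ δ s t → δ :* (s :+ t) :* (s :- t) := δ :* (s :* s) :- δ :* (t :* t)) refl δ y₁ y₂ ⟩
        δ * (y₁ * y₁) - δ * (y₂ * y₂)
          ≡⟨ difference₀ (trans e₁ (sym e₂)) ⟩
        0ℚ ∎))
      derivative : ι (+ 3) * (x₁ * x₁) + ι (+ 2) * (A′ l x₁ y₁ * x₁) + B′ l x₁ y₁ ≡ 0ℚ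
      derivative = begin
        ι (+ 3) * (x₁ * x₁) + ι (+ 2) * (A′ l x₁ y₁ * x₁) + B′ l x₁ y₁
          ≡⟨ solve 6 (λ δ a b l x y →
               con (ι (+ 3)) :* (x :* x) :+ con (ι (+ 2)) :* ((a :- δ :* (l :* l)) :* x)
                 :+ (b :- con (ι (+ 2)) :* (δ :* (l :* (y :- l :* x))))
               := (con (ι (+ 3)) :* (x :* x) :+ con (ι (+ 2)) :* (a :* x) :+ b) :- l :* (δ :* (y :+ y)))
               refl δ a b l x₁ y₁ ⟩
        g′ x₁ - l * (δ * (y₁ + y₁))
          ≡⟨ difference₀ (trans (sym slope) (cong (λ y → l * (δ * (y₁ + y))) (sym y₁≡y₂))) ⟩
        0ℚ ∎

  ⊖_ : Point M → Point M
  ⊖ O            = O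
  ⊖ affine x y e = affine x (- y) (trans (solve 2 (λ δ y → δ :* ((:- y) :* (:- y)) := δ :* (y :* y)) refl δ y) e)

  -- The chord-tangent law.  If x₁ = x₂, then y₁ = ± y₂ (for δ ≠ 0), so that
  -- δ (y₁ + y₂) is nonzero exactly when the points are equal and not 2-torsion,
  -- and it is then the 2 δ y₁ of the usual tangent slope.
  infixl 6 _⊕_
  _⊕_ : Point M → Point M → Point M
  O ⊕ Q = Q
  P@(affine _ _ _) ⊕ O = P
  affine x₁ y₁ e₁ ⊕ affine x₂ y₂ e₂ with x₂ - x₁ ≟ 0ℚ
  ... | no x₁≢x₂ = affine x₃ (- (l * (x₃ - x₁) + y₁))
          (chord-closed l x₁ y₁ x₂ y₂ x₁≢x₂ (÷-* (y₂ - y₁) (x₂ - x₁) x₁≢x₂) e₁ e₂)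
    where
    l  = ((y₂ - y₁) ÷ (x₂ - x₁)) {{≢-nonZero x₁≢x₂}}
    x₃ = δ * (l * l) - a - x₁ - x₂
  ... | yes x₁≡x₂ with δ * (y₁ + y₂) ≟ 0ℚ
  ...   | yes _  = O
  ...   | no 2δy≢0 = affine x₃ (- (l * (x₃ - x₁) + y₁))
            (tangent-closed l x₁ y₁ y₂ 2δy≢0 (÷-* (g′ x₁) (δ * (y₁ + y₂)) 2δy≢0) e₁
              (trans e₂ (cong g (difference {x₂} {x₁} x₁≡x₂))))
    where
    l  = (g′ x₁ ÷ (δ * (y₁ + y₂))) {{≢-nonZero 2δy≢0}}
    x₃ = δ * (l * l) - a - x₁ - x₁

  pointMonoid : RawMonoid _ _
  pointMonoid = record { Carrier = Point M ; _≈_ = _≡_ ; _∙_ = _⊕_ ; ε = O }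

  private
    module Monoid = RawMonoidDefs pointMonoid

  infixr 8 _·_
  _·_ : ℤ → Point M → Point M
  (+ n)    · P = n Monoid.× P
  -[1+ n ] · P = ⊖ (suc n Monoid.× P)

  combination : ∀ {r} → Vector ℤ r → Vector (Point M) r → Point M
  combination n P = Monoid.sum (λ i → n i · P i)

Independent Dependent : ∀ {M r} → Vector (Point M) r → Set
Independent P = ∀ n → combination n P ≡ O → ∀ i → n i ≡ 0ℤ
Dependent   P = ∃[ n ] combination n P ≡ O × (∃[ i ] n i ≢ 0ℤ)

-- The rank is the length of a maximal ℤ-linearly independent family.
HasRank : Model → ℕ → Set
HasRank M r =
  Σ[ P ∈ Vector (Point M) r ] Independent P × (∀ Q → Dependent (Q ∷ P))

PositiveRank : Model → Set
PositiveRank M = ∃[ r ] HasRank M r × 0 ℕ.< r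

-- W arises from E over ℚ by x = u² x′ + r, y = u³ y′ + s u² x′ + t.
record _IsIntegralModelOf_ (W : Weierstrass) (E : EllipticCurve) : Set where
  open Weierstrass W
  open EllipticCurve E
  field
    u r s t : ℚ
    u≢0 : u ≢ 0ℚ
    eq₁ : u * ι a₁ ≡ ι (+ 2) * s
    eq₂ : u * u * ι a₂ ≡ a + ι (+ 3) * r - s * s
    eq₃ : u * u * u * ι a₃ ≡ ι (+ 2) * t
    eq₄ : u * u * u * u * ι a₄ ≡ b + ι (+ 2) * (r * a) + ι (+ 3) * (r * r) - ι (+ 2) * (s * t)
    eq₆ : u * u * u * u * u * u * ι a₆ ≡ c + r * b + r * r * a + r * r * r - t * t

data Kodaira : Set where
  I I*                : ℕ → Kodaira
  II III IV IV* III* II* : Kodaira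

-- The number of irreducible components of the geometric special fibre
components : Kodaira → ℕ
components (I zero)    = 1
components (I (suc n)) = suc n
components II          = 1
components III         = 2
components IV          = 3
components (I* n)      = 5 ℕ.+ n
components IV*         = 7
components III*        = 8
components II*         = 9

-- The terminal cases of Tate's algorithm at p.  A model satisfying one of
-- them is minimal at p.  The algorithm's conditions that the polynomials
--   T³ + (a₂/p) T² + (a₄/p²) T + a₆/p³,   Y² + (a₃/pⁱ) Y − a₆/p²ⁱ,
--   (a₂/p) X² + (a₄/pʲ) X + a₆/p²ʲ⁻¹
-- have distinct roots over the algebraic closure of 𝔽ₚ are expressed by their
-- discriminants, cleared of denominators: cubicDisc/p⁶, b₆/p²ⁱ and
-- quadraticDisc/p²ʲ are prime to p.
module _ (p : ℕ) (W : Weierstrass) where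
  open Weierstrass W

  private
    infix 4 _^∣_ _^∤_
    _^∣_ _^∤_ : ℕ → ℤ → Set
    k ^∣ n = + (p ℕ.^ k) ∣ n
    k ^∤ n = ¬ (k ^∣ n)

  data HasType : Kodaira → Set where
    I₀   : 1 ^∤ Δ → HasType (I 0)
    Iₙ   : ∀ n → 1 ^∣ a₃ → 1 ^∣ a₄ → 1 ^∣ a₆ → 1 ^∤ b₂ →
           Valuation p Δ (suc n) → HasType (I (suc n))
    II   : 1 ^∣ a₃ → 1 ^∣ a₄ → 1 ^∣ a₆ → 1 ^∣ b₂ → 2 ^∤ a₆ → HasType II
    III  : 1 ^∣ a₃ → 1 ^∣ a₄ → 2 ^∣ a₆ → 1 ^∣ b₂ → 3 ^∤ b₈ → HasType III
    IV   : 1 ^∣ a₃ → 1 ^∣ a₄ → 2 ^∣ a₆ → 1 ^∣ b₂ → 3 ^∣ b₈ → 3 ^∤ b₆ → HasType IV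
    I₀*  : 1 ^∣ a₁ → 1 ^∣ a₂ → 2 ^∣ a₃ → 2 ^∣ a₄ → 3 ^∣ a₆ →
           7 ^∤ cubicDisc → HasType (I* 0)
    Iₙ*-odd  : ∀ k → 1 ^∣ a₁ → 1 ^∣ a₂ → 2 ^∤ a₂ →
           2 ℕ.+ k ^∣ a₃ → 3 ℕ.+ k ^∣ a₄ → 4 ℕ.+ 2 ℕ.* k ^∣ a₆ →
           5 ℕ.+ 2 ℕ.* k ^∤ b₆ → HasType (I* (1 ℕ.+ 2 ℕ.* k))
    Iₙ*-even : ∀ k → 1 ^∣ a₁ → 1 ^∣ a₂ → 2 ^∤ a₂ →
           3 ℕ.+ k ^∣ a₃ → 3 ℕ.+ k ^∣ a₄ → 5 ℕ.+ 2 ℕ.* k ^∣ a₆ →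
           7 ℕ.+ 2 ℕ.* k ^∤ quadraticDisc → HasType (I* (2 ℕ.+ 2 ℕ.* k))
    IV*  : 1 ^∣ a₁ → 2 ^∣ a₂ → 2 ^∣ a₃ → 3 ^∣ a₄ → 4 ^∣ a₆ → 5 ^∤ b₆ → HasType IV*
    III* : 1 ^∣ a₁ → 2 ^∣ a₂ → 3 ^∣ a₃ → 3 ^∣ a₄ → 5 ^∣ a₆ → 4 ^∤ a₄ → HasType III*
    II*  : 1 ^∣ a₁ → 2 ^∣ a₂ → 3 ^∣ a₃ → 4 ^∣ a₄ → 5 ^∣ a₆ → 6 ^∤ a₆ → HasType II*

-- Ogg's formula: f = v(Δ) − m + 1 for a minimal model, where m is the number
-- of components.
ConductorExponent : EllipticCurve → ℕ → ℕ → Set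
ConductorExponent E p f =
  ∃[ W ] W IsIntegralModelOf E × (∃[ K ] HasType p W K ×
    (∃[ v ] Valuation p (Weierstrass.Δ W) v × f ℕ.+ components K ≡ v ℕ.+ 1))

IsConductor : EllipticCurve → ℕ → Set
IsConductor E N =
  ∀ p → Prime p → ∃[ f ] ConductorExponent E p f × Valuation p (+ N) f

-- Since rank is a relation, the equation between ranks includes that the two
-- ranks exist (the Mordell–Weil theorem).  The condition that the discriminant
-- of ℚ(√d) is coprime to N matters only if N is even and d ≡ 3 (mod 4):
-- there χ d (- N) = 0, and the equation would be (-1)^r′ = 0.
ParityConjecture : Set
ParityConjecture =
  ∀ E N → IsConductor E N →
  ∀ d → Squarefree d → Coprime d (+ (2 ℕ.* N)) → Coprime (fieldDiscriminant d) (+ N) →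
  ∃[ r′ ] ∃[ r ] HasRank (twist E d) r′ × HasRank (curve E) r ×
    -1ℤ ℤ.^ r′ ≡ -1ℤ ℤ.^ r ℤ.* χ d (ℤ.- (+ N))

{-# OPTIONS --safe #-}
module Submission where

-- If d ≡ 1 (mod 8N), then χ_d(-N) is the sign of d.  So take squarefree d > 0
-- and d′ < 0, both ≡ 1 (mod 8N) and ≡ m (mod p).  If both twists had rank 0,
-- then the rank of E would be even by the parity conjecture for d and odd by
-- that for d′.
--
-- Squarefree numbers in the progression a + n M, with a prime to M and M even,
-- are found by counting: at most T/k² + 1 of the terms with n < T are divisible
-- by k², and Σ 1/k² over k ≥ 3 is at most 1/2.
--
-- The parity conjecture supplies its own rank of E for d and for d′, so the rank
-- must be shown to be unique, and this needs the associativity of the chord-tangent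
-- law.  The class of the ideal κ P = ⟨ x - x_P ∣ y - y_P ⟩ of the coordinate ring
-- turns ⊕ into multiplication of ideals, because a line y = ℓ(x) through P, Q and
-- ⊖ (P ⊕ Q) satisfies (y - ℓ)(y + ℓ) = (x - x_P)(x - x_Q)(x - x_{P ⊕ Q}).  It is
-- injective: if κ P ∼ κ Q, then κ P κ(⊖ Q) has a generator whose norm has degree 2,
-- and since p² - g q² has degree at least 3 for q ≠ 0, that generator is a linear
-- polynomial in x alone, which forces P = Q.

open import Level using (0ℓ)
open import Algebra.Bundles using (AbelianGroup; CommutativeRing)
import Algebra.Properties.CommutativeMonoid.Sum as CommutativeMonoidSum
import Algebra.Properties.Semiring.Sum as SemiringSum
open import Data.Empty using (⊥; ⊥-elim)
open import Data.Fin using (Fin; zero; suc; toℕ; punchIn)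
open import Data.Fin.Properties using (all?; any?; ¬∀⟶∃¬)
open import Data.Integer as ℤ using (ℤ; +_; -[1+_]; 0ℤ; 1ℤ; -1ℤ; ∣_∣)
import Data.Integer.Properties as ℤₚ
open import Data.Integer.Solver using () renaming (module +-*-Solver to ℤ-Solver)
open import Data.Nat as ℕ using (ℕ; zero; suc; NonZero)
import Data.Nat.Properties as ℕₚ
open import Data.Product using (Σ-syntax; ∃-syntax; _×_; _,_; proj₁; proj₂)
open import Data.Sum using (_⊎_; inj₁; inj₂; [_,_]′; map₂)
open import Data.Vec.Functional using (Vector; _∷_; insertAt)
open import Data.Vec.Functional.Properties using (insertAt-lookup; insertAt-punchIn)
open import Relation.Binary.Definitions using (tri<; tri≈; tri>)
open import Relation.Binary.PropositionalEquality as ≡ using (_≡_; _≢_)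
open import Relation.Nullary using (¬_; Dec; yes; no; does; ¬?; contradiction)
open import Relation.Nullary.Decidable using (recompute; dec-true; dec-false)

-- Ideals

-- The modulus 8N rather than N serves the prime 2: it makes (d/2) = 1, and it gives d ≡ 1 (mod 4),
-- so that the field discriminant is d itself and is prime to N. Which of the two twists has
-- positive rank is read off from the ranks that `ParityConjecture` supplies; each finite list to be
-- avoided gets its own pair d, d′.
--
-- Only ranks of E itself are ever compared, so the group law is treated for δ = 1 alone. The theory
-- of class groups is bypassed: no fractional ideals and no Dedekind property occur. Two ideals are
-- equivalent when regular multiples of them agree, and each ideal identity comes down to writing
-- one element as an explicit combination of products of generators. Polynomials are functions on ℚ,
-- which turns ring identities into pointwise ones, at the price of proving that a degree is
-- determined by the function; finite differences do that.

module Ideals (R : CommutativeRing 0ℓ 0ℓ) where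
  open CommutativeRing R
  open import Algebra.Properties.CommutativeSemigroup *-commutativeSemigroup
    using (interchange; x∙yz≈y∙xz)
  open import Relation.Binary.Reasoning.Setoid setoid

  cancellative : ∀ {f} → (∀ {x} → f * x ≈ 0# → x ≈ 0#) → ∀ {x y} → f * x ≈ f * y → x ≈ y
  cancellative {f} c {x} {y} e = x∙y⁻¹≈ε⇒x≈y x y (c (begin
    f * (x - y)     ≈⟨ distribˡ f x (- y) ⟩
    f * x + f * - y ≈⟨ +-congˡ (-‿distribʳ-* f y) ⟨
    f * x - f * y   ≈⟨ x≈y⇒x∙y⁻¹≈ε e ⟩
    0#              ∎))
    where open import Algebra.Properties.Ring ring using (x∙y⁻¹≈ε⇒x≈y; x≈y⇒x∙y⁻¹≈ε; -‿distribʳ-*)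

  record Ideal : Set₁ where
    no-eta-equality
    field
      Mem      : Carrier → Set
      resp     : ∀ {x y} → x ≈ y → Mem x → Mem y
      0-mem    : Mem 0#
      +-closed : ∀ {x y} → Mem x → Mem y → Mem (x + y)
      *-closed : ∀ r {x} → Mem x → Mem (r * x)

  open Ideal

  infix 4 _∈_ _⊆_ _≐_
  _∈_ : Carrier → Ideal → Set
  x ∈ I = Mem I x

  _⊆_ : Ideal → Ideal → Set
  I ⊆ J = ∀ {x} → x ∈ I → x ∈ J

  record _≐_ (I J : Ideal) : Set where
    constructor ⊆-antisym
    field
      ⊆-to   : I ⊆ J
      ⊆-from : J ⊆ I

  open _≐_ public

  ≐-refl : ∀ {I} → I ≐ I
  ≐-refl = ⊆-antisym (λ m → m) (λ m → m)

  ≐-sym : ∀ {I J} → I ≐ J → J ≐ I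
  ≐-sym (⊆-antisym f g) = ⊆-antisym g f

  ≐-trans : ∀ {I J K} → I ≐ J → J ≐ K → I ≐ K
  ≐-trans (⊆-antisym f g) (⊆-antisym f′ g′) = ⊆-antisym (λ m → f′ (f m)) (λ m → g (g′ m))

  ⟨_⟩ : Carrier → Ideal
  ⟨ a ⟩ .Mem x = ∃[ s ] x ≈ a * s
  ⟨ a ⟩ .resp e (s , e′) = s , trans (sym e) e′
  ⟨ a ⟩ .0-mem = 0# , sym (zeroʳ a)
  ⟨ a ⟩ .+-closed (s , e) (s′ , e′) = s + s′ , trans (+-cong e e′) (sym (distribˡ a s s′))
  ⟨ a ⟩ .*-closed r (s , e) = r * s , trans (*-congˡ e) (x∙yz≈y∙xz r a s)

  ⟨_∣_⟩ : Carrier → Carrier → Ideal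
  ⟨ a ∣ b ⟩ .Mem x = ∃[ s ] ∃[ t ] x ≈ a * s + b * t
  ⟨ a ∣ b ⟩ .resp e (s , t , e′) = s , t , trans (sym e) e′
  ⟨ a ∣ b ⟩ .0-mem = 0# , 0# , sym (trans (+-cong (zeroʳ a) (zeroʳ b)) (+-identityʳ 0#))
  ⟨ a ∣ b ⟩ .+-closed {x} {y} (s , t , e) (s′ , t′ , e′) = s + s′ , t + t′ , (begin
    x + y                             ≈⟨ +-cong e e′ ⟩
    (a * s + b * t) + (a * s′ + b * t′) ≈⟨ +-interchange _ _ _ _ ⟩
    (a * s + a * s′) + (b * t + b * t′) ≈⟨ +-cong (distribˡ a s s′) (distribˡ b t t′) ⟨
    a * (s + s′) + b * (t + t′)       ∎)
    where open import Algebra.Properties.CommutativeSemigroup +-commutativeSemigroup renaming (interchange to +-interchange) using ()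
  ⟨ a ∣ b ⟩ .*-closed r {x} (s , t , e) = r * s , r * t , (begin
    r * x                     ≈⟨ *-congˡ e ⟩
    r * (a * s + b * t)       ≈⟨ distribˡ r _ _ ⟩
    r * (a * s) + r * (b * t) ≈⟨ +-cong (x∙yz≈y∙xz r a s) (x∙yz≈y∙xz r b t) ⟩
    a * (r * s) + b * (r * t) ∎)

  left-generator : ∀ {a b} → a ∈ ⟨ a ∣ b ⟩
  left-generator {a} {b} = 1# , 0# , sym (trans (+-cong (*-identityʳ a) (zeroʳ b)) (+-identityʳ a))

  right-generator : ∀ {a b} → b ∈ ⟨ a ∣ b ⟩
  right-generator {a} {b} = 0# , 1# , sym (trans (+-cong (zeroʳ a) (*-identityʳ b)) (+-identityˡ b))

  ⟨⟩-⊆ : ∀ {a} I → a ∈ I → ⟨ a ⟩ ⊆ I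
  ⟨⟩-⊆ {a} I a∈I (s , e) = resp I (trans (*-comm s a) (sym e)) (*-closed I s a∈I)

  ⟨∣⟩-⊆ : ∀ {a b} I → a ∈ I → b ∈ I → ⟨ a ∣ b ⟩ ⊆ I
  ⟨∣⟩-⊆ {a} {b} I a∈I b∈I (s , t , e) =
    resp I (trans (+-cong (*-comm s a) (*-comm t b)) (sym e))
      (+-closed I (*-closed I s a∈I) (*-closed I t b∈I))

  -- Finite sums of products, kept as binary trees, so that an inclusion need only be checked on
  -- single products (`⊙-least`).
  data Product (I J : Ideal) : Carrier → Set where
    product : ∀ {x y z} → x ∈ I → y ∈ J → z ≈ x * y → Product I J z
    sum     : ∀ {x y z} → Product I J x → Product I J y → z ≈ x + y → Product I J z

  infixl 7 _⊙_
  _⊙_ : Ideal → Ideal → Ideal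
  (I ⊙ J) .Mem = Product I J
  (I ⊙ J) .resp e (product i j e′) = product i j (trans (sym e) e′)
  (I ⊙ J) .resp e (sum m n e′) = sum m n (trans (sym e) e′)
  (I ⊙ J) .0-mem = product (0-mem I) (0-mem J) (sym (zeroʳ 0#))
  (I ⊙ J) .+-closed m n = sum m n refl
  (I ⊙ J) .*-closed r (product i j e) =
    product (*-closed I r i) j (trans (*-congˡ e) (sym (*-assoc r _ _)))
  (I ⊙ J) .*-closed r (sum m n e) =
    sum (*-closed (I ⊙ J) r m) (*-closed (I ⊙ J) r n) (trans (*-congˡ e) (distribˡ r _ _))

  ⊙-least : ∀ {I J} K → (∀ {x y} → x ∈ I → y ∈ J → x * y ∈ K) → I ⊙ J ⊆ K
  ⊙-least K f (product i j e) = resp K (sym e) (f i j)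
  ⊙-least K f (sum m n e)     = resp K (sym e) (+-closed K (⊙-least K f m) (⊙-least K f n))

  ⊙-mem : ∀ {I J x y} → x ∈ I → y ∈ J → x * y ∈ I ⊙ J
  ⊙-mem i j = product i j refl

  ⊙-⊆ˡ : ∀ {I J} → I ⊙ J ⊆ I
  ⊙-⊆ˡ {I} = ⊙-least I (λ {_} {y} i _ → resp I (*-comm y _) (*-closed I y i))

  ⊙-⊆ʳ : ∀ {I J} → I ⊙ J ⊆ J
  ⊙-⊆ʳ {I} {J} = ⊙-least J (λ {x} _ j → *-closed J x j)

  ⊙-mono : ∀ {I I′ J J′} → I ⊆ I′ → J ⊆ J′ → I ⊙ J ⊆ I′ ⊙ J′
  ⊙-mono {I′ = I′} {J′ = J′} f g = ⊙-least (I′ ⊙ J′) (λ i j → ⊙-mem (f i) (g j))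

  ⊙-cong : ∀ {I I′ J J′} → I ≐ I′ → J ≐ J′ → I ⊙ J ≐ I′ ⊙ J′
  ⊙-cong {I} {I′} {J} {J′} (⊆-antisym f f′) (⊆-antisym g g′) =
    ⊆-antisym (⊙-mono {I} {I′} {J} {J′} f g) (⊙-mono {I′} {I} {J′} {J} f′ g′)

  ⊙-comm : ∀ I J → I ⊙ J ≐ J ⊙ I
  ⊙-comm I J = ⊆-antisym (swap I J) (swap J I)
    where
    swap : ∀ I J → I ⊙ J ⊆ J ⊙ I
    swap I J = ⊙-least (J ⊙ I) (λ i j → product j i (*-comm _ _))

  ⊙-assoc : ∀ I J K → (I ⊙ J) ⊙ K ≐ I ⊙ (J ⊙ K)
  ⊙-assoc I J K = ⊆-antisym (⊙-least (I ⊙ (J ⊙ K)) right) (⊙-least ((I ⊙ J) ⊙ K) left)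
    where
    right : ∀ {x y} → x ∈ I ⊙ J → y ∈ K → x * y ∈ I ⊙ (J ⊙ K)
    right (product i j e) k = product i (⊙-mem j k) (trans (*-congʳ e) (*-assoc _ _ _))
    right (sum m n e)     k = sum (right m k) (right n k) (trans (*-congʳ e) (distribʳ _ _ _))
    left : ∀ {x y} → x ∈ I → y ∈ J ⊙ K → x * y ∈ (I ⊙ J) ⊙ K
    left i (product j k e) = product (⊙-mem i j) k (trans (*-congˡ e) (sym (*-assoc _ _ _)))
    left i (sum m n e)     = sum (left i m) (left i n) (trans (*-congˡ e) (distribˡ _ _ _))

  -- Regroups (κ P κ(⊖ P)) (κ Q κ(⊖ Q)) as (κ P κ(⊖ Q)) (κ Q κ(⊖ P)) in `degrees`.
  ⊙-exchange : ∀ I J K L → (I ⊙ J) ⊙ (K ⊙ L) ≐ (I ⊙ L) ⊙ (K ⊙ J)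
  ⊙-exchange I J K L = ≐-trans (⊙-assoc I J (K ⊙ L)) (≐-trans
    (⊙-cong ≐-refl (≐-trans (⊙-comm J (K ⊙ L)) (≐-trans (⊙-cong (⊙-comm K L) ≐-refl) (⊙-assoc L K J))))
    (≐-sym (⊙-assoc I L (K ⊙ J))))

  ⊙-identityˡ : ∀ I → ⟨ 1# ⟩ ⊙ I ≐ I
  ⊙-identityˡ I = ⊆-antisym (⊙-⊆ʳ {⟨ 1# ⟩} {I})
    (λ {x} i → product (1# , sym (*-identityʳ 1#)) i (sym (*-identityˡ x)))

  ⟨⟩-⊙ : ∀ a b → ⟨ a ⟩ ⊙ ⟨ b ⟩ ≐ ⟨ a * b ⟩
  ⟨⟩-⊙ a b = ⊆-antisym
    (⊙-least ⟨ a * b ⟩ (λ { (s , e) (t , e′) → s * t , trans (*-cong e e′) (interchange a s b t) }))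
    (⟨⟩-⊆ (⟨ a ⟩ ⊙ ⟨ b ⟩) (product (self a) (self b) refl))
    where
    self : ∀ a → a ∈ ⟨ a ⟩
    self a = 1# , sym (*-identityʳ a)

  ⟨∣⟩-⊙-⊆ : ∀ {a b c d} I →
    a * c ∈ I → a * d ∈ I → b * c ∈ I → b * d ∈ I → ⟨ a ∣ b ⟩ ⊙ ⟨ c ∣ d ⟩ ⊆ I
  ⟨∣⟩-⊙-⊆ {a} {b} {c} {d} I ac ad bc bd =
    ⊙-least I (λ { {x} {y} (s , t , e) j → resp I (sym (expand e)) (+-closed I
      (*-closed I s (row ac ad j)) (*-closed I t (row bc bd j))) })
    where
    row : ∀ {r y} → r * c ∈ I → r * d ∈ I → y ∈ ⟨ c ∣ d ⟩ → r * y ∈ I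
    row {r} rc rd (s , t , e) = resp I
      (sym (trans (*-congˡ e) (trans (distribˡ r _ _) (+-cong (move c s) (move d t)))))
      (+-closed I (*-closed I s rc) (*-closed I t rd))
      where
      move : ∀ c s → r * (c * s) ≈ s * (r * c)
      move c s = trans (sym (*-assoc r c s)) (*-comm (r * c) s)
    expand : ∀ {x y s t} → x ≈ a * s + b * t → x * y ≈ s * (a * y) + t * (b * y)
    expand {x} {y} {s} {t} e = begin
      x * y                     ≈⟨ *-congʳ e ⟩
      (a * s + b * t) * y       ≈⟨ distribʳ y _ _ ⟩
      a * s * y + b * t * y     ≈⟨ +-cong (move a s) (move b t) ⟩
      s * (a * y) + t * (b * y) ∎
      where
      move : ∀ a s → a * s * y ≈ s * (a * y)
      move a s = trans (*-congʳ (*-comm a s)) (*-assoc s a y)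

  -- Serves to replace the generator y - y_P by the equation of a line through P; two points on one
  -- line then share a generator.
  ⟨∣⟩-shear : ∀ {a b c} r → c ≈ b + a * r → ⟨ a ∣ b ⟩ ≐ ⟨ a ∣ c ⟩
  ⟨∣⟩-shear {a} {b} {c} r e = ⊆-antisym
    (⟨∣⟩-⊆ ⟨ a ∣ c ⟩ left-generator (- r , 1# , (begin
      b                          ≈⟨ +-identityʳ b ⟨
      b + 0#                     ≈⟨ +-congˡ cancelled ⟨
      b + (a * r + a * - r)      ≈⟨ +-assoc b _ _ ⟨
      b + a * r + a * - r        ≈⟨ +-comm _ _ ⟩
      a * - r + (b + a * r)      ≈⟨ +-congˡ (trans (*-identityʳ c) e) ⟨
      a * - r + c * 1#           ∎)))
    (⟨∣⟩-⊆ ⟨ a ∣ b ⟩ left-generator (r , 1# , (begin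
      c                          ≈⟨ e ⟩
      b + a * r                  ≈⟨ +-comm b _ ⟩
      a * r + b                  ≈⟨ +-congˡ (*-identityʳ b) ⟨
      a * r + b * 1#             ∎)))
    where
    cancelled : a * r + a * - r ≈ 0#
    cancelled = trans (sym (distribˡ a r (- r))) (trans (*-congˡ (-‿inverseʳ r)) (zeroʳ a))

  -- The colon ideal (K : r). It turns the inclusion of a multiple of `J` in `K` into an inclusion
  -- of `J` itself.
  quotient : Ideal → Carrier → Ideal
  quotient K r .Mem x = r * x ∈ K
  quotient K r .resp e = resp K (*-congˡ e)
  quotient K r .0-mem = resp K (sym (zeroʳ r)) (0-mem K)
  quotient K r .+-closed m n = resp K (sym (distribˡ r _ _)) (+-closed K m n)
  quotient K r .*-closed s m = resp K (x∙yz≈y∙xz s r _) (*-closed K s m)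

  ⟨⟩⊙-⊆ : ∀ {a J} K → J ⊆ quotient K a → ⟨ a ⟩ ⊙ J ⊆ K
  ⟨⟩⊙-⊆ {a} K f = ⊙-least K λ { {x} {y} (s , e) j →
    resp K (sym (trans (*-congʳ (trans e (*-comm a s))) (*-assoc s a y))) (*-closed K s (f j)) }

  ∈⟨⟩⊙ : ∀ {a J x} → x ∈ J → a * x ∈ ⟨ a ⟩ ⊙ J
  ∈⟨⟩⊙ {a} j = product (1# , sym (*-identityʳ a)) j refl

  ∈⟨⟩⊙⁻¹ : ∀ {a J x} → x ∈ ⟨ a ⟩ ⊙ J → ∃[ y ] y ∈ J × x ≈ a * y
  ∈⟨⟩⊙⁻¹ {a} {J} (product (s , e) j e′) =
    _ , *-closed J s j , trans e′ (trans (*-congʳ e) (*-assoc a s _))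
  ∈⟨⟩⊙⁻¹ {a} {J} (sum m n e) with ∈⟨⟩⊙⁻¹ {J = J} m | ∈⟨⟩⊙⁻¹ {J = J} n
  ... | y , j , e₁ | y′ , j′ , e₂ =
    y + y′ , +-closed J j j′ , trans e (trans (+-cong e₁ e₂) (sym (distribˡ a y y′)))

  -- Since b lies in a J, it is a h with h in J. Any j in J satisfies a j = b s = a h s for some s,
  -- and cancelling a gives j = h s.
  ⟨⟩⊙-cancel : ∀ {a b J} → (∀ {x y} → a * x ≈ a * y → x ≈ y) →
    ⟨ a ⟩ ⊙ J ≐ ⟨ b ⟩ → ∃[ h ] J ≐ ⟨ h ⟩
  ⟨⟩⊙-cancel {a} {b} {J} cancel e with ∈⟨⟩⊙⁻¹ {J = J} (⊆-from e (1# , sym (*-identityʳ b)))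
  ... | h , h∈J , b≈ah = h , ⊆-antisym
    (λ j → let (s , e′) = ⊆-to e (∈⟨⟩⊙ {J = J} j) in
      s , cancel (trans e′ (trans (*-congʳ b≈ah) (*-assoc a h s))))
    (⟨⟩-⊆ J h∈J)

  -- Three collinear points with abscissae x₁, x₂, x₃: here Xᵢ = x − xᵢ, and
  -- w = y − ℓ(x), w′ = y + ℓ(x) satisfy w w′ = X₁ X₂ X₃.
  line-⊙ : ∀ {X₁ X₂ X₃ w w′} → X₃ * (X₁ * X₂) ≈ w * w′ →
    w ∈ ⟨ X₁ ∣ w ⟩ ⊙ ⟨ X₂ ∣ w ⟩ →
    ⟨ X₃ ⟩ ⊙ (⟨ X₁ ∣ w ⟩ ⊙ ⟨ X₂ ∣ w ⟩) ≐ ⟨ w ⟩ ⊙ ⟨ X₃ ∣ w′ ⟩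
  line-⊙ {X₁} {X₂} {X₃} {w} {w′} e w∈ = ⊆-antisym
    (⟨⟩⊙-⊆ {J = ⟨ X₁ ∣ w ⟩ ⊙ ⟨ X₂ ∣ w ⟩} K (⟨∣⟩-⊙-⊆ (quotient K X₃)
      (resp K (sym e) (∈⟨⟩⊙ {J = ⟨ X₃ ∣ w′ ⟩} right-generator))
      (multiple (trans (*-congˡ (*-comm X₁ w)) (x∙yz≈y∙xz X₃ w X₁)))
      (multiple (x∙yz≈y∙xz X₃ w X₂))
      (multiple (x∙yz≈y∙xz X₃ w w))))
    (⟨⟩⊙-⊆ {J = ⟨ X₃ ∣ w′ ⟩} L (⟨∣⟩-⊆ (quotient L w)
      (resp L (*-comm X₃ w) (∈⟨⟩⊙ {J = ⟨ X₁ ∣ w ⟩ ⊙ ⟨ X₂ ∣ w ⟩} w∈))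
      (resp L e (∈⟨⟩⊙ {J = ⟨ X₁ ∣ w ⟩ ⊙ ⟨ X₂ ∣ w ⟩} (⊙-mem {⟨ X₁ ∣ w ⟩} {⟨ X₂ ∣ w ⟩} left-generator left-generator)))))
    where
    K = ⟨ w ⟩ ⊙ ⟨ X₃ ∣ w′ ⟩
    L = ⟨ X₃ ⟩ ⊙ (⟨ X₁ ∣ w ⟩ ⊙ ⟨ X₂ ∣ w ⟩)
    multiple : ∀ {x t} → x ≈ w * (X₃ * t) → x ∈ K
    multiple {x} {t} e = resp K (sym (trans e (*-congˡ (*-comm X₃ t))))
      (∈⟨⟩⊙ {J = ⟨ X₃ ∣ w′ ⟩} (*-closed ⟨ X₃ ∣ w′ ⟩ t left-generator))

  -- Ideal classes without fractions: both sides are multiplied by elements of `S`. For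
  -- transitivity, f I = g J and f′ J = g′ K give f′ f I = g g′ K, which is why `S` must be closed
  -- under products.
  module Classes (S : Carrier → Set) (1∈S : S 1#) (S-* : ∀ {f g} → S f → S g → S (f * g)) where

    infix 4 _∼_
    _∼_ : Ideal → Ideal → Set
    I ∼ J = ∃[ f ] ∃[ g ] S f × S g × (⟨ f ⟩ ⊙ I ≐ ⟨ g ⟩ ⊙ J)

    ≐⇒∼ : ∀ {I J} → I ≐ J → I ∼ J
    ≐⇒∼ e = 1# , 1# , 1∈S , 1∈S , ⊙-cong ≐-refl e

    ∼-sym : ∀ {I J} → I ∼ J → J ∼ I
    ∼-sym (f , g , sf , sg , e) = g , f , sg , sf , ≐-sym e

    ∼-trans : ∀ {I J K} → I ∼ J → J ∼ K → I ∼ K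
    ∼-trans {I} {J} {K} (f , g , sf , sg , e) (f′ , g′ , sf′ , sg′ , e′) =
      f′ * f , g * g′ , S-* sf′ sf , S-* sg sg′ ,
      ≐-trans (split f′ f I) (≐-trans (⊙-cong ≐-refl e) (≐-trans (exchange f′ g J)
        (≐-trans (⊙-cong ≐-refl e′) (≐-sym (split g g′ K)))))
      where
      split : ∀ a b I → ⟨ a * b ⟩ ⊙ I ≐ ⟨ a ⟩ ⊙ (⟨ b ⟩ ⊙ I)
      split a b I = ≐-trans (⊙-cong (≐-sym (⟨⟩-⊙ a b)) ≐-refl) (⊙-assoc ⟨ a ⟩ ⟨ b ⟩ I)
      exchange : ∀ a b I → ⟨ a ⟩ ⊙ (⟨ b ⟩ ⊙ I) ≐ ⟨ b ⟩ ⊙ (⟨ a ⟩ ⊙ I)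
      exchange a b I = ≐-trans (≐-sym (⊙-assoc ⟨ a ⟩ ⟨ b ⟩ I))
        (≐-trans (⊙-cong (⊙-comm ⟨ a ⟩ ⟨ b ⟩) ≐-refl) (⊙-assoc ⟨ b ⟩ ⟨ a ⟩ I))

    ∼-⊙ʳ : ∀ {I J} K → I ∼ J → I ⊙ K ∼ J ⊙ K
    ∼-⊙ʳ {I} {J} K (f , g , sf , sg , e) = f , g , sf , sg ,
      ≐-trans (≐-sym (⊙-assoc ⟨ f ⟩ I K)) (≐-trans (⊙-cong e ≐-refl) (⊙-assoc ⟨ g ⟩ J K))

    ∼-⊙ˡ : ∀ {I J} K → I ∼ J → K ⊙ I ∼ K ⊙ J
    ∼-⊙ˡ {I} {J} K e =
      ∼-trans (≐⇒∼ (⊙-comm K I)) (∼-trans (∼-⊙ʳ K e) (≐⇒∼ (⊙-comm J K)))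

-- Linear independence in abelian groups

open SemiringSum ℤₚ.+-*-semiring using () renaming
  (sum to ∑; sum-cong-≗ to ∑-cong; sum-remove to ∑-remove; ∑-distrib-+ to ∑-+;
   *-distribˡ-sum to *-∑; *-distribʳ-sum to ∑-*; sum-replicate-zero to ∑-0)


-- A nonzero integer vector in the left kernel of A: the rows are indexed by the unknowns, the
-- columns by the equations.
NonzeroSolution : ∀ {r s} → (Fin s → Fin r → ℤ) → Set
NonzeroSolution {s = s} A =
  Σ[ t ∈ Vector ℤ s ] (∃[ j ] t j ≢ 0ℤ) × (∀ i → ∑ (λ j → t j ℤ.* A j i) ≡ 0ℤ)

module Elimination {r s} (A : Fin (suc s) → Fin (suc r) → ℤ) (j₀ : Fin (suc s)) where
  pivot : ℤ
  pivot = A j₀ zero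

  -- Fraction-free elimination: a row is scaled by the pivot before the multiple of row `j₀` that
  -- clears its first entry is subtracted, so all entries stay in ℤ.
  reduced : Fin s → Fin r → ℤ
  reduced j i = pivot ℤ.* A (punchIn j₀ j) (suc i) ℤ.- A (punchIn j₀ j) zero ℤ.* A j₀ (suc i)

  module _ (t : Vector ℤ s) where
    term : Fin (suc r) → Vector ℤ s
    term i j = t j ℤ.* A (punchIn j₀ j) i

    column : Fin (suc r) → ℤ
    column i = ∑ (term i)

    -- Scaling the other coefficients by the pivot allows the coefficient of row `j₀` to be the
    -- integer that cancels the first column.
    lift : Vector ℤ (suc s)
    lift = insertAt (λ j → pivot ℤ.* t j) j₀ (ℤ.- column zero)

    lift-column : ∀ i → ∑ (λ j → lift j ℤ.* A j i) ≡ pivot ℤ.* column i ℤ.- column zero ℤ.* A j₀ i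
    lift-column i = begin
      ∑ (λ j → lift j ℤ.* A j i)
        ≡⟨ ∑-remove {i = j₀} (λ j → lift j ℤ.* A j i) ⟩
      lift j₀ ℤ.* A j₀ i ℤ.+ ∑ (λ j → lift (punchIn j₀ j) ℤ.* A (punchIn j₀ j) i)
        ≡⟨ ≡.cong₂ ℤ._+_ (≡.cong (ℤ._* A j₀ i) (insertAt-lookup _ j₀ _)) (∑-cong λ j →
             ≡.trans (≡.cong (ℤ._* A (punchIn j₀ j) i) (insertAt-punchIn _ j₀ _ j)) (ℤₚ.*-assoc pivot (t j) _)) ⟩
      ℤ.- column zero ℤ.* A j₀ i ℤ.+ ∑ (λ j → pivot ℤ.* (t j ℤ.* A (punchIn j₀ j) i))
        ≡⟨ ≡.cong (λ t → ℤ.- column zero ℤ.* A j₀ i ℤ.+ t) (*-∑ pivot (term i)) ⟨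
      ℤ.- column zero ℤ.* A j₀ i ℤ.+ pivot ℤ.* column i
        ≡⟨ ℤ-Solver.solve 4 (λ p q c a → (:- c) :* a :+ p :* q := p :* q :- c :* a) ≡.refl
             pivot (column i) (column zero) (A j₀ i) ⟩
      pivot ℤ.* column i ℤ.- column zero ℤ.* A j₀ i ∎
      where
      open ≡.≡-Reasoning
      open ℤ-Solver

    reduced-column : ∀ i → ∑ (λ j → t j ℤ.* reduced j i) ≡ pivot ℤ.* column (suc i) ℤ.- column zero ℤ.* A j₀ (suc i)
    reduced-column i = begin
      ∑ (λ j → t j ℤ.* reduced j i)
        ≡⟨ (∑-cong λ j → ℤ-Solver.solve 5 (λ t p a b c → t :* (p :* a :- b :* c) := p :* (t :* a) :+ t :* b :* (:- c)) ≡.refl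
             (t j) pivot (A (punchIn j₀ j) (suc i)) (A (punchIn j₀ j) zero) (A j₀ (suc i))) ⟩
      ∑ (λ j → pivot ℤ.* (t j ℤ.* A (punchIn j₀ j) (suc i)) ℤ.+ t j ℤ.* A (punchIn j₀ j) zero ℤ.* ℤ.- A j₀ (suc i))
        ≡⟨ ∑-+ (λ j → pivot ℤ.* term (suc i) j) (λ j → term zero j ℤ.* ℤ.- A j₀ (suc i)) ⟩
      ∑ (λ j → pivot ℤ.* term (suc i) j) ℤ.+ ∑ (λ j → term zero j ℤ.* ℤ.- A j₀ (suc i))
        ≡⟨ ≡.cong₂ ℤ._+_ (*-∑ pivot (term (suc i))) (∑-* (ℤ.- A j₀ (suc i)) (term zero)) ⟨
      pivot ℤ.* column (suc i) ℤ.+ column zero ℤ.* ℤ.- A j₀ (suc i)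
        ≡⟨ ℤ-Solver.solve 4 (λ p q c a → p :* q :+ c :* (:- a) := p :* q :- c :* a) ≡.refl
             pivot (column (suc i)) (column zero) (A j₀ (suc i)) ⟩
      pivot ℤ.* column (suc i) ℤ.- column zero ℤ.* A j₀ (suc i) ∎
      where
      open ≡.≡-Reasoning
      open ℤ-Solver

  lift-solves : pivot ≢ 0ℤ → NonzeroSolution reduced → NonzeroSolution A
  lift-solves p≢0 (t , (j , tj≢0) , solves) = lift t , (punchIn j₀ j , nonzero) , λ where
      zero    → ≡.trans (lift-column t zero) (≡.trans
                  (≡.cong (λ u → u ℤ.- column t zero ℤ.* pivot) (ℤₚ.*-comm pivot (column t zero)))
                  (ℤₚ.+-inverseʳ (column t zero ℤ.* pivot)))
      (suc i) → ≡.trans (lift-column t (suc i)) (≡.trans (≡.sym (reduced-column t i)) (solves i))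
    where
    nonzero : lift t (punchIn j₀ j) ≢ 0ℤ
    nonzero e = [ p≢0 , tj≢0 ]′ (ℤₚ.i*j≡0⇒i≡0∨j≡0 pivot
      (≡.trans (≡.sym (insertAt-punchIn (λ j → pivot ℤ.* t j) j₀ (ℤ.- column t zero) j)) e))

-- Induction on the number of equations. A zero column is an empty equation and is dropped;
-- otherwise a nonzero entry serves as pivot, which removes one equation and one unknown and keeps r
-- < s.
homogeneous-solution : ∀ {r s} → r ℕ.< s → (A : Fin s → Fin r → ℤ) → NonzeroSolution A
homogeneous-solution {zero} {suc s} _ A = (λ _ → 1ℤ) , (zero , λ ()) , λ ()
homogeneous-solution {suc r} {suc s} (ℕ.s≤s r<s) A with all? (λ j → A j zero ℤ.≟ 0ℤ)
... | yes A₀≡0 =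
  let (t , t≢0 , solves) = homogeneous-solution (ℕₚ.m≤n⇒m≤1+n r<s) (λ j i → A j (suc i)) in
  t , t≢0 , λ where
    zero    → ≡.trans (∑-cong λ j → ≡.trans (≡.cong (t j ℤ.*_) (A₀≡0 j)) (ℤₚ.*-zeroʳ (t j))) (∑-0 (suc s))
    (suc i) → solves i
... | no A₀≢0 =
  let (j₀ , p≢0) = ¬∀⟶∃¬ (suc s) (λ j → A j zero ≡ 0ℤ) (λ j → A j zero ℤ.≟ 0ℤ) A₀≢0 in
  Elimination.lift-solves A j₀ p≢0 (homogeneous-solution r<s (Elimination.reduced A j₀))

module Independence (G : AbelianGroup 0ℓ 0ℓ) where
  open AbelianGroup G
  open import Algebra.Properties.AbelianGroup G using (⁻¹-∙-comm; ε⁻¹≈ε; inverseˡ-unique)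
  open import Algebra.Properties.CommutativeMonoid.Sum commutativeMonoid
    using (sum; sum-cong-≋; ∑-distrib-+; ∑-comm; sum-replicate-zero)
  open import Algebra.Properties.CommutativeMonoid.Mult commutativeMonoid
    using (×-homo-+; ×-congʳ; ×-distrib-+) renaming (_×_ to _×ᴳ_)
  open import Algebra.Properties.CommutativeSemigroup commutativeSemigroup using (interchange)
  open import Relation.Binary.Reasoning.Setoid setoid

  infixr 8 _·_
  _·_ : ℤ → Carrier → Carrier
  (+ n)    · x = n ×ᴳ x
  -[1+ n ] · x = (suc n ×ᴳ x) ⁻¹

  ·-congˡ : ∀ n {x y} → x ≈ y → n · x ≈ n · y
  ·-congˡ (+ n)    e = ×-congʳ n e
  ·-congˡ -[1+ n ] e = ⁻¹-cong (×-congʳ (suc n) e)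

  ·-∙ : ∀ n x y → n · (x ∙ y) ≈ n · x ∙ n · y
  ·-∙ (+ n)    x y = ×-distrib-+ x y n
  ·-∙ -[1+ n ] x y = trans (⁻¹-cong (×-distrib-+ x y (suc n))) (sym (⁻¹-∙-comm _ _))

  ⊖-· : ∀ m n x → (m ℤ.⊖ n) · x ≈ m ×ᴳ x ∙ (n ×ᴳ x) ⁻¹
  ⊖-· m zero x = sym (trans (∙-congˡ ε⁻¹≈ε) (identityʳ _))
  ⊖-· zero (suc n) x = sym (identityˡ _)
  ⊖-· (suc m) (suc n) x = begin
    (suc m ℤ.⊖ suc n) · x                 ≡⟨ ≡.cong (_· x) (ℤₚ.[1+m]⊖[1+n]≡m⊖n m n) ⟩
    (m ℤ.⊖ n) · x                         ≈⟨ ⊖-· m n x ⟩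
    m ×ᴳ x ∙ (n ×ᴳ x) ⁻¹                  ≈⟨ identityˡ _ ⟨
    ε ∙ (m ×ᴳ x ∙ (n ×ᴳ x) ⁻¹)            ≈⟨ ∙-congʳ (inverseʳ x) ⟨
    (x ∙ x ⁻¹) ∙ (m ×ᴳ x ∙ (n ×ᴳ x) ⁻¹)   ≈⟨ interchange _ _ _ _ ⟩
    (x ∙ m ×ᴳ x) ∙ (x ⁻¹ ∙ (n ×ᴳ x) ⁻¹)   ≈⟨ ∙-congˡ (⁻¹-∙-comm _ _) ⟩
    (x ∙ m ×ᴳ x) ∙ (x ∙ n ×ᴳ x) ⁻¹        ∎

  +-· : ∀ m n x → (m ℤ.+ n) · x ≈ m · x ∙ n · x
  +-· (+ m)    (+ n)    x = ×-homo-+ x m n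
  +-· (+ m)    -[1+ n ] x = ⊖-· m (suc n) x
  +-· -[1+ m ] (+ n)    x = trans (⊖-· n (suc m) x) (comm _ _)
  +-· -[1+ m ] -[1+ n ] x = begin
    (suc (suc (m ℕ.+ n)) ×ᴳ x) ⁻¹        ≡⟨ ≡.cong (λ k → (suc k ×ᴳ x) ⁻¹) (ℕₚ.+-suc m n) ⟨
    ((suc m ℕ.+ suc n) ×ᴳ x) ⁻¹          ≈⟨ ⁻¹-cong (×-homo-+ x (suc m) (suc n)) ⟩
    (suc m ×ᴳ x ∙ suc n ×ᴳ x) ⁻¹         ≈⟨ ⁻¹-∙-comm _ _ ⟨
    (suc m ×ᴳ x) ⁻¹ ∙ (suc n ×ᴳ x) ⁻¹    ∎

  neg-· : ∀ n x → (ℤ.- n) · x ≈ (n · x) ⁻¹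
  neg-· n x = inverseˡ-unique _ _ (begin
    (ℤ.- n) · x ∙ n · x ≈⟨ +-· (ℤ.- n) n x ⟨
    (ℤ.- n ℤ.+ n) · x   ≡⟨ ≡.cong (_· x) (ℤₚ.+-inverseˡ n) ⟩
    ε                   ∎)

  *-· : ∀ m n x → (m ℤ.* n) · x ≈ m · (n · x)
  *-· m n x = go m
    where
    natural : ∀ m → (+ m ℤ.* n) · x ≈ m ×ᴳ (n · x)
    natural zero    = reflexive (≡.cong (_· x) (ℤₚ.*-zeroˡ n))
    natural (suc m) = begin
      (+ suc m ℤ.* n) · x     ≡⟨ ≡.cong (_· x) (ℤₚ.suc-* (+ m) n) ⟩
      (n ℤ.+ + m ℤ.* n) · x   ≈⟨ +-· n (+ m ℤ.* n) x ⟩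
      n · x ∙ (+ m ℤ.* n) · x ≈⟨ ∙-congˡ (natural m) ⟩
      n · x ∙ m ×ᴳ (n · x)    ∎
    go : ∀ m → (m ℤ.* n) · x ≈ m · (n · x)
    go (+ m)    = natural m
    go -[1+ m ] = begin
      (-[1+ m ] ℤ.* n) · x       ≡⟨ ≡.cong (_· x) (ℤₚ.neg-distribˡ-* (+ suc m) n) ⟨
      (ℤ.- (+ suc m ℤ.* n)) · x  ≈⟨ neg-· (+ suc m ℤ.* n) x ⟩
      ((+ suc m ℤ.* n) · x) ⁻¹   ≈⟨ ⁻¹-cong (natural (suc m)) ⟩
      (suc m ×ᴳ (n · x)) ⁻¹      ∎

  -- `ε` is `0ℤ · ε` by computation, so this is an instance of `*-·`.
  ·-ε : ∀ n → n · ε ≈ ε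
  ·-ε n = trans (sym (*-· n 0ℤ ε)) (reflexive (≡.cong (_· ε) (ℤₚ.*-zeroʳ n)))

  ·-sum : ∀ n {s} (f : Vector Carrier s) → n · sum f ≈ sum (λ j → n · f j)
  ·-sum n {zero}  f = ·-ε n
  ·-sum n {suc s} f = trans (·-∙ n _ _) (∙-congˡ (·-sum n (λ j → f (suc j))))

  ∑-· : ∀ {s} (t : Vector ℤ s) x → ∑ t · x ≈ sum (λ j → t j · x)
  ∑-· {zero}  t x = refl
  ∑-· {suc s} t x = trans (+-· (t zero) _ x) (∙-congˡ (∑-· (λ j → t (suc j)) x))

  combination : ∀ {r} → Vector ℤ r → Vector Carrier r → Carrier
  combination n P = sum (λ i → n i · P i)

  Independent : ∀ {r} → Vector Carrier r → Set
  Independent P = ∀ n → combination n P ≈ ε → ∀ i → n i ≡ 0ℤ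

  Dependent : ∀ {r} → Vector Carrier r → Set
  Dependent P = ∃[ n ] combination n P ≈ ε × (∃[ i ] n i ≢ 0ℤ)

  -- The coefficient of Q cannot vanish, since the relation would then be one among the independent
  -- P.
  multiple-in-span : ∀ {r} {P : Vector Carrier r} → Independent P → ∀ {Q} → Dependent (Q ∷ P) →
    ∃[ k ] ∃[ n ] k ≢ 0ℤ × k · Q ≈ combination n P
  multiple-in-span {P = P} indep {Q} (n , vanishes , i , nᵢ≢0) =
    n zero , (λ i → ℤ.- n (suc i)) , n₀≢0 i nᵢ≢0 , (begin
      n zero · Q                                        ≈⟨ inverseˡ-unique _ _ vanishes ⟩
      combination (λ i → n (suc i)) P ⁻¹                ≈⟨ sum-⁻¹ (λ i → n (suc i) · P i) ⟩
      sum (λ i → (n (suc i) · P i) ⁻¹)                  ≈⟨ sum-cong-≋ (λ i → neg-· (n (suc i)) (P i)) ⟨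
      combination (λ i → ℤ.- n (suc i)) P               ∎)
    where
    sum-⁻¹ : ∀ {s} (f : Vector Carrier s) → sum f ⁻¹ ≈ sum (λ i → f i ⁻¹)
    sum-⁻¹ {zero}  f = ε⁻¹≈ε
    sum-⁻¹ {suc s} f = trans (sym (⁻¹-∙-comm _ _)) (∙-congˡ (sum-⁻¹ (λ i → f (suc i))))
    tail-vanishes : n zero ≡ 0ℤ → combination (λ i → n (suc i)) P ≈ ε
    tail-vanishes n₀≡0 = begin
      combination (λ i → n (suc i)) P       ≈⟨ identityˡ _ ⟨
      0ℤ · Q ∙ combination (λ i → n (suc i)) P ≡⟨ ≡.cong (λ k → k · Q ∙ combination (λ i → n (suc i)) P) n₀≡0 ⟨
      combination n (Q ∷ P)                 ≈⟨ vanishes ⟩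
      ε                                     ∎
    n₀≢0 : ∀ i → n i ≢ 0ℤ → n zero ≢ 0ℤ
    n₀≢0 zero    nᵢ≢0 n₀≡0 = nᵢ≢0 n₀≡0
    n₀≢0 (suc i) nᵢ≢0 n₀≡0 = nᵢ≢0 (indep (λ i → n (suc i)) (tail-vanishes n₀≡0) i)

  -- Some nonzero multiple k j · Q j is a combination of P with coefficients A j. If s > r, the rows
  -- A j satisfy a nontrivial relation t, and the products t j k j are then a nontrivial relation
  -- among the Q j.
  independent-≤ : ∀ {r s} {P : Vector Carrier r} {Q : Vector Carrier s} →
    Independent P → (∀ x → Dependent (x ∷ P)) → Independent Q → s ℕ.≤ r
  independent-≤ {r} {s} {P} {Q} indepP spans indepQ with s ℕ.≤? r
  ... | yes s≤r = s≤r
  ... | no s≰r  = ⊥-elim ([ tj≢0 , k≢0 j ]′ (ℤₚ.i*j≡0⇒i≡0∨j≡0 (t j) (indepQ (λ j → t j ℤ.* k j) relation j)))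
    where
    span : ∀ j → ∃[ k ] ∃[ n ] k ≢ 0ℤ × k · Q j ≈ combination n P
    span j = multiple-in-span indepP (spans (Q j))
    k : Vector ℤ s
    k j = proj₁ (span j)
    A : Fin s → Fin r → ℤ
    A j = proj₁ (proj₂ (span j))
    k≢0 : ∀ j → k j ≢ 0ℤ
    k≢0 j = proj₁ (proj₂ (proj₂ (span j)))
    solution = homogeneous-solution (ℕₚ.≰⇒> s≰r) A
    t = proj₁ solution
    j = proj₁ (proj₁ (proj₂ solution))
    tj≢0 = proj₂ (proj₁ (proj₂ solution))
    relation : combination (λ j → t j ℤ.* k j) Q ≈ ε
    relation = begin
      sum (λ j → (t j ℤ.* k j) · Q j)
        ≈⟨ sum-cong-≋ (λ j → trans (*-· (t j) (k j) (Q j)) (·-congˡ (t j) (proj₂ (proj₂ (proj₂ (span j)))))) ⟩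
      sum (λ j → t j · sum (λ i → A j i · P i))
        ≈⟨ sum-cong-≋ (λ j → trans (·-sum (t j) (λ i → A j i · P i)) (sum-cong-≋ (λ i → sym (*-· (t j) (A j i) (P i))))) ⟩
      sum (λ j → sum (λ i → (t j ℤ.* A j i) · P i))
        ≈⟨ ∑-comm (λ j i → (t j ℤ.* A j i) · P i) ⟩
      sum (λ i → sum (λ j → (t j ℤ.* A j i) · P i))
        ≈⟨ sum-cong-≋ (λ i → ∑-· (λ j → t j ℤ.* A j i) (P i)) ⟨
      sum (λ i → ∑ (λ j → t j ℤ.* A j i) · P i)
        ≈⟨ sum-cong-≋ (λ i → reflexive (≡.cong (_· P i) (proj₂ (proj₂ solution) i))) ⟩
      sum {r} (λ i → ε)
        ≈⟨ sum-replicate-zero r ⟩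
      ε ∎

open import Relation.Binary.PropositionalEquality using (refl; sym; trans; cong; cong₂; subst; isEquivalence; module ≡-Reasoning)

-- Squarefree numbers in arithmetic progressions

module Sieve where
  open import Data.Bool using (if_then_else_)
  open import Data.Nat hiding (NonZero; ℕ; zero; suc)
  open import Data.Nat.Coprimality using (Coprime; coprime-divisor)
  open import Data.Nat.Divisibility using (_∣_; _∣?_; ∣-trans; ∣m+n∣m⇒∣n; n∣m*n; ∣⇒≤; m∣m*n; _∣0)
  open import Data.Nat.Properties
  open import Data.Nat.Solver using (module +-*-Solver)
  open +-*-Solver using (solve; _:=_; _:+_; _:*_; con)

  indicator : ∀ {P : Set} → Dec P → ℕ
  indicator P? = if does P? then 1 else 0

  count : {P : ℕ → Set} → (∀ n → Dec (P n)) → ℕ → ℕ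
  count P? zero    = 0
  count P? (suc n) = indicator (P? n) + count P? n

  module _ {P : ℕ → Set} (P? : ∀ n → Dec (P n)) {q : ℕ} (gap : ∀ {m n} → m < n → P m → P n → q + m ≤ n) where

    -- Going down from the hit n, each earlier hit costs a distance of at least q. Keeping the next
    -- hit n as a parameter is what makes the induction on T work.
    count-before : ∀ T {n} → T ≤ n → P n → count P? T * q ≤ n
    count-before zero    _   _  = z≤n
    count-before (suc T) T<n Pn with P? T
    ... | yes PT = ≤-trans (+-monoʳ-≤ q (count-before T ≤-refl PT)) (gap T<n PT Pn)
    ... | no  _  = count-before T (<⇒≤ T<n) Pn

    -- The last hit below T bounds the number of the earlier ones; it alone accounts for the extra
    -- q.
    count-gap : ∀ T → count P? T * q ≤ q + T
    count-gap zero    = z≤n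
    count-gap (suc T) with P? T
    ... | yes PT = +-monoʳ-≤ q (≤-trans (count-before T ≤-refl PT) (n≤1+n T))
    ... | no  _  = ≤-trans (count-gap T) (+-monoʳ-≤ q (n≤1+n T))

  sumTo : (ℕ → ℕ) → ℕ → ℕ
  sumTo f zero    = 0
  sumTo f (suc J) = f J + sumTo f J

  sumTo-+ : ∀ f h J → sumTo (λ j → f j + h j) J ≡ sumTo f J + sumTo h J
  sumTo-+ f h zero    = refl
  sumTo-+ f h (suc J) = trans (cong (λ s → f J + h J + s) (sumTo-+ f h J))
    (solve 4 (λ a b c d → a :+ b :+ (c :+ d) := a :+ c :+ (b :+ d)) refl (f J) (h J) (sumTo f J) (sumTo h J))

  term≤sumTo : ∀ f {j J} → j < J → f j ≤ sumTo f J
  term≤sumTo f {j} {suc J} (s≤s j≤J) with m≤n⇒m<n∨m≡n j≤J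
  ... | inj₁ j<J  = ≤-trans (term≤sumTo f j<J) (m≤n+m (sumTo f J) (f J))
  ... | inj₂ refl = m≤m+n (f J) (sumTo f J)

  module _ {Q : ℕ → ℕ → Set} (Q? : ∀ j n → Dec (Q j n)) where

    -- Double counting of the pairs (j , n) with Q j n: every n < T contributes at least one.
    union-bound : ∀ {J} T → (∀ {n} → n < T → ∃[ j ] j < J × Q j n) → T ≤ sumTo (λ j → count (Q? j) T) J
    union-bound zero _ = z≤n
    union-bound {J} (suc T) covered with covered (n<1+n T)
    ... | j , j<J , QjT = ≤-trans
      (+-mono-≤ (≤-trans (hit (Q? j T) QjT) (term≤sumTo (λ j → indicator (Q? j T)) j<J))
                (union-bound T (λ n<T → covered (m<n⇒m<1+n n<T))))
      (≤-reflexive (sym (sumTo-+ (λ j → indicator (Q? j T)) (λ j → count (Q? j) T) J)))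
      where
      hit : ∀ {P : Set} (P? : Dec P) → P → 1 ≤ indicator P?
      hit (yes _) _ = ≤-refl
      hit (no ¬p) p = ⊥-elim (¬p p)

    -- The search below T is finite and decidable, so the contrapositive of the union bound yields
    -- an actual n.
    uncovered : ∀ J T → sumTo (λ j → count (Q? j) T) J < T → ∃[ n ] n < T × (∀ {j} → j < J → ¬ Q j n)
    uncovered J T few with anyUpTo? (λ n → allUpTo? (λ j → ¬? (Q? j n)) J) T
    ... | yes found = found
    ... | no  none  = ⊥-elim (<⇒≱ few (union-bound T covered))
      where
      covered : ∀ {n} → n < T → ∃[ j ] j < J × Q j n
      covered {n} n<T with anyUpTo? (λ j → Q? j n) J
      ... | yes hit = hit
      ... | no miss = ⊥-elim (none (n , n<T , λ j<J Qjn → miss (_ , j<J , Qjn)))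

  -- Σ 1/k² over k ≥ 3 is bounded by the telescoping sum Σ 1/(k(k-1)) = 1/2.
  telescope : ∀ {T} (f : ℕ → ℕ) → (∀ j → f j * ((3 + j) * (3 + j)) ≤ T) →
    ∀ J → (2 + J) * (2 * sumTo f J) ≤ T * J
  telescope f _ zero = z≤n
  -- The sum of 1/(k(k-1)) over 3 ≤ k ≤ J + 2 is J / (2 (J + 2)). With denominators cleared, the
  -- step rests on (3 + J) J + 2 = (2 + J) (1 + J).
  telescope {T} f small (suc J) = *-cancelˡ-≤ (2 + J) (begin
    (2 + J) * ((3 + J) * (2 * (f J + sumTo f J)))
      ≡⟨ solve 3 (λ J x S → (con 2 :+ J) :* ((con 3 :+ J) :* (con 2 :* (x :+ S))) :=
           (con 3 :+ J) :* ((con 2 :+ J) :* (con 2 :* S)) :+ con 2 :* (x :* ((con 2 :+ J) :* (con 3 :+ J)))) refl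
           J (f J) (sumTo f J) ⟩
    (3 + J) * ((2 + J) * (2 * sumTo f J)) + 2 * (f J * ((2 + J) * (3 + J)))
      ≤⟨ +-mono-≤ (*-monoʳ-≤ (3 + J) (telescope f small J))
           (*-monoʳ-≤ 2 (≤-trans (*-monoʳ-≤ (f J) (*-monoˡ-≤ (3 + J) (n≤1+n (2 + J)))) (small J))) ⟩
    (3 + J) * (T * J) + 2 * T
      ≡⟨ solve 2 (λ J T → (con 3 :+ J) :* (T :* J) :+ con 2 :* T := (con 2 :+ J) :* (T :* (con 1 :+ J))) refl J T ⟩
    (2 + J) * (T * suc J) ∎)
    where open ≤-Reasoning

  -- Each bound T/k² + 1 is split: the J summands 1 give 2 J, and the remaining `c j ∸ 1` are small
  -- enough for `telescope`. Truncation does no harm because c ≤ 1 + (c ∸ 1).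
  sum-reciprocal-squares : ∀ {T} (c : ℕ → ℕ) → (∀ j → c j * ((3 + j) * (3 + j)) ≤ (3 + j) * (3 + j) + T) →
    ∀ J → 2 * sumTo c J ≤ T + 2 * J
  sum-reciprocal-squares {T} c small J = begin
    2 * sumTo c J                      ≤⟨ *-monoʳ-≤ 2 (split J) ⟩
    2 * (sumTo f J + J)                ≡⟨ *-distribˡ-+ 2 (sumTo f J) J ⟩
    2 * sumTo f J + 2 * J              ≤⟨ +-monoˡ-≤ (2 * J) (*-cancelˡ-≤ {2 * sumTo f J} {T} (2 + J) (begin
      (2 + J) * (2 * sumTo f J)          ≤⟨ telescope f smaller J ⟩
      T * J                              ≤⟨ *-monoʳ-≤ T (m≤n+m J 2) ⟩
      T * (2 + J)                        ≡⟨ *-comm T (2 + J) ⟩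
      (2 + J) * T                        ∎)) ⟩
    T + 2 * J                          ∎
    where
    open ≤-Reasoning
    f : ℕ → ℕ
    f j = c j ∸ 1
    split : ∀ J → sumTo c J ≤ sumTo f J + J
    split zero    = z≤n
    split (suc J) = ≤-trans (+-mono-≤ (m≤n+m∸n (c J) 1) (split J))
      (≤-reflexive (solve 3 (λ x S J → con 1 :+ x :+ (S :+ J) := x :+ S :+ (con 1 :+ J)) refl (f J) (sumTo f J) J))
    smaller : ∀ j → f j * ((3 + j) * (3 + j)) ≤ T
    smaller j = begin
      (c j ∸ 1) * q        ≡⟨ *-distribʳ-∸ q (c j) 1 ⟩
      c j * q ∸ 1 * q      ≡⟨ cong (λ s → c j * q ∸ s) (*-identityˡ q) ⟩
      c j * q ∸ q          ≤⟨ ∸-monoˡ-≤ q (small j) ⟩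
      (q + T) ∸ q          ≡⟨ m+n∸m≡n q T ⟩
      T                    ∎
      where q = (3 + j) * (3 + j)

  module _ (a M : ℕ) (coprime : Coprime a M) where

    coprime-value : ∀ n → Coprime (a + n * M) M
    coprime-value n {d} (d∣x , d∣M) =
      coprime (∣m+n∣m⇒∣n (subst (d ∣_) (+-comm a (n * M)) d∣x) (∣-trans d∣M (n∣m*n n)) , d∣M)

    -- q divides the difference (n - m) M of the two terms. It is prime to M because it divides a
    -- term, so it divides n - m.
    divisor-gap : ∀ {q m n} → m < n → q ∣ a + m * M → q ∣ a + n * M → q + m ≤ n
    divisor-gap {q} {m} {n} m<n q∣m q∣n = begin
      q + m       ≤⟨ +-monoˡ-≤ m (∣⇒≤ q∣n∸m) ⟩
      n ∸ m + m   ≡⟨ m∸n+n≡m (<⇒≤ m<n) ⟩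
      n           ∎
      where
      open ≤-Reasoning
      instance
        _ = >-nonZero (m<n⇒0<n∸m m<n)
      coprime-q : Coprime q M
      coprime-q (d∣q , d∣M) = coprime-value m (∣-trans d∣q q∣m , d∣M)
      decomposed : a + n * M ≡ a + m * M + M * (n ∸ m)
      decomposed = begin-equality
        a + n * M                 ≡⟨ cong (λ t → a + t * M) (m+[n∸m]≡n (<⇒≤ m<n)) ⟨
        a + (m + (n ∸ m)) * M     ≡⟨ solve 4 (λ a m t M → a :+ (m :+ t) :* M := a :+ m :* M :+ M :* t) refl a m (n ∸ m) M ⟩
        a + m * M + M * (n ∸ m)   ∎
      q∣n∸m : q ∣ n ∸ m
      q∣n∸m = coprime-divisor coprime-q (∣m+n∣m⇒∣n (subst (q ∣_) decomposed q∣n) q∣m)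

    private
      J T : ℕ
      -- The sieve uses the J squares k² with 3 ≤ k < 3 + J. They hit at most (T + 2 J)/2 indices,
      -- which is less than T as soon as T > 2 J. Since 2 M ≤ J, the terms with n ≤ 2 J stay below
      -- (3 + J)², so no larger k matters.
      J = a + 2 * M
      T = suc (2 * J)

      Q? : ∀ j n → Dec ((3 + j) * (3 + j) ∣ a + n * M)
      Q? j n = (3 + j) * (3 + j) ∣? a + n * M

      few : sumTo (λ j → count (Q? j) T) J < T
      few = *-cancelˡ-< 2 _ _ (begin-strict
        2 * sumTo (λ j → count (Q? j) T) J
          ≤⟨ sum-reciprocal-squares (λ j → count (Q? j) T) (λ j → count-gap (Q? j) divisor-gap T) J ⟩
        T + 2 * J       <⟨ +-monoʳ-< T (n<1+n (2 * J)) ⟩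
        T + T           ≡⟨ cong (λ s → T + s) (+-identityʳ T) ⟨
        2 * T           ∎)
        where open ≤-Reasoning

      values-bounded : ∀ {n} → n < T → a + n * M < (3 + J) * (3 + J)
      values-bounded {n} (s≤s n≤2J) = begin-strict
        a + n * M          ≤⟨ +-monoʳ-≤ a (*-monoˡ-≤ M n≤2J) ⟩
        a + 2 * J * M      <⟨ m<m+n (a + 2 * J * M) (s≤s z≤n) ⟩
        -- The summand is the exact difference to (3 + J)², computed with J² = J a + 2 J M.
        a + 2 * J * M + suc (J * a + 5 * a + 12 * M + 8)
          ≡⟨ solve 2 (λ a M → let J = a :+ con 2 :* M in
               a :+ con 2 :* J :* M :+ (con 1 :+ (J :* a :+ con 5 :* a :+ con 12 :* M :+ con 8))
               := (con 3 :+ J) :* (con 3 :+ J)) refl a M ⟩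
        (3 + J) * (3 + J)  ∎
        where open ≤-Reasoning

    -- The terms are odd because M is even, which excludes k = 0 and k = 2. A sieve that included k
    -- = 2 would have the telescoping bound 1 and leave no index over; from k = 3 on the bound is
    -- 1/2.
    squarefree-in-progression : 2 ∣ M → ∃[ n ] ∀ k → k * k ∣ a + n * M → k ≡ 1
    squarefree-in-progression 2∣M with uncovered Q? J T few
    ... | n , n<T , avoids = n , squarefree
      where
      odd : ¬ 2 ∣ a + n * M
      odd 2∣x with () ← coprime-value n (2∣x , 2∣M)
      instance
        _ = ≢-nonZero {a + n * M} (λ x≡0 → odd (subst (2 ∣_) (sym x≡0) (2 ∣0)))
      squarefree : ∀ k → k * k ∣ a + n * M → k ≡ 1
      squarefree 0 0∣x = ⊥-elim (odd (∣-trans (2 ∣0) 0∣x))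
      squarefree 1 _   = refl
      squarefree 2 4∣x = ⊥-elim (odd (∣-trans (m∣m*n 2) 4∣x))
      squarefree (suc (suc (suc j))) k²∣x with j <? J
      ... | yes j<J = ⊥-elim (avoids j<J k²∣x)
      ... | no  j≮J = ⊥-elim (<⇒≱ (values-bounded n<T)
        (≤-trans (*-mono-≤ (+-monoʳ-≤ 3 (≮⇒≥ j≮J)) (+-monoʳ-≤ 3 (≮⇒≥ j≮J))) (∣⇒≤ k²∣x)))

-- Polynomial functions

module Polynomials where
  open import Data.Rational using (ℚ; 0ℚ; 1ℚ; _+_; _-_; _*_; -_; 1/_; ≢-nonZero; Positive; +-*-rawSemiring)
  open import Data.Rational.Properties using (_≟_; *-inverseˡ; *-assoc; *-identityˡ; *-identityʳ; *-zeroʳ; *-zeroˡ; pos+pos⇒pos)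
  open import Data.Rational.Solver using (module +-*-Solver)
  open import Algebra.Definitions.RawSemiring +-*-rawSemiring using (_^_)
  open +-*-Solver using (solve; _:=_; _:+_; _:-_; _:*_; :-_; con)

  *-cancelˡ-0 : ∀ {s t} → s ≢ 0ℚ → s * t ≡ 0ℚ → t ≡ 0ℚ
  *-cancelˡ-0 {s} {t} s≢0 st≡0 = begin
    t              ≡⟨ *-identityˡ t ⟨
    1ℚ * t         ≡⟨ cong (_* t) (*-inverseˡ s) ⟨
    (1/ s * s) * t ≡⟨ *-assoc (1/ s) s t ⟩
    1/ s * (s * t) ≡⟨ cong (1/ s *_) st≡0 ⟩
    1/ s * 0ℚ      ≡⟨ *-zeroʳ (1/ s) ⟩
    0ℚ             ∎
    where
    open ≡-Reasoning
    instance
      _ = ≢-nonZero s≢0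

  *-≢0 : ∀ {s t} → s ≢ 0ℚ → t ≢ 0ℚ → s * t ≢ 0ℚ
  *-≢0 s≢0 t≢0 e = t≢0 (*-cancelˡ-0 s≢0 e)

  x-y≡0⇒x≡y : ∀ {s t} → s - t ≡ 0ℚ → s ≡ t
  x-y≡0⇒x≡y {s} {t} e = begin
    s            ≡⟨ solve 2 (λ s t → s := (s :- t) :+ t) refl s t ⟩
    (s - t) + t  ≡⟨ cong (_+ t) e ⟩
    0ℚ + t       ≡⟨ solve 1 (λ t → con 0ℚ :+ t := t) refl t ⟩
    t            ∎
    where open ≡-Reasoning

  -- Polynomials are represented by the functions they define on ℚ.
  -- Below n f: f is a polynomial function of degree < n.
  data Below : ℕ → (ℚ → ℚ) → Set where
    zero : ∀ {f} → (∀ x → f x ≡ 0ℚ) → Below 0 f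
    suc  : ∀ {n f h} c → Below n h → (∀ x → f x ≡ c * x ^ n + h x) → Below (suc n) f

  record HasDegree (n : ℕ) (f : ℚ → ℚ) : Set where
    constructor hasDegree
    field
      {rest}   : ℚ → ℚ
      lead     : ℚ
      lead≢0   : lead ≢ 0ℚ
      rest<n   : Below n rest
      expand   : ∀ x → f x ≡ lead * x ^ n + rest x

  below-resp : ∀ {n f h} → (∀ x → h x ≡ f x) → Below n f → Below n h
  below-resp e (zero f0)    = zero λ x → trans (e x) (f0 x)
  below-resp e (suc c B fx) = suc c B λ x → trans (e x) (fx x)

  degree-resp : ∀ {n f h} → (∀ x → h x ≡ f x) → HasDegree n f → HasDegree n h
  degree-resp e (hasDegree c c≢0 B fx) = hasDegree c c≢0 B λ x → trans (e x) (fx x)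

  below-suc : ∀ {n f} → Below n f → Below (suc n) f
  below-suc {n} {f} B = suc 0ℚ B λ x → solve 2 (λ y f → f := con 0ℚ :* y :+ f) refl (x ^ n) (f x)

  below-≤ : ∀ {m n f} → m ℕ.≤ n → Below m f → Below n f
  below-≤ m≤n B = go (ℕₚ.≤⇒≤′ m≤n) B
    where
    go : ∀ {m n f} → m ℕ.≤′ n → Below m f → Below n f
    go ℕ.≤′-refl     B = B
    go (ℕ.≤′-step l) B = below-suc (go l B)

  below-0 : ∀ n → Below n (λ _ → 0ℚ)
  below-0 n = below-≤ {n = n} ℕ.z≤n (zero λ _ → refl)

  below-+ : ∀ {n f h} → Below n f → Below n h → Below n (λ x → f x + h x)
  below-+ (zero f0) (zero h0) = zero λ x → cong₂ _+_ (f0 x) (h0 x)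
  below-+ {suc n} (suc {h = r} c B fx) (suc {h = s} d C hx) = suc (c + d) (below-+ B C) λ x →
    trans (cong₂ _+_ (fx x) (hx x))
      (solve 5 (λ c d y r s → (c :* y :+ r) :+ (d :* y :+ s) := (c :+ d) :* y :+ (r :+ s)) refl
        c d (x ^ n) (r x) (s x))

  below-scale : ∀ {n f} k → Below n f → Below n (λ x → k * f x)
  below-scale k (zero f0) = zero λ x → trans (cong (k *_) (f0 x)) (*-zeroʳ k)
  below-scale {suc n} k (suc {h = r} c B fx) = suc (k * c) (below-scale k B) λ x →
    trans (cong (k *_) (fx x))
      (solve 4 (λ k c y r → k :* (c :* y :+ r) := k :* c :* y :+ k :* r) refl k c (x ^ n) (r x))

  below-x* : ∀ {n f} → Below n f → Below (suc n) (λ x → x * f x)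
  below-x* (zero f0) = below-suc (zero λ x → trans (cong (x *_) (f0 x)) (*-zeroʳ x))
  below-x* {suc n} (suc {h = r} c B fx) = suc c (below-x* B) λ x →
    trans (cong (x *_) (fx x))
      (solve 4 (λ x c y r → x :* (c :* y :+ r) := c :* (x :* y) :+ x :* r) refl x c (x ^ n) (r x))

  below-x^* : ∀ m {n f} → Below n f → Below (m ℕ.+ n) (λ x → x ^ m * f x)
  below-x^* zero    {f = f} B = below-resp (λ x → *-identityˡ (f x)) B
  below-x^* (suc m) {f = f} B =
    below-resp (λ x → *-assoc x (x ^ m) (f x)) (below-x* (below-x^* m B))

  below-* : ∀ {m n f h} → Below m f → Below n h → Below (m ℕ.+ n) (λ x → f x * h x)
  below-* {n = n} {h = h} (zero f0) C =
    below-resp (λ x → trans (cong (_* h x) (f0 x)) (*-zeroˡ (h x))) (below-0 n)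
  below-* {suc m} {h = h} (suc {h = r} c B fx) C = below-suc (below-resp
    (λ x → trans (cong (_* h x) (fx x))
      (solve 4 (λ c y r h → (c :* y :+ r) :* h := c :* (y :* h) :+ r :* h) refl c (x ^ m) (r x) (h x)))
    (below-+ (below-scale c (below-x^* m C)) (below-* B C)))

  degree⇒below : ∀ {n f} → HasDegree n f → Below (suc n) f
  degree⇒below (hasDegree c _ B fx) = suc c B fx

  degree-+-below : ∀ {n f h} → HasDegree n f → Below n h → HasDegree n (λ x → f x + h x)
  degree-+-below {n} {h = h} (hasDegree {r} c c≢0 B fx) C = hasDegree c c≢0 (below-+ B C) λ x →
    trans (cong (_+ h x) (fx x))
      (solve 4 (λ c y r h → (c :* y :+ r) :+ h := c :* y :+ (r :+ h)) refl c (x ^ n) (r x) (h x))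

  degree-scale : ∀ {n f k} → k ≢ 0ℚ → HasDegree n f → HasDegree n (λ x → k * f x)
  degree-scale {n} {k = k} k≢0 (hasDegree {r} c c≢0 B fx) = hasDegree (k * c) (*-≢0 k≢0 c≢0) (below-scale k B) λ x →
    trans (cong (k *_) (fx x))
      (solve 4 (λ k c y r → k :* (c :* y :+ r) := k :* c :* y :+ k :* r) refl k c (x ^ n) (r x))

  ^-+ : ∀ m n x → x ^ (m ℕ.+ n) ≡ x ^ m * x ^ n
  ^-+ zero    n x = sym (*-identityˡ (x ^ n))
  ^-+ (suc m) n x = trans (cong (x *_) (^-+ m n x)) (sym (*-assoc x (x ^ m) (x ^ n)))

  degree-* : ∀ {m n f h} → HasDegree m f → HasDegree n h → HasDegree (m ℕ.+ n) (λ x → f x * h x)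
  degree-* {m} {n} (hasDegree {r} c c≢0 B fx) (hasDegree {s} d d≢0 C hx) =
    hasDegree (c * d) (*-≢0 c≢0 d≢0)
      (below-+ (below-+ (below-scale c (below-x^* m C))
                        (below-≤ (ℕₚ.≤-reflexive (ℕₚ.+-comm n m)) (below-scale d (below-x^* n B))))
               (below-* B C))
      λ x → trans (cong₂ _*_ (fx x) (hx x)) (trans
        (solve 6 (λ c d y z r s → (c :* y :+ r) :* (d :* z :+ s) :=
            c :* d :* (y :* z) :+ (c :* (y :* s) :+ d :* (z :* r) :+ r :* s)) refl
          c d (x ^ m) (x ^ n) (r x) (s x))
        (cong (λ t → c * d * t + (c * (x ^ m * s x) + d * (x ^ n * r x) + r x * s x)) (sym (^-+ m n x))))

  -- Vanishing of a rational coefficient is decidable, so leading zeros can be stripped off one by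
  -- one.
  zero⊎degree : ∀ {n f} → Below n f → (∀ x → f x ≡ 0ℚ) ⊎ ∃[ m ] HasDegree m f
  zero⊎degree (zero f0) = inj₁ f0
  zero⊎degree (suc {n} {h = r} c B fx) with c ≟ 0ℚ
  ... | no c≢0 = inj₂ (n , hasDegree c c≢0 B fx)
  ... | yes refl with zero⊎degree B
  ...   | inj₁ r0 = inj₁ λ x → trans (drop x) (r0 x)
    where
    drop : ∀ x → _ ≡ r x
    drop x = trans (fx x) (solve 2 (λ y r → con 0ℚ :* y :+ r := r) refl (x ^ n) (r x))
  ...   | inj₂ (m , D) = inj₂ (m , degree-resp drop D)
    where
    drop : ∀ x → _ ≡ r x
    drop x = trans (fx x) (solve 2 (λ y r → con 0ℚ :* y :+ r := r) refl (x ^ n) (r x))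

  -- The forward difference. It lowers degrees by exactly one and depends only on the function, so
  -- it shows that the function determines the degree.
  Δ : (ℚ → ℚ) → ℚ → ℚ
  Δ f x = f (x + 1ℚ) - f x

  -- The leading coefficient of Δ applied to the power n + 1 is n + 1. Its sign is all that is
  -- recorded: positivity survives the induction and implies that it is nonzero.
  record PositiveLead (n : ℕ) (f : ℚ → ℚ) : Set where
    field
      {rest} : ℚ → ℚ
      lead   : ℚ
      lead>0 : Positive lead
      rest<n : Below n rest
      expand : ∀ x → f x ≡ lead * x ^ n + rest x

  Δ-power : ∀ n → PositiveLead n (Δ (_^ suc n))
  Δ-power zero = record { lead = 1ℚ ; lead>0 = _ ; rest<n = zero (λ _ → refl) ; expand = λ x →
    solve 1 (λ x → (x :+ con 1ℚ) :* con 1ℚ :- x :* con 1ℚ := con 1ℚ :* con 1ℚ :+ con 0ℚ) refl x }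
  Δ-power (suc n) = record
    { lead   = 1ℚ + lead
    ; lead>0 = pos+pos⇒pos 1ℚ lead {{lead>0}}
    ; rest<n = below-+ (below-x* rest<n) (suc lead rest<n λ _ → refl)
    ; expand = λ x → trans
        (solve 3 (λ x u v → (x :+ con 1ℚ) :* u :- x :* v := v :+ (x :* (u :- v) :+ (u :- v))) refl
          x ((x + 1ℚ) ^ suc n) (x ^ suc n))
        (trans (cong (λ t → x ^ suc n + (x * t + t)) (expand x))
          (solve 4 (λ x c y r → x :* y :+ (x :* (c :* y :+ r) :+ (c :* y :+ r)) :=
              (con 1ℚ :+ c) :* (x :* y) :+ (x :* r :+ (c :* y :+ r))) refl
            x lead (x ^ n) (rest x)))
    }
    where open PositiveLead (Δ-power n)

  module _ (n : ℕ) where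
    open PositiveLead (Δ-power n)

    Δ-expand : ∀ {f h} c → (∀ x → f x ≡ c * x ^ suc n + h x) →
      ∀ x → Δ f x ≡ c * lead * x ^ n + (c * rest x + Δ h x)
    Δ-expand {h = h} c fx x = trans (cong₂ _-_ (fx (x + 1ℚ)) (fx x)) (trans
      (solve 5 (λ c u v s t → (c :* u :+ s) :- (c :* v :+ t) := c :* (u :- v) :+ (s :- t)) refl
        c ((x + 1ℚ) ^ suc n) (x ^ suc n) (h (x + 1ℚ)) (h x))
      (trans (cong (λ t → c * t + Δ h x) (expand x))
        (solve 5 (λ c l y r s → c :* (l :* y :+ r) :+ s := c :* l :* y :+ (c :* r :+ s)) refl
          c lead (x ^ n) (rest x) (Δ h x))))

  below-Δ : ∀ {n f} → Below (suc n) f → Below n (Δ f)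
  below-Δ {zero} (suc c (zero h0) fx) = zero λ x →
    trans (cong₂ _-_ (value (x + 1ℚ)) (value x)) (solve 1 (λ c → c :- c := con 0ℚ) refl (c * 1ℚ + 0ℚ))
    where
    value : ∀ x → _ ≡ c * 1ℚ + 0ℚ
    value x = trans (fx x) (cong (λ s → c * 1ℚ + s) (h0 x))
  below-Δ {suc n} (suc c B fx) =
    suc (c * lead) (below-+ (below-scale c rest<n) (below-Δ B)) (Δ-expand n c fx)
    where open PositiveLead (Δ-power n)

  positive⇒≢0 : ∀ {q} → Positive q → q ≢ 0ℚ
  positive⇒≢0 () refl

  degree-Δ : ∀ {n f} → HasDegree (suc n) f → HasDegree n (Δ f)
  degree-Δ {n} (hasDegree c c≢0 B fx) =
    hasDegree (c * lead) (*-≢0 c≢0 (positive⇒≢0 lead>0))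
      (below-+ (below-scale c rest<n) (below-Δ B)) (Δ-expand n c fx)
    where open PositiveLead (Δ-power n)

  degree₀-nonzero : ∀ {f} → HasDegree 0 f → ∀ x → f x ≢ 0ℚ
  degree₀-nonzero (hasDegree c c≢0 (zero r0) fx) x f≡0 = c≢0 (begin
    c             ≡⟨ solve 1 (λ c → c := c :* con 1ℚ :+ con 0ℚ) refl c ⟩
    c * 1ℚ + 0ℚ   ≡⟨ cong (λ s → c * 1ℚ + s) (r0 x) ⟨
    c * 1ℚ + _    ≡⟨ fx x ⟨
    _             ≡⟨ f≡0 ⟩
    0ℚ            ∎)
    where open ≡-Reasoning

  degree₁-root-unique : ∀ {f} → HasDegree 1 f → ∀ {u w} → f u ≡ 0ℚ → f w ≡ 0ℚ → u ≡ w
  degree₁-root-unique {f} (hasDegree {r} c c≢0 (suc d (zero z) rx) fx) {u} {w} fu fw =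
    x-y≡0⇒x≡y (*-cancelˡ-0 c≢0 (begin
      c * (u - w)
        ≡⟨ solve 4 (λ c u w d → c :* (u :- w) := (c :* (u :* con 1ℚ) :+ d) :- (c :* (w :* con 1ℚ) :+ d)) refl c u w (d * 1ℚ + 0ℚ) ⟩
      (c * (u * 1ℚ) + (d * 1ℚ + 0ℚ)) - (c * (w * 1ℚ) + (d * 1ℚ + 0ℚ))
        ≡⟨ cong₂ _-_ (linear u) (linear w) ⟨
      f u - f w
        ≡⟨ cong₂ _-_ fu fw ⟩
      0ℚ ∎))
    where
    open ≡-Reasoning
    linear : ∀ t → f t ≡ c * (t * 1ℚ) + (d * 1ℚ + 0ℚ)
    linear t = trans (fx t) (cong (λ s → c * (t * 1ℚ) + s) (trans (rx t) (cong (λ s → d * 1ℚ + s) (z t))))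

  -- Repeated differences lead from f to a nonzero constant, but from the zero function only to
  -- zero.
  degree⇒nonzero : ∀ {n f} → HasDegree n f → ¬ (∀ x → f x ≡ 0ℚ)
  degree⇒nonzero {zero}  D f0 = degree₀-nonzero D 0ℚ (f0 0ℚ)
  degree⇒nonzero {suc n} D f0 = degree⇒nonzero (degree-Δ D) λ x → cong₂ _-_ (f0 (x + 1ℚ)) (f0 x)

  -- Otherwise f - f would have degree n.
  ¬degree-< : ∀ {m n f} → m ℕ.< n → HasDegree m f → ¬ HasDegree n f
  ¬degree-< {f = f} m<n D D′ =
    degree⇒nonzero (degree-+-below D′ (below-scale (- 1ℚ) (below-≤ m<n (degree⇒below D))))
      λ x → solve 1 (λ f → f :+ (:- con 1ℚ) :* f := con 0ℚ) refl (f x)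

  degree-unique : ∀ {m n f} → HasDegree m f → HasDegree n f → m ≡ n
  degree-unique {m} {n} D D′ with ℕₚ.<-cmp m n
  ... | tri< m<n _ _ = ⊥-elim (¬degree-< m<n D D′)
  ... | tri≈ _ m≡n _ = m≡n
  ... | tri> _ _ n<m = ⊥-elim (¬degree-< n<m D′ D)

  below-const : ∀ k → Below 1 (λ _ → k)
  below-const k = suc k (zero λ _ → refl) λ _ → solve 1 (λ k → k := k :* con 1ℚ :+ con 0ℚ) refl k

  degree-linear : ∀ {k} l → k ≢ 0ℚ → HasDegree 1 (λ x → k * x + l)
  degree-linear {k} l k≢0 = hasDegree k k≢0 (below-const l) λ x →
    cong (λ t → k * t + l) (sym (*-identityʳ x))

  below-linear : ∀ k l → Below 2 (λ x → k * x + l)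
  below-linear k l = suc k (below-const l) λ x → cong (λ t → k * t + l) (sym (*-identityʳ x))

  degree-below-minus : ∀ {n f h} → Below n f → HasDegree n h → HasDegree n (λ x → f x - h x)
  degree-below-minus {f = f} {h} B D = degree-resp
    (λ x → solve 2 (λ u v → u :- v := (:- con 1ℚ) :* v :+ u) refl (f x) (h x))
    (degree-+-below (degree-scale {k = - 1ℚ} (λ ()) D) B)

  degree-minus-below : ∀ {n f h} → HasDegree n f → Below n h → HasDegree n (λ x → f x - h x)
  degree-minus-below {f = f} {h} D B = degree-resp
    (λ x → solve 2 (λ u v → u :- v := u :+ (:- con 1ℚ) :* v) refl (f x) (h x))
    (degree-+-below D (below-scale (- 1ℚ) B))

  IsPolynomial : (ℚ → ℚ) → Set
  IsPolynomial f = ∃[ n ] Below n f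

  abstract
    poly-const : ∀ k → IsPolynomial (λ _ → k)
    poly-const k = 1 , below-const k

    poly-x : IsPolynomial (λ x → x)
    poly-x = 2 , below-resp (λ x → solve 1 (λ x → x := con 1ℚ :* x :+ con 0ℚ) refl x) (below-linear 1ℚ 0ℚ)

    poly-+ : ∀ {f h} → IsPolynomial f → IsPolynomial h → IsPolynomial (λ x → f x + h x)
    poly-+ (m , B) (n , C) =
      m ℕ.+ n , below-+ (below-≤ (ℕₚ.m≤m+n m n) B) (below-≤ (ℕₚ.m≤n+m n m) C)

    poly-* : ∀ {f h} → IsPolynomial f → IsPolynomial h → IsPolynomial (λ x → f x * h x)
    poly-* (m , B) (n , C) = m ℕ.+ n , below-* B C

    poly-neg : ∀ {f} → IsPolynomial f → IsPolynomial (λ x → - f x)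
    poly-neg {f} (n , B) = n , below-resp
      (λ x → solve 1 (λ u → :- u := (:- con 1ℚ) :* u) refl (f x)) (below-scale (- 1ℚ) B)

-- The group law

open import Defs

module ChordTangent where
  open import Data.Rational using (ℚ; 0ℚ; 1ℚ; _+_; _-_; _*_; -_; 1/_; _÷_; ≢-nonZero)
  open import Data.Rational.Properties using (_≟_; *-inverseˡ; *-assoc; *-identityˡ; *-identityʳ; *-zeroʳ; *-zeroˡ)
  open import Data.Rational.Solver using (module +-*-Solver)
  open +-*-Solver using (Polynomial; solve; _:=_; _:+_; _:-_; _:*_; :-_; con)
  open Polynomials

  -- The coordinate ring of the affine curve and its norm to polynomials in x

  module CoordinateRing (E : EllipticCurve) where
    open EllipticCurve E
    open Model (curve E) using (g; g′)

    -- p(x) + q(x) y, with polynomials p and q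
    record Function : Set where
      no-eta-equality
      constructor function
      field
        even odd : ℚ → ℚ
        even-poly : IsPolynomial even
        odd-poly  : IsPolynomial odd

    open Function

    infix 4 _≈_
    record _≈_ (f h : Function) : Set where
      constructor _,_
      field
        even-≡ : ∀ x → even f x ≡ even h x
        odd-≡  : ∀ x → odd f x ≡ odd h x

    open _≈_

    degree-g : HasDegree 3 g
    degree-g = hasDegree 1ℚ (λ ()) (suc a (below-linear b c) λ _ → refl) λ x →
      solve 4 (λ x a b c → x :* x :* x :+ a :* (x :* x) :+ b :* x :+ c :=
        con 1ℚ :* (x :* (x :* (x :* con 1ℚ))) :+ (a :* (x :* (x :* con 1ℚ)) :+ (b :* x :+ c))) refl x a b c

    abstract
      poly-g : IsPolynomial g
      poly-g = _ , degree⇒below degree-g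

    constant : ℚ → Function
    constant k = function (λ _ → k) (λ _ → 0ℚ) (poly-const k) (poly-const 0ℚ)

    infixl 6 _⊹_
    infixl 7 _✶_
    infix 8 ⁻_
    _⊹_ _✶_ : Function → Function → Function
    f ⊹ h = function (λ x → even f x + even h x) (λ x → odd f x + odd h x)
      (poly-+ (even-poly f) (even-poly h)) (poly-+ (odd-poly f) (odd-poly h))
    f ✶ h = function
      (λ x → even f x * even h x + g x * (odd f x * odd h x))
      (λ x → even f x * odd h x + odd f x * even h x)
      (poly-+ (poly-* (even-poly f) (even-poly h)) (poly-* poly-g (poly-* (odd-poly f) (odd-poly h))))
      (poly-+ (poly-* (even-poly f) (odd-poly h)) (poly-* (odd-poly f) (even-poly h)))

    ⁻_ : Function → Function
    ⁻ f = function (λ x → - even f x) (λ x → - odd f x) (poly-neg (even-poly f)) (poly-neg (odd-poly f))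

    coordinateRing : CommutativeRing 0ℓ 0ℓ
    coordinateRing = record
      { Carrier = Function ; _≈_ = _≈_ ; _+_ = _⊹_ ; _*_ = _✶_ ; -_ = ⁻_
      ; 0# = constant 0ℚ ; 1# = constant 1ℚ
      ; isCommutativeRing = record
        { isRing = record
          { +-isAbelianGroup = record
            { isGroup = record
              { isMonoid = record
                { isSemigroup = record
                  { isMagma = record
                    { isEquivalence = record
                      { refl  = (λ _ → refl) , (λ _ → refl)
                      ; sym   = λ (e , o) → (λ x → sym (e x)) , (λ x → sym (o x))
                      ; trans = λ (e , o) (e′ , o′) → (λ x → trans (e x) (e′ x)) , (λ x → trans (o x) (o′ x))
                      }
                    ; ∙-cong = λ (e , o) (e′ , o′) → (λ x → cong₂ _+_ (e x) (e′ x)) , (λ x → cong₂ _+_ (o x) (o′ x))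
                    }
                  ; assoc = λ f h k → (λ x → +-assoc′ (even f x) (even h x) (even k x)) ,
                                      (λ x → +-assoc′ (odd f x) (odd h x) (odd k x))
                  }
                ; identity = (λ f → (λ x → +-idˡ (even f x)) , (λ x → +-idˡ (odd f x)))
                           , (λ f → (λ x → +-idʳ (even f x)) , (λ x → +-idʳ (odd f x)))
                }
              ; inverse = (λ f → (λ x → +-invˡ (even f x)) , (λ x → +-invˡ (odd f x)))
                        , (λ f → (λ x → +-invʳ (even f x)) , (λ x → +-invʳ (odd f x)))
              ; ⁻¹-cong = λ (e , o) → (λ x → cong -_ (e x)) , (λ x → cong -_ (o x))
              }
            ; comm = λ f h → (λ x → +-comm′ (even f x) (even h x)) , (λ x → +-comm′ (odd f x) (odd h x))
            }
          ; *-cong = λ (e , o) (e′ , o′) →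
              (λ x → cong₂ _+_ (cong₂ _*_ (e x) (e′ x)) (cong (g x *_) (cong₂ _*_ (o x) (o′ x)))) ,
              (λ x → cong₂ _+_ (cong₂ _*_ (e x) (o′ x)) (cong₂ _*_ (o x) (e′ x)))
          ; *-assoc = λ f h k →
              (λ x → solve 7 (λ g p q r s t u → (p :* r :+ g :* (q :* s)) :* t :+ g :* ((p :* s :+ q :* r) :* u)
                                := p :* (r :* t :+ g :* (s :* u)) :+ g :* (q :* (r :* u :+ s :* t))) refl
                       (g x) (even f x) (odd f x) (even h x) (odd h x) (even k x) (odd k x)) ,
              (λ x → solve 7 (λ g p q r s t u → (p :* r :+ g :* (q :* s)) :* u :+ (p :* s :+ q :* r) :* t
                                := p :* (r :* u :+ s :* t) :+ q :* (r :* t :+ g :* (s :* u))) refl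
                       (g x) (even f x) (odd f x) (even h x) (odd h x) (even k x) (odd k x))
          ; *-identity =
              (λ f → (λ x → solve 3 (λ g p q → con 1ℚ :* p :+ g :* (con 0ℚ :* q) := p) refl (g x) (even f x) (odd f x)) ,
                     (λ x → solve 2 (λ p q → con 1ℚ :* q :+ con 0ℚ :* p := q) refl (even f x) (odd f x))) ,
              (λ f → (λ x → solve 3 (λ g p q → p :* con 1ℚ :+ g :* (q :* con 0ℚ) := p) refl (g x) (even f x) (odd f x)) ,
                     (λ x → solve 2 (λ p q → p :* con 0ℚ :+ q :* con 1ℚ := q) refl (even f x) (odd f x)))
          ; distrib =
              (λ f h k →
                (λ x → solve 7 (λ g p q r s t u → p :* (r :+ t) :+ g :* (q :* (s :+ u))
                         := (p :* r :+ g :* (q :* s)) :+ (p :* t :+ g :* (q :* u))) refl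
                       (g x) (even f x) (odd f x) (even h x) (odd h x) (even k x) (odd k x)) ,
                (λ x → solve 6 (λ p q r s t u → p :* (s :+ u) :+ q :* (r :+ t)
                         := (p :* s :+ q :* r) :+ (p :* u :+ q :* t)) refl
                       (even f x) (odd f x) (even h x) (odd h x) (even k x) (odd k x))) ,
              (λ f h k →
                (λ x → solve 7 (λ g p q r s t u → (r :+ t) :* p :+ g :* ((s :+ u) :* q)
                         := (r :* p :+ g :* (s :* q)) :+ (t :* p :+ g :* (u :* q))) refl
                       (g x) (even f x) (odd f x) (even h x) (odd h x) (even k x) (odd k x)) ,
                (λ x → solve 6 (λ p q r s t u → (r :+ t) :* q :+ (s :+ u) :* p
                         := (r :* q :+ s :* p) :+ (t :* q :+ u :* p)) refl
                       (even f x) (odd f x) (even h x) (odd h x) (even k x) (odd k x)))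
          }
        ; *-comm = λ f h →
            (λ x → solve 5 (λ g p q r s → p :* r :+ g :* (q :* s) := r :* p :+ g :* (s :* q)) refl
                     (g x) (even f x) (odd f x) (even h x) (odd h x)) ,
            (λ x → solve 4 (λ p q r s → p :* s :+ q :* r := r :* q :+ s :* p) refl
                     (even f x) (odd f x) (even h x) (odd h x))
        }
      }
      where
      open import Data.Rational.Properties
        renaming (+-assoc to +-assoc′; +-comm to +-comm′; +-identityˡ to +-idˡ; +-identityʳ to +-idʳ;
                  +-inverseˡ to +-invˡ; +-inverseʳ to +-invʳ) using ()

    norm : Function → ℚ → ℚ
    norm f x = even f x * even f x - g x * (odd f x * odd f x)

    norm-✶ : ∀ f h x → norm (f ✶ h) x ≡ norm f x * norm h x
    norm-✶ f h x = solve 5 (λ g p q r s →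
      (p :* r :+ g :* (q :* s)) :* (p :* r :+ g :* (q :* s)) :- g :* ((p :* s :+ q :* r) :* (p :* s :+ q :* r))
        := (p :* p :- g :* (q :* q)) :* (r :* r :- g :* (s :* s))) refl
      (g x) (even f x) (odd f x) (even h x) (odd h x)

    norm-cong : ∀ {f h} → f ≈ h → ∀ x → norm f x ≡ norm h x
    norm-cong (e , o) x = cong₂ _-_ (cong₂ _*_ (e x) (e x)) (cong (g x *_) (cong₂ _*_ (o x) (o x)))

    norm-0 : ∀ {f} → f ≈ constant 0ℚ → ∀ x → norm f x ≡ 0ℚ
    norm-0 {f} e x = trans (norm-cong {f} {constant 0ℚ} e x)
      (solve 1 (λ g → con 0ℚ :* con 0ℚ :- g :* (con 0ℚ :* con 0ℚ) := con 0ℚ) refl (g x))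

    -- The multiplicative set for the ideal classes. Having a degree says positively that the norm
    -- is nonzero, and the degree itself is what the injectivity argument counts.
    record Regular (f : Function) : Set where
      constructor _,_
      field
        degree      : ℕ
        norm-degree : HasDegree degree (norm f)

    regular-1 : Regular (constant 1ℚ)
    regular-1 = 0 , hasDegree 1ℚ (λ ()) (zero λ _ → refl) λ x →
      solve 1 (λ g → con 1ℚ :* con 1ℚ :- g :* (con 0ℚ :* con 0ℚ) := con 1ℚ :* con 1ℚ :+ con 0ℚ) refl (g x)

    regular-✶ : ∀ {f h} → Regular f → Regular h → Regular (f ✶ h)
    regular-✶ {f} {h} (m , D) (n , D′) = m ℕ.+ n , degree-resp (norm-✶ f h) (degree-* D D′)

    even≢odd : ∀ m k → m ℕ.+ m ≢ 3 ℕ.+ (k ℕ.+ k)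
    even≢odd m k e = ℕₚ.even≢odd m (suc k) (begin
      2 ℕ.* m             ≡⟨ cong (m ℕ.+_) (ℕₚ.+-identityʳ m) ⟩
      m ℕ.+ m             ≡⟨ e ⟩
      3 ℕ.+ (k ℕ.+ k)     ≡⟨ cong (2 ℕ.+_) (ℕₚ.+-suc k k) ⟨
      2 ℕ.+ (k ℕ.+ suc k) ≡⟨ cong (λ t → 2 ℕ.+ (k ℕ.+ suc t)) (ℕₚ.+-identityʳ k) ⟨
      suc (2 ℕ.* suc k)   ∎)
      where open ≡-Reasoning

    -- `pure` is a nonzero polynomial in x, of even norm degree; `mixed` covers every element with a
    -- nonzero y-part, where g contributes its degree 3.
    data NormShape (f : Function) : Set where
      vanishing : (∀ x → even f x ≡ 0ℚ) → (∀ x → odd f x ≡ 0ℚ) → NormShape f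
      pure      : ∀ {m} → (∀ x → odd f x ≡ 0ℚ) → HasDegree m (even f) → HasDegree (m ℕ.+ m) (norm f) → NormShape f
      mixed     : ∀ {n} → 3 ℕ.≤ n → HasDegree n (norm f) → NormShape f

    -- The terms p² and g q² of the norm have degrees of different parity, so they cannot cancel.
    normShape : ∀ f → NormShape f
    normShape f with zero⊎degree (proj₂ (even-poly f)) | zero⊎degree (proj₂ (odd-poly f))
    ... | inj₁ p0 | inj₁ q0 = vanishing p0 q0
    ... | inj₂ (m , D) | inj₁ q0 = pure q0 D (degree-minus-below (degree-* D D)
            (below-resp (λ x → trans (cong (λ t → g x * (t * t)) (q0 x)) (*-zeroʳ (g x))) (below-0 (m ℕ.+ m))))
    ... | inj₁ p0 | inj₂ (k , D) = mixed (ℕₚ.m≤m+n 3 (k ℕ.+ k)) (degree-below-minus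
            (below-resp (λ x → cong (λ t → t * t) (p0 x)) (below-0 (3 ℕ.+ (k ℕ.+ k))))
            (degree-* degree-g (degree-* D D)))
    ... | inj₂ (m , D) | inj₂ (k , D′) with ℕₚ.<-cmp (m ℕ.+ m) (3 ℕ.+ (k ℕ.+ k))
    ...   | tri< l _ _ = mixed (ℕₚ.m≤m+n 3 (k ℕ.+ k))
              (degree-below-minus (below-≤ l (degree⇒below (degree-* D D))) (degree-* degree-g (degree-* D′ D′)))
    ...   | tri≈ _ e _ = ⊥-elim (even≢odd m k e)
    ...   | tri> _ _ l = mixed (ℕₚ.≤-trans (ℕₚ.m≤m+n 3 (k ℕ.+ k)) (ℕₚ.<⇒≤ l))
              (degree-minus-below (degree-* D D) (below-≤ l (degree⇒below (degree-* degree-g (degree-* D′ D′)))))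

    -- Here it matters that g is cubic: a nonzero y-part forces norm degree at least 3. If g had
    -- degree 1, the function y would have norm degree 1.
    norm-degree≤2 : ∀ f {n} → HasDegree n (norm f) → n ℕ.≤ 2 →
      (∀ x → odd f x ≡ 0ℚ) × ∃[ m ] HasDegree m (even f) × m ℕ.+ m ≡ n
    norm-degree≤2 f D n≤2 with normShape f
    ... | vanishing p0 q0 = ⊥-elim (degree⇒nonzero D (norm-0 {f} (p0 , q0)))
    ... | pure q0 D₁ D₂   = q0 , _ , D₁ , degree-unique D₂ D
    ... | mixed 3≤n D₁    = ⊥-elim (ℕₚ.<-irrefl refl (ℕₚ.≤-trans 3≤n (subst (ℕ._≤ 2) (degree-unique D D₁) n≤2)))

    norm-zero : ∀ f → (∀ x → norm f x ≡ 0ℚ) → f ≈ constant 0ℚ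
    norm-zero f N0 with normShape f
    ... | vanishing p0 q0 = p0 , q0
    ... | pure _ _ D      = ⊥-elim (degree⇒nonzero D N0)
    ... | mixed _ D       = ⊥-elim (degree⇒nonzero D N0)

    zero⊎regular : ∀ f → (∀ x → norm f x ≡ 0ℚ) ⊎ Regular f
    zero⊎regular f = map₂ (λ (n , D) → n , D) (zero⊎degree (proj₂ (poly-+ (poly-* (even-poly f) (even-poly f))
      (poly-neg (poly-* poly-g (poly-* (odd-poly f) (odd-poly f)))))))

    open Ideals coordinateRing

    -- Norms are multiplicative and degrees add, so a product of two elements with nonzero norm has
    -- nonzero norm.
    regular-cancel : ∀ {f} → Regular f → ∀ {h} → f ✶ h ≈ constant 0ℚ → h ≈ constant 0ℚ
    regular-cancel {f} (n , D) {h} e with zero⊎regular h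
    ... | inj₁ N0 = norm-zero h N0
    ... | inj₂ (m , D′) = ⊥-elim (degree⇒nonzero (degree-* D D′) λ x →
            trans (sym (norm-✶ f h x)) (norm-0 {f ✶ h} e x))

    regular-factors : ∀ {f h} → Regular (f ✶ h) → Regular f × Regular h
    regular-factors {f} {h} (n , D) with zero⊎regular f | zero⊎regular h
    ... | inj₂ F  | inj₂ H  = F , H
    ... | inj₁ N0 | _       = ⊥-elim (degree⇒nonzero D λ x →
      trans (norm-✶ f h x) (trans (cong (_* norm h x) (N0 x)) (*-zeroˡ (norm h x))))
    ... | inj₂ _  | inj₁ N0 = ⊥-elim (degree⇒nonzero D λ x →
      trans (norm-✶ f h x) (trans (cong (norm f x *_) (N0 x)) (*-zeroʳ (norm f x))))

  inverse : ∀ {s} → s ≢ 0ℚ → ∃[ k ] k * s ≡ 1ℚ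
  inverse {s} s≢0 = 1/ s , *-inverseˡ s
    where
    instance
      _ = ≢-nonZero s≢0

  -- Inserts the factor k d = 1, so that an identity that divides by d becomes a polynomial identity
  -- in k and the other variables.
  unit : ∀ {k d} → k * d ≡ 1ℚ → ∀ t → t ≡ k * d * t
  unit e t = trans (sym (*-identityˡ t)) (cong (_* t) (sym e))

  -- The operations of the coordinate ring on pairs of solver expressions
  module Symbolic {n} (g : Polynomial n) where
    infixl 6 _⊞_
    infixl 7 _⊗_
    _⊞_ _⊗_ : (f h : Polynomial n × Polynomial n) → Polynomial n × Polynomial n
    (p , q) ⊞ (r , s) = p :+ r , q :+ s
    (p , q) ⊗ (r , s) = p :* r :+ g :* (q :* s) , p :* s :+ q :* r

  -- Points as ideal classes

  module GroupLaw (E : EllipticCurve) where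
    open EllipticCurve E
    open Model (curve E) using (g; g′)
    open CoordinateRing E
    open Function
    open CommutativeRing coordinateRing using () renaming
      (refl to ≈-refl; sym to ≈-sym; *-comm to ✶-comm; *-identityʳ to ✶-identityʳ)
    open Ideals coordinateRing
    open Ideal
    open Classes Regular regular-1 regular-✶

    X : ℚ → Function
    X e = function (λ x → x - e) (λ _ → 0ℚ) (poly-+ poly-x (poly-const (- e))) (poly-const 0ℚ)

    -- y − h(x)
    Y : (h : ℚ → ℚ) → IsPolynomial h → Function
    Y h P = function (λ x → - h x) (λ _ → 1ℚ) (poly-neg P) (poly-const 1ℚ)

    V : ℚ → Function
    V y = Y (λ _ → y) (poly-const y)

    degree-X : ∀ e → HasDegree 2 (norm (X e))
    degree-X e = degree-resp
      (λ x → solve 3 (λ x e g → (x :- e) :* (x :- e) :- g :* (con 0ℚ :* con 0ℚ)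
          := (con 1ℚ :* x :+ (:- e)) :* (con 1ℚ :* x :+ (:- e))) refl x e (g x))
      (degree-* (degree-linear {1ℚ} (- e) λ ()) (degree-linear {1ℚ} (- e) λ ()))

    regular-X : ∀ e → Regular (X e)
    regular-X e = 2 , degree-X e

    regular-resp : ∀ {f h} → f ≈ h → Regular f → Regular h
    regular-resp e (n , D) = n , degree-resp (norm-cong (≈-sym e)) D

    -- Common to chords and tangents, which differ only in the proof of `factored` and in the reason
    -- why w lies in the product ideal.
    module Line (l x₁ y₁ x₂ y₂ x₃ : ℚ)
      (factored : ∀ x → g x - (l * (x - x₁) + y₁) * (l * (x - x₁) + y₁) ≡ (x - x₁) * (x - x₂) * (x - x₃))
      (on-line : y₂ ≡ l * (x₂ - x₁) + y₁) where

      ℓ : ℚ → ℚ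
      ℓ x = l * (x - x₁) + y₁

      abstract
        poly-ℓ : IsPolynomial ℓ
        poly-ℓ = poly-+ (poly-* (poly-const l) (poly-+ poly-x (poly-const (- x₁)))) (poly-const y₁)

      w w′ : Function
      w  = Y ℓ poly-ℓ
      w′ = Y (λ x → - ℓ x) (poly-neg poly-ℓ)

      -- w w′ = y² - ℓ², and y² is g in the coordinate ring, so `factored` applies.
      norm-line : X x₃ ✶ (X x₁ ✶ X x₂) ≈ w ✶ w′
      norm-line =
        (λ x → begin
          (x - x₃) * ((x - x₁) * (x - x₂) + g x * (0ℚ * 0ℚ)) + g x * (0ℚ * ((x - x₁) * 0ℚ + 0ℚ * (x - x₂)))
            ≡⟨ solve 4 (λ r s t g → t :* (r :* s :+ g :* (con 0ℚ :* con 0ℚ)) :+ g :* (con 0ℚ :* (r :* con 0ℚ :+ con 0ℚ :* s))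
                 := r :* s :* t) refl (x - x₁) (x - x₂) (x - x₃) (g x) ⟩
          (x - x₁) * (x - x₂) * (x - x₃)
            ≡⟨ factored x ⟨
          g x - ℓ x * ℓ x
            ≡⟨ solve 2 (λ g m → g :- m :* m := (:- m) :* (:- (:- m)) :+ g :* (con 1ℚ :* con 1ℚ)) refl (g x) (ℓ x) ⟩
          (- ℓ x) * (- (- ℓ x)) + g x * (1ℚ * 1ℚ) ∎) ,
        (λ x → trans
          (solve 4 (λ r s t g → t :* (r :* con 0ℚ :+ con 0ℚ :* s) :+ con 0ℚ :* (r :* s :+ g :* (con 0ℚ :* con 0ℚ))
                 := con 0ℚ) refl (x - x₁) (x - x₂) (x - x₃) (g x))
          (solve 1 (λ m → con 0ℚ := (:- m) :* con 1ℚ :+ con 1ℚ :* (:- (:- m))) refl (ℓ x)))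
        where open ≡-Reasoning

      regular-w : Regular w
      regular-w = proj₁ (regular-factors {w} {w′} (regular-resp norm-line
        (regular-✶ (regular-X x₃) (regular-✶ (regular-X x₁) (regular-X x₂)))))

      first : ⟨ X x₁ ∣ V y₁ ⟩ ≐ ⟨ X x₁ ∣ w ⟩
      first = ⟨∣⟩-shear {X x₁} {V y₁} {w} (constant (- l))
        ((λ x → solve 5 (λ l x x₁ y₁ g → :- (l :* (x :- x₁) :+ y₁) := (:- y₁) :+ ((x :- x₁) :* (:- l) :+ g :* (con 0ℚ :* con 0ℚ)))
          refl l x x₁ y₁ (g x)) ,
         (λ x → solve 3 (λ l x x₁ → con 1ℚ := con 1ℚ :+ ((x :- x₁) :* con 0ℚ :+ con 0ℚ :* (:- l))) refl l x x₁))

      second : ⟨ X x₂ ∣ V y₂ ⟩ ≐ ⟨ X x₂ ∣ w ⟩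
      second = ⟨∣⟩-shear {X x₂} {V y₂} {w} (constant (- l))
        ((λ x → trans
          (solve 6 (λ l x x₁ x₂ y₁ g → :- (l :* (x :- x₁) :+ y₁)
              := (:- (l :* (x₂ :- x₁) :+ y₁)) :+ ((x :- x₂) :* (:- l) :+ g :* (con 0ℚ :* con 0ℚ)))
            refl l x x₁ x₂ y₁ (g x))
          (cong (λ t → - t + ((x - x₂) * (- l) + g x * (0ℚ * 0ℚ))) (sym on-line))) ,
         (λ x → solve 3 (λ l x x₁ → con 1ℚ := con 1ℚ :+ ((x :- x₁) :* con 0ℚ :+ con 0ℚ :* (:- l))) refl l x x₂))

      -- The line y = -ℓ(x) passes through the reflection of the third intersection point, that is,
      -- through the sum of the two points.
      third : ⟨ X x₃ ∣ V (- ℓ x₃) ⟩ ≐ ⟨ X x₃ ∣ w′ ⟩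
      third = ⟨∣⟩-shear {X x₃} {V (- ℓ x₃)} {w′} (constant l)
        ((λ x →
          solve 6 (λ l x x₁ x₃ y₁ g → :- (:- (l :* (x :- x₁) :+ y₁))
              := (:- (:- (l :* (x₃ :- x₁) :+ y₁))) :+ ((x :- x₃) :* l :+ g :* (con 0ℚ :* con 0ℚ)))
            refl l x x₁ x₃ y₁ (g x)) ,
         (λ x → solve 3 (λ l x x₁ → con 1ℚ := con 1ℚ :+ ((x :- x₁) :* con 0ℚ :+ con 0ℚ :* l)) refl l x x₃))

      collinear : w ∈ ⟨ X x₁ ∣ w ⟩ ⊙ ⟨ X x₂ ∣ w ⟩ →
        ⟨ X x₁ ∣ V y₁ ⟩ ⊙ ⟨ X x₂ ∣ V y₂ ⟩ ∼ ⟨ X x₃ ∣ V (- ℓ x₃) ⟩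
      collinear w∈ = X x₃ , w , regular-X x₃ , regular-w ,
        ≐-trans (⊙-cong ≐-refl (⊙-cong first second))
          (≐-trans (line-⊙ norm-line w∈) (⊙-cong ≐-refl (≐-sym third)))

      -- The part of `line-⊙` that is not formal. Evident members of the product are X₁ w, w X₂ and
      -- w², and also w w′ because it equals X₃ X₁ X₂; the kᵢ certify that w is a combination of
      -- these four.
      w-mem : ∀ {k₁ k₂ k₃ k₄} →
        w ≈ (k₁ ✶ (X x₁ ✶ w) ⊹ k₂ ✶ (w ✶ X x₂)) ⊹ (k₃ ✶ (w ✶ w) ⊹ k₄ ✶ (w ✶ w′)) →
        w ∈ ⟨ X x₁ ∣ w ⟩ ⊙ ⟨ X x₂ ∣ w ⟩
      w-mem {k₁} {k₂} {k₃} {k₄} e = resp J (≈-sym e) (+-closed J {k₁ ✶ (X x₁ ✶ w) ⊹ k₂ ✶ (w ✶ X x₂)}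
        (+-closed J {k₁ ✶ (X x₁ ✶ w)} (*-closed J k₁ {X x₁ ✶ w} (⊙-mem {I₁} {I₂} {X x₁} {w} X₁∈ w∈₂))
                    (*-closed J k₂ {w ✶ X x₂} (⊙-mem {I₁} {I₂} {w} {X x₂} w∈₁ X₂∈)))
        (+-closed J {k₃ ✶ (w ✶ w)} (*-closed J k₃ {w ✶ w} (⊙-mem {I₁} {I₂} {w} {w} w∈₁ w∈₂))
                    (*-closed J k₄ {w ✶ w′} (resp J norm-line
                      (*-closed J (X x₃) {X x₁ ✶ X x₂} (⊙-mem {I₁} {I₂} {X x₁} {X x₂} X₁∈ X₂∈))))))
        where
        I₁ = ⟨ X x₁ ∣ w ⟩
        I₂ = ⟨ X x₂ ∣ w ⟩
        J  = I₁ ⊙ I₂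
        X₁∈ : X x₁ ∈ I₁
        X₁∈ = left-generator {X x₁} {w}
        X₂∈ : X x₂ ∈ I₂
        X₂∈ = left-generator {X x₂} {w}
        w∈₁ : w ∈ I₁
        w∈₁ = right-generator {X x₁} {w}
        w∈₂ : w ∈ I₂
        w∈₂ = right-generator {X x₂} {w}

      private
        combination₂ : ∀ {n} (g m x x₁ x₂ k₁ k₂ k₃ k₄ : Polynomial n) → Polynomial n × Polynomial n
        combination₂ g m x x₁ x₂ k₁ k₂ k₃ k₄ =
          (k₁′ ⊗ (X₁ ⊗ W) ⊞ k₂′ ⊗ (W ⊗ X₂)) ⊞ (k₃′ ⊗ (W ⊗ W) ⊞ k₄′ ⊗ (W ⊗ W′))
          where
          open Symbolic g
          X₁ = (x :- x₁) , con 0ℚ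
          X₂ = (x :- x₂) , con 0ℚ
          W  = (:- m) , con 1ℚ
          W′ = (:- (:- m)) , con 1ℚ
          k₁′ = k₁ , con 0ℚ
          k₂′ = k₂ , con 0ℚ
          k₃′ = k₃ , con 0ℚ
          k₄′ = k₄ , con 0ℚ

      distinct : x₂ - x₁ ≢ 0ℚ → w ∈ ⟨ X x₁ ∣ w ⟩ ⊙ ⟨ X x₂ ∣ w ⟩
      distinct ne with inverse ne
      -- X₁ w - w X₂ = (x₂ - x₁) w, and k inverts x₂ - x₁.
      ... | k , kd = w-mem {constant k} {constant (- k)} {constant 0ℚ} {constant 0ℚ}
        ((λ x → trans (unit {k} {x₂ - x₁} kd (- ℓ x))
            (solve 6 (λ k x x₁ x₂ m g → k :* (x₂ :- x₁) :* (:- m) :=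
                proj₁ (combination₂ g m x x₁ x₂ k (:- k) (con 0ℚ) (con 0ℚ))) refl
              k x x₁ x₂ (ℓ x) (g x))) ,
         (λ x → trans (sym kd)
            (solve 6 (λ k x x₁ x₂ m g → k :* (x₂ :- x₁) :=
                proj₂ (combination₂ g m x x₁ x₂ k (:- k) (con 0ℚ) (con 0ℚ))) refl
              k x x₁ x₂ (ℓ x) (g x))))

      -- w (w′ − w) = 2 ℓ w and ℓ = y₁ + l X₁.
      tangent : y₁ + y₁ ≢ 0ℚ → w ∈ ⟨ X x₁ ∣ w ⟩ ⊙ ⟨ X x₂ ∣ w ⟩
      tangent ne with inverse ne
      ... | k , kd = w-mem {constant (- (k * (l + l)))} {constant 0ℚ} {constant (- k)} {constant k}
        ((λ x → trans (unit {k} {y₁ + y₁} kd (- ℓ x))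
            (solve 7 (λ k x x₁ x₂ l y₁ g → k :* (y₁ :+ y₁) :* (:- (l :* (x :- x₁) :+ y₁)) :=
                proj₁ (combination₂ g (l :* (x :- x₁) :+ y₁) x x₁ x₂ (:- (k :* (l :+ l))) (con 0ℚ) (:- k) k)) refl
              k x x₁ x₂ l y₁ (g x))) ,
         (λ x → trans (sym kd)
            (solve 7 (λ k x x₁ x₂ l y₁ g → k :* (y₁ :+ y₁) :=
                proj₂ (combination₂ g (l :* (x :- x₁) :+ y₁) x x₁ x₂ (:- (k :* (l :+ l))) (con 0ℚ) (:- k) k)) refl
              k x x₁ x₂ l y₁ (g x))))

    -- By the choice of x₃ the two sides agree in x³ and x², so their difference is linear in x. The
    -- identity is its Lagrange interpolation from x₁ and x₂, where it vanishes by the curve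
    -- equations.
    chord-factored : ∀ l x₁ y₁ x₂ y₂ → x₂ - x₁ ≢ 0ℚ → l * (x₂ - x₁) ≡ y₂ - y₁ →
      1ℚ * (y₁ * y₁) ≡ g x₁ → 1ℚ * (y₂ * y₂) ≡ g x₂ → ∀ x →
      g x - (l * (x - x₁) + y₁) * (l * (x - x₁) + y₁)
        ≡ (x - x₁) * (x - x₂) * (x - (1ℚ * (l * l) - a - x₁ - x₂))
    chord-factored l x₁ y₁ x₂ y₂ ne slope e₁ e₂ x = x-y≡0⇒x≡y (*-cancelˡ-0 ne (begin
      (x₂ - x₁) * ((g x - (l * (x - x₁) + y₁) * (l * (x - x₁) + y₁)) - (x - x₁) * (x - x₂) * (x - (1ℚ * (l * l) - a - x₁ - x₂)))
        ≡⟨ solve 8 (λ a b c l x₁ y₁ x₂ x →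
             let G = λ x → x :* x :* x :+ a :* (x :* x) :+ b :* x :+ c
                 h = l :* (x :- x₁) :+ y₁
                 y₂ = l :* (x₂ :- x₁) :+ y₁ in
             (x₂ :- x₁) :* ((G x :- h :* h) :- (x :- x₁) :* (x :- x₂) :* (x :- (con 1ℚ :* (l :* l) :- a :- x₁ :- x₂)))
             := (G x₁ :- con 1ℚ :* (y₁ :* y₁)) :* (x₂ :- x) :+ (G x₂ :- con 1ℚ :* (y₂ :* y₂)) :* (x :- x₁))
             refl a b c l x₁ y₁ x₂ x ⟩
      (g x₁ - 1ℚ * (y₁ * y₁)) * (x₂ - x) + (g x₂ - 1ℚ * (y * y)) * (x - x₁)
        ≡⟨ cong₂ (λ s t → (g x₁ - s) * (x₂ - x) + (g x₂ - t) * (x - x₁)) e₁ (trans (cong (λ t → 1ℚ * (t * t)) y≡y₂) e₂) ⟩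
      (g x₁ - g x₁) * (x₂ - x) + (g x₂ - g x₂) * (x - x₁)
        ≡⟨ solve 4 (λ s t u v → (s :- s) :* u :+ (t :- t) :* v := con 0ℚ) refl (g x₁) (g x₂) (x₂ - x) (x - x₁) ⟩
      0ℚ ∎))
      where
      open ≡-Reasoning
      y = l * (x₂ - x₁) + y₁
      y≡y₂ : y ≡ y₂
      y≡y₂ = trans (cong (_+ y₁) slope) (solve 2 (λ s t → (s :- t) :+ t := s) refl y₂ y₁)

    -- As for chords the difference is linear in x; now its value and its derivative at x₁ vanish,
    -- by the curve equation and the tangent slope.
    tangent-factored : ∀ l x₁ y₁ → l * (1ℚ * (y₁ + y₁)) ≡ g′ x₁ → 1ℚ * (y₁ * y₁) ≡ g x₁ → ∀ x →
      g x - (l * (x - x₁) + y₁) * (l * (x - x₁) + y₁)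
        ≡ (x - x₁) * (x - x₁) * (x - (1ℚ * (l * l) - a - x₁ - x₁))
    tangent-factored l x₁ y₁ slope e₁ x = x-y≡0⇒x≡y (begin
      (g x - (l * (x - x₁) + y₁) * (l * (x - x₁) + y₁)) - (x - x₁) * (x - x₁) * (x - (1ℚ * (l * l) - a - x₁ - x₁))
        ≡⟨ solve 7 (λ a b c l x₁ y₁ x →
             let G = λ x → x :* x :* x :+ a :* (x :* x) :+ b :* x :+ c
                 G′ = λ x → con (ι (+ 3)) :* (x :* x) :+ con (ι (+ 2)) :* (a :* x) :+ b
                 h = l :* (x :- x₁) :+ y₁ in
             (G x :- h :* h) :- (x :- x₁) :* (x :- x₁) :* (x :- (con 1ℚ :* (l :* l) :- a :- x₁ :- x₁))
             := (G x₁ :- con 1ℚ :* (y₁ :* y₁)) :+ (G′ x₁ :- l :* (con 1ℚ :* (y₁ :+ y₁))) :* (x :- x₁))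
             refl a b c l x₁ y₁ x ⟩
      (g x₁ - 1ℚ * (y₁ * y₁)) + (g′ x₁ - l * (1ℚ * (y₁ + y₁))) * (x - x₁)
        ≡⟨ cong₂ (λ s t → (g x₁ - s) + (g′ x₁ - t) * (x - x₁)) e₁ slope ⟩
      (g x₁ - g x₁) + (g′ x₁ - g′ x₁) * (x - x₁)
        ≡⟨ solve 3 (λ s t u → (s :- s) :+ (t :- t) :* u := con 0ℚ) refl (g x₁) (g′ x₁) (x - x₁) ⟩
      0ℚ ∎)
      where open ≡-Reasoning

    -- For given a and e, `b₀` and `c₀` are the coefficients of the cubic with double root e. If g
    -- and g′ vanish at e, then b = b₀ and c = c₀, and the discriminant is zero.
    nonsingular : ∀ x → g x ≡ 0ℚ → g′ x ≢ 0ℚ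
    nonsingular e g≡0 g′≡0 = discriminant≢0 (begin
      discriminant a b c
        ≡⟨ solve 4 (λ a b c e →
             let G  = e :* e :* e :+ a :* (e :* e) :+ b :* e :+ c
                 G′ = con (ι (+ 3)) :* (e :* e) :+ con (ι (+ 2)) :* (a :* e) :+ b
                 b₀ = :- (con (ι (+ 3)) :* (e :* e) :+ con (ι (+ 2)) :* (a :* e))
                 c₀ = con (ι (+ 2)) :* (e :* e :* e) :+ a :* (e :* e) in
             D a b c := D a (b₀ :+ G′) (c₀ :+ G :- e :* G′)) refl a b c e ⟩
      discriminant a (b₀ + g′ e) (c₀ + g e - e * g′ e)
        ≡⟨ cong₂ (λ s t → discriminant a (b₀ + s) (c₀ + t - e * s)) g′≡0 g≡0 ⟩
      discriminant a (b₀ + 0ℚ) (c₀ + 0ℚ - e * 0ℚ)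
        ≡⟨ solve 2 (λ a e →
             let b₀ = :- (con (ι (+ 3)) :* (e :* e) :+ con (ι (+ 2)) :* (a :* e))
                 c₀ = con (ι (+ 2)) :* (e :* e :* e) :+ a :* (e :* e) in
             D a (b₀ :+ con 0ℚ) (c₀ :+ con 0ℚ :- e :* con 0ℚ) := con 0ℚ) refl a e ⟩
      0ℚ ∎)
      where
      open ≡-Reasoning
      b₀ = - (ι (+ 3) * (e * e) + ι (+ 2) * (a * e))
      c₀ = ι (+ 2) * (e * e * e) + a * (e * e)
      D : ∀ {n} (a b c : Polynomial n) → Polynomial n
      D a b c = a :* a :* b :* b :- con (ι (+ 4)) :* (b :* b :* b) :- con (ι (+ 4)) :* (a :* a :* a :* c)
               :- con (ι (+ 27)) :* (c :* c) :+ con (ι (+ 18)) :* (a :* b :* c)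

    module Vertical (x₁ y₁ : ℚ) (e₁ : 1ℚ * (y₁ * y₁) ≡ g x₁) where
      I₁ = ⟨ X x₁ ∣ V y₁ ⟩
      I₂ = ⟨ X x₁ ∣ V (- y₁) ⟩

      -- The divided difference (g(x) - g(x₁)) / (x - x₁).
      slope : Function
      slope = function (λ x → x * x + x * x₁ + x₁ * x₁ + a * (x + x₁) + b) (λ _ → 0ℚ)
        (poly-+ (poly-+ (poly-+ (poly-+ (poly-* poly-x poly-x) (poly-* poly-x (poly-const x₁))) (poly-const (x₁ * x₁)))
          (poly-* (poly-const a) (poly-+ poly-x (poly-const x₁)))) (poly-const b))
        (poly-const 0ℚ)

      vertical-product : V y₁ ✶ V (- y₁) ≈ X x₁ ✶ slope
      vertical-product =
        (λ x → begin
          - y₁ * - (- y₁) + g x * (1ℚ * 1ℚ)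
            ≡⟨ solve 2 (λ y g → (:- y) :* (:- (:- y)) :+ g :* (con 1ℚ :* con 1ℚ) := g :- con 1ℚ :* (y :* y)) refl y₁ (g x) ⟩
          g x - 1ℚ * (y₁ * y₁)
            ≡⟨ cong (λ t → g x - t) e₁ ⟩
          g x - g x₁
            ≡⟨ solve 6 (λ a b c x x₁ d →
                 let G = λ x → x :* x :* x :+ a :* (x :* x) :+ b :* x :+ c in
                 G x :- G x₁ := (x :- x₁) :* (x :* x :+ x :* x₁ :+ x₁ :* x₁ :+ a :* (x :+ x₁) :+ b) :+ d :* (con 0ℚ :* con 0ℚ))
                 refl a b c x x₁ (g x) ⟩
          (x - x₁) * even slope x + g x * (0ℚ * 0ℚ) ∎) ,
        (λ x → solve 3 (λ y u v → (:- y) :* con 1ℚ :+ con 1ℚ :* (:- (:- y)) := u :* con 0ℚ :+ con 0ℚ :* v) refl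
          y₁ (x - x₁) (even slope x))
        where open ≡-Reasoning

      X∈₁ : X x₁ ∈ I₁
      X∈₁ = left-generator {X x₁} {V y₁}
      V∈₁ : V y₁ ∈ I₁
      V∈₁ = right-generator {X x₁} {V y₁}
      X∈₂ : X x₁ ∈ I₂
      X∈₂ = left-generator {X x₁} {V (- y₁)}
      V∈₂ : V (- y₁) ∈ I₂
      V∈₂ = right-generator {X x₁} {V (- y₁)}

      J = I₁ ⊙ I₂

      -- A certificate as in `w-mem`: the four products of generators are at hand, (y - y₁)(y + y₁)
      -- in the form X₁ · `slope`.
      X-mem : ∀ {k₁ k₂ k₃ k₄} →
        X x₁ ≈ (k₁ ✶ (X x₁ ✶ X x₁) ⊹ k₂ ✶ (X x₁ ✶ V (- y₁))) ⊹ (k₃ ✶ (V y₁ ✶ X x₁) ⊹ k₄ ✶ (X x₁ ✶ slope)) → X x₁ ∈ J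
      X-mem {k₁} {k₂} {k₃} {k₄} e = resp J (≈-sym e) (+-closed J {k₁ ✶ (X x₁ ✶ X x₁) ⊹ k₂ ✶ (X x₁ ✶ V (- y₁))}
        (+-closed J {k₁ ✶ (X x₁ ✶ X x₁)} (*-closed J k₁ {X x₁ ✶ X x₁} (⊙-mem {I₁} {I₂} {X x₁} {X x₁} X∈₁ X∈₂))
          (*-closed J k₂ {X x₁ ✶ V (- y₁)} (⊙-mem {I₁} {I₂} {X x₁} {V (- y₁)} X∈₁ V∈₂)))
        (+-closed J {k₃ ✶ (V y₁ ✶ X x₁)} (*-closed J k₃ {V y₁ ✶ X x₁} (⊙-mem {I₁} {I₂} {V y₁} {X x₁} V∈₁ X∈₂))
          (*-closed J k₄ {X x₁ ✶ slope} (resp J vertical-product (⊙-mem {I₁} {I₂} {V y₁} {V (- y₁)} V∈₁ V∈₂)))))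

      private
        combination₂ : ∀ {n} (g y x x₁ s k₁ k₁′ k₂ k₃ k₄ : Polynomial n) → Polynomial n × Polynomial n
        combination₂ g y x x₁ s k₁ k₁′ k₂ k₃ k₄ =
          (((k₁ :* (x :+ k₁′)) , con 0ℚ) ⊗ (X₁ ⊗ X₁) ⊞ (k₂ , con 0ℚ) ⊗ (X₁ ⊗ ((:- (:- y)) , con 1ℚ)))
            ⊞ ((k₃ , con 0ℚ) ⊗ (((:- y) , con 1ℚ) ⊗ X₁) ⊞ (k₄ , con 0ℚ) ⊗ (X₁ ⊗ (s , con 0ℚ)))
          where
          open Symbolic g
          X₁ = (x :- x₁) , con 0ℚ

      scaled : (k k′ : ℚ) → Function
      scaled k k′ = function (λ x → k * (x + k′)) (λ _ → 0ℚ)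
        (poly-* (poly-const k) (poly-+ poly-x (poly-const k′))) (poly-const 0ℚ)

      unramified : (∃[ k ] k * (y₁ + y₁) ≡ 1ℚ) → X x₁ ∈ J
      -- (x - x₁)(y + y₁) - (y - y₁)(x - x₁) = 2 y₁ (x - x₁).
      unramified (k , kd) = X-mem {scaled 0ℚ 0ℚ} {constant k} {constant (- k)} {constant 0ℚ}
        ((λ x → trans (unit {k} {y₁ + y₁} kd (x - x₁))
            (solve 6 (λ k y x x₁ s g → k :* (y :+ y) :* (x :- x₁) :=
               proj₁ (combination₂ g y x x₁ s (con 0ℚ) (con 0ℚ) k (:- k) (con 0ℚ))) refl
               k y₁ x x₁ (even slope x) (g x))) ,
         (λ x → solve 6 (λ k y x x₁ s g → con 0ℚ :=
               proj₂ (combination₂ g y x x₁ s (con 0ℚ) (con 0ℚ) k (:- k) (con 0ℚ))) refl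
               k y₁ x x₁ (even slope x) (g x)))

      -- For points of order 2, where 2 y₁ is not invertible but g′(x₁) is, by nonsingularity. The
      -- multipliers come from slope(x) = g′(x₁) + (x - x₁)(x + 2 x₁ + a).
      ramified : (∃[ k ] k * g′ x₁ ≡ 1ℚ) → X x₁ ∈ J
      ramified (k , kd) = X-mem {scaled (- k) (x₁ + x₁ + a)} {constant 0ℚ} {constant 0ℚ} {constant k}
        ((λ x → trans (unit {k} {g′ x₁} kd (x - x₁))
            (solve 7 (λ k y x x₁ a b g →
               let G′ = con (ι (+ 3)) :* (x₁ :* x₁) :+ con (ι (+ 2)) :* (a :* x₁) :+ b in
               k :* G′ :* (x :- x₁) :=
               proj₁ (combination₂ g y x x₁ (x :* x :+ x :* x₁ :+ x₁ :* x₁ :+ a :* (x :+ x₁) :+ b)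
                 (:- k) (x₁ :+ x₁ :+ a) (con 0ℚ) (con 0ℚ) k)) refl
               k y₁ x x₁ a b (g x))) ,
         (λ x → solve 7 (λ k y x x₁ a b g → con 0ℚ :=
               proj₂ (combination₂ g y x x₁ (x :* x :+ x :* x₁ :+ x₁ :* x₁ :+ a :* (x :+ x₁) :+ b)
                 (:- k) (x₁ :+ x₁ :+ a) (con 0ℚ) (con 0ℚ) k)) refl
               k y₁ x x₁ a b (g x)))

      X∈J : X x₁ ∈ J
      X∈J with y₁ + y₁ ≟ 0ℚ
      ... | no 2y≢0  = unramified (inverse 2y≢0)
      ... | yes 2y≡0 = ramified (inverse (nonsingular x₁ g≡0))
        where
        y≡0 : y₁ ≡ 0ℚ
        y≡0 = *-cancelˡ-0 {ι (+ 2)} (λ ()) (trans (solve 1 (λ y → con (ι (+ 2)) :* y := y :+ y) refl y₁) 2y≡0)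
        g≡0 : g x₁ ≡ 0ℚ
        g≡0 = trans (sym e₁) (cong (λ t → 1ℚ * (t * t)) y≡0)

      vertical : I₁ ⊙ I₂ ≐ ⟨ X x₁ ⟩
      vertical = ⊆-antisym
        (⟨∣⟩-⊙-⊆ {X x₁} {V y₁} {X x₁} {V (- y₁)} ⟨ X x₁ ⟩
          (X x₁ , ≈-refl) (V (- y₁) , ≈-refl) (V y₁ , ✶-comm (V y₁) (X x₁)) (slope , vertical-product))
        (⟨⟩-⊆ {X x₁} J X∈J)

    κ : Point (curve E) → Ideal
    κ O              = ⟨ constant 1ℚ ⟩
    κ (affine x y _) = ⟨ X x ∣ V y ⟩

    chord-∼ : ∀ l x₁ y₁ x₂ y₂ → x₂ - x₁ ≢ 0ℚ → l * (x₂ - x₁) ≡ y₂ - y₁ →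
      1ℚ * (y₁ * y₁) ≡ g x₁ → 1ℚ * (y₂ * y₂) ≡ g x₂ →
      let x₃ = 1ℚ * (l * l) - a - x₁ - x₂ in
      ⟨ X x₁ ∣ V y₁ ⟩ ⊙ ⟨ X x₂ ∣ V y₂ ⟩ ∼ ⟨ X x₃ ∣ V (- (l * (x₃ - x₁) + y₁)) ⟩
    chord-∼ l x₁ y₁ x₂ y₂ ne slope e₁ e₂ = collinear (distinct ne)
      where
      open Line l x₁ y₁ x₂ y₂ (1ℚ * (l * l) - a - x₁ - x₂) (chord-factored l x₁ y₁ x₂ y₂ ne slope e₁ e₂)
        (trans (solve 2 (λ s t → s := (s :- t) :+ t) refl y₂ y₁) (cong (_+ y₁) (sym slope)))

    tangent-∼ : ∀ l x₁ y₁ x₂ y₂ → x₂ ≡ x₁ → y₂ ≡ y₁ → 1ℚ * (y₁ + y₂) ≢ 0ℚ →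
      l * (1ℚ * (y₁ + y₂)) ≡ g′ x₁ → 1ℚ * (y₁ * y₁) ≡ g x₁ →
      let x₃ = 1ℚ * (l * l) - a - x₁ - x₁ in
      ⟨ X x₁ ∣ V y₁ ⟩ ⊙ ⟨ X x₂ ∣ V y₂ ⟩ ∼ ⟨ X x₃ ∣ V (- (l * (x₃ - x₁) + y₁)) ⟩
    tangent-∼ l x₁ y₁ .x₁ .y₁ refl refl ne slope e₁ =
      collinear (tangent λ e → ne (trans (*-identityˡ (y₁ + y₁)) e))
      where
      open Line l x₁ y₁ x₁ y₁ (1ℚ * (l * l) - a - x₁ - x₁) (tangent-factored l x₁ y₁ slope e₁)
        (solve 3 (λ l x y → y := l :* (x :- x) :+ y) refl l x₁ y₁)

    vertical-∼ : ∀ x₁ y₁ x₂ y₂ → x₂ ≡ x₁ → 1ℚ * (y₁ + y₂) ≡ 0ℚ → 1ℚ * (y₁ * y₁) ≡ g x₁ →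
      ⟨ X x₁ ∣ V y₁ ⟩ ⊙ ⟨ X x₂ ∣ V y₂ ⟩ ∼ ⟨ constant 1ℚ ⟩
    vertical-∼ x₁ y₁ .x₁ y₂ refl opposite e₁ = constant 1ℚ , X x₁ , regular-1 , regular-X x₁ ,
      ≐-trans (⊙-identityˡ _) (≐-trans
        (subst (λ t → ⟨ X x₁ ∣ V y₁ ⟩ ⊙ ⟨ X x₁ ∣ V t ⟩ ≐ ⟨ X x₁ ⟩) (sym y₂≡-y₁) (Vertical.vertical x₁ y₁ e₁))
        (≐-sym (≐-trans (⊙-comm ⟨ X x₁ ⟩ ⟨ constant 1ℚ ⟩) (⊙-identityˡ ⟨ X x₁ ⟩))))
      where
      y₂≡-y₁ : y₂ ≡ - y₁
      y₂≡-y₁ = begin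
        y₂                    ≡⟨ solve 2 (λ s t → t := con 1ℚ :* (s :+ t) :- s) refl y₁ y₂ ⟩
        1ℚ * (y₁ + y₂) - y₁   ≡⟨ cong (_- y₁) opposite ⟩
        0ℚ - y₁               ≡⟨ solve 1 (λ s → con 0ℚ :- s := :- s) refl y₁ ⟩
        - y₁                  ∎
        where open ≡-Reasoning

    ÷-* : ∀ s t → (t≢0 : t ≢ 0ℚ) → (s ÷ t) {{≢-nonZero t≢0}} * t ≡ s
    ÷-* s t t≢0 = trans (*-assoc s (1/ t) t) (trans (cong (s *_) (*-inverseˡ t)) (*-identityʳ s))
      where
      instance
        _ = ≢-nonZero t≢0

    -- The case distinctions are those of `_⊕_`, so the sum computes in each branch to the point
    -- that the matching lemma speaks of.
    κ-⊕ : ∀ P Q → κ P ⊙ κ Q ∼ κ (P ⊕ Q)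
    κ-⊕ O Q = ≐⇒∼ (⊙-identityˡ (κ Q))
    κ-⊕ P@(affine _ _ _) O = ≐⇒∼ (≐-trans (⊙-comm (κ P) ⟨ constant 1ℚ ⟩) (⊙-identityˡ (κ P)))
    κ-⊕ (affine x₁ y₁ e₁) (affine x₂ y₂ e₂) with x₂ - x₁ ≟ 0ℚ
    ... | no x₁≢x₂ = chord-∼ (((y₂ - y₁) ÷ (x₂ - x₁)) {{≢-nonZero x₁≢x₂}}) x₁ y₁ x₂ y₂ x₁≢x₂ (÷-* (y₂ - y₁) (x₂ - x₁) x₁≢x₂)
          -- The curve equation is an irrelevant field of a point; decidable equality on ℚ recovers
          -- a usable proof.
          (recompute (_ ≟ _) e₁) (recompute (_ ≟ _) e₂)
    ... | yes x₁≡x₂ with 1ℚ * (y₁ + y₂) ≟ 0ℚ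
    ...   | yes opposite = vertical-∼ x₁ y₁ x₂ y₂ (x-y≡0⇒x≡y x₁≡x₂) opposite (recompute (_ ≟ _) e₁)
    ...   | no 2y≢0 = tangent-∼ ((g′ x₁ ÷ (1ℚ * (y₁ + y₂))) {{≢-nonZero 2y≢0}}) x₁ y₁ x₂ y₂ x₂≡x₁
            (x-y≡0⇒x≡y (*-cancelˡ-0 2y≢0 y₂-y₁)) 2y≢0 (÷-* (g′ x₁) (1ℚ * (y₁ + y₂)) 2y≢0) E₁
      where
      open ≡-Reasoning
      E₁ : 1ℚ * (y₁ * y₁) ≡ g x₁
      E₁ = recompute (_ ≟ _) e₁
      E₂ : 1ℚ * (y₂ * y₂) ≡ g x₂
      E₂ = recompute (_ ≟ _) e₂
      x₂≡x₁ : x₂ ≡ x₁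
      x₂≡x₁ = x-y≡0⇒x≡y x₁≡x₂
      y₂-y₁ : 1ℚ * (y₁ + y₂) * (y₂ - y₁) ≡ 0ℚ
      y₂-y₁ = begin
        1ℚ * (y₁ + y₂) * (y₂ - y₁)
          ≡⟨ solve 2 (λ s t → con 1ℚ :* (s :+ t) :* (t :- s) := con 1ℚ :* (t :* t) :- con 1ℚ :* (s :* s)) refl y₁ y₂ ⟩
        1ℚ * (y₂ * y₂) - 1ℚ * (y₁ * y₁)
          ≡⟨ cong₂ _-_ (trans E₂ (cong g x₂≡x₁)) E₁ ⟩
        g x₁ - g x₁
          ≡⟨ solve 1 (λ s → s :- s := con 0ℚ) refl (g x₁) ⟩
        0ℚ ∎

    -- Injectivity of the class map

    v : Point (curve E) → Function
    v O              = constant 1ℚ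
    v (affine x _ _) = X x

    regular-v : ∀ P → Regular (v P)
    regular-v O              = regular-1
    regular-v (affine x _ _) = regular-X x

    κ-⊖ : ∀ P → κ P ⊙ κ (⊖ P) ≐ ⟨ v P ⟩
    κ-⊖ O              = ⊙-identityˡ ⟨ constant 1ℚ ⟩
    κ-⊖ (affine x y e) = Vertical.vertical x y (recompute (_ ≟ _) e)

    abstract
      -- Multiplying f κ P = h κ Q by κ(⊖ Q) makes the right side principal, generated by h v(Q);
      -- the regular factor f is then cancelled.
      ∼⇒principal : ∀ P Q → κ P ∼ κ Q → ∃[ h ] κ P ⊙ κ (⊖ Q) ≐ ⟨ h ⟩
      ∼⇒principal P Q (f , h , rf , rh , e) =
        ⟨⟩⊙-cancel {f} {h ✶ v Q} {κ P ⊙ κ (⊖ Q)} (cancellative {f} (regular-cancel {f} rf))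
          (≐-trans (≐-sym (⊙-assoc ⟨ f ⟩ (κ P) (κ (⊖ Q)))) (≐-trans (⊙-cong e ≐-refl)
            (≐-trans (⊙-assoc ⟨ h ⟩ (κ Q) (κ (⊖ Q))) (≐-trans (⊙-cong ≐-refl (κ-⊖ Q)) (⟨⟩-⊙ h (v Q))))))

    value : ∀ {x y} → 1ℚ * (y * y) ≡ g x → ∀ {h} → h ∈ ⟨ X x ∣ V y ⟩ → even h x + odd h x * y ≡ 0ℚ
    value {x} {y} e {h} (s , t , e₀ , e₁) = begin
      even h x + odd h x * y
        ≡⟨ cong₂ (λ u w → u + w * y) (e₀ x) (e₁ x) ⟩
      _ ≡⟨ solve 7 (λ x y g p q r s →
             let open Symbolic g
                 f = ((x :- x) , con 0ℚ) ⊗ (p , q) ⊞ ((:- y) , con 1ℚ) ⊗ (r , s) in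
             proj₁ f :+ proj₂ f :* y := (g :- con 1ℚ :* (y :* y)) :* s)
           refl x y (g x) (even s x) (odd s x) (even t x) (odd t x) ⟩
      (g x - 1ℚ * (y * y)) * odd t x
        ≡⟨ cong (λ u → (g x - u) * odd t x) e ⟩
      (g x - g x) * odd t x
        ≡⟨ solve 2 (λ u w → (u :- u) :* w := con 0ℚ) refl (g x) (odd t x) ⟩
      0ℚ ∎
      where open ≡-Reasoning

    value-pure : ∀ {x y} → 1ℚ * (y * y) ≡ g x → ∀ {h} → h ∈ ⟨ X x ∣ V y ⟩ → (∀ x → odd h x ≡ 0ℚ) → even h x ≡ 0ℚ
    value-pure {x} {y} e {h} h∈ odd≡0 = trans
      (trans (solve 2 (λ u y → u := u :+ con 0ℚ :* y) refl (even h x) y) (cong (λ t → even h x + t * y) (sym (odd≡0 x))))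
      (value e {h} h∈)

    -- With a norm of degree below 2, h would be a polynomial in x of degree 0, a nonzero constant;
    -- but members of the ideal vanish at the point.
    2≤degree : ∀ {x y} → 1ℚ * (y * y) ≡ g x → ∀ {h} → h ∈ ⟨ X x ∣ V y ⟩ → ∀ {n} → HasDegree n (norm h) → 2 ℕ.≤ n
    2≤degree {x} e {h} h∈ {n} D with 2 ℕ.≤? n
    ... | yes 2≤n = 2≤n
    ... | no  2≰n with norm-degree≤2 h D (ℕₚ.<⇒≤ (ℕₚ.≰⇒> 2≰n))
    ...   | odd≡0 , zero  , D₀ , _    = ⊥-elim (degree₀-nonzero D₀ x (value-pure e {h} h∈ odd≡0))
    ...   | odd≡0 , suc m , D₀ , refl = ⊥-elim (2≰n (ℕ.s≤s (ℕₚ.≤-trans (ℕ.s≤s ℕ.z≤n) (ℕₚ.m≤n+m (suc m) m))))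

    factor-degrees : ∀ {f h k s d} → f ≈ (h ✶ k) ✶ s → HasDegree d (norm f) →
      ∃[ m ] ∃[ n ] HasDegree m (norm h) × HasDegree n (norm k) × m ℕ.+ n ℕ.≤ d
    factor-degrees {f} {h} {k} {s} {d} e D = m , n , Dₕ , Dₖ , ℕₚ.≤-trans (ℕₚ.m≤m+n (m ℕ.+ n) l)
      (ℕₚ.≤-reflexive (degree-unique
        (degree-resp (λ x → trans (norm-cong e x) (trans (norm-✶ (h ✶ k) s x) (cong (_* norm s x) (norm-✶ h k x))))
          (degree-* (degree-* Dₕ Dₖ) Dₛ)) D))
      where
      hk×s : Regular (h ✶ k) × Regular s
      hk×s = regular-factors {h ✶ k} {s} (regular-resp e (d , D))
      h×k : Regular h × Regular k
      h×k = regular-factors {h} {k} (proj₁ hk×s)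
      open Regular (proj₁ h×k) renaming (degree to m; norm-degree to Dₕ)
      open Regular (proj₂ h×k) renaming (degree to n; norm-degree to Dₖ)
      open Regular (proj₂ hk×s) renaming (degree to l; norm-degree to Dₛ)

    abstract
      -- The generators h, k of κ P ⊙ κ (⊖ Q) and κ Q ⊙ κ (⊖ P) satisfy h k ∣ v P v Q.
      degrees : ∀ P Q {h k d} → κ P ⊙ κ (⊖ Q) ≐ ⟨ h ⟩ → κ Q ⊙ κ (⊖ P) ≐ ⟨ k ⟩ → HasDegree d (norm (v P ✶ v Q)) →
        ∃[ m ] ∃[ n ] HasDegree m (norm h) × HasDegree n (norm k) × m ℕ.+ n ℕ.≤ d
      degrees P Q {h} {k} eh ek D = factor-degrees {v P ✶ v Q} {h} {k} {proj₁ cofactor} (proj₂ cofactor) D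
        where
        multiple : ⟨ v P ✶ v Q ⟩ ≐ ⟨ h ✶ k ⟩
        multiple = ≐-trans (≐-sym (⟨⟩-⊙ (v P) (v Q))) (≐-trans (⊙-cong (≐-sym (κ-⊖ P)) (≐-sym (κ-⊖ Q)))
          (≐-trans (⊙-exchange (κ P) (κ (⊖ P)) (κ Q) (κ (⊖ Q))) (≐-trans (⊙-cong eh ek) (⟨⟩-⊙ h k))))
        cofactor : v P ✶ v Q ∈ ⟨ h ✶ k ⟩
        cofactor = ⊆-to multiple (constant 1ℚ , ≈-sym (✶-identityʳ (v P ✶ v Q)))

    self-mem : ∀ {h I} → I ≐ ⟨ h ⟩ → h ∈ I
    self-mem {h} e = ⊆-from e (constant 1ℚ , ≈-sym (✶-identityʳ h))

    on-curve : ∀ {x y} → .(1ℚ * (y * y) ≡ g x) → 1ℚ * (y * y) ≡ g x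
    on-curve e = recompute (_ ≟ _) e

    on-curve-⊖ : ∀ {x y} → .(1ℚ * (y * y) ≡ g x) → 1ℚ * (- y * - y) ≡ g x
    on-curve-⊖ {x} {y} e = trans (solve 1 (λ y → con 1ℚ :* ((:- y) :* (:- y)) := con 1ℚ :* (y :* y)) refl y) (on-curve {x} {y} e)

    abstract
      -- h vanishes at P and k at ⊖ P, so both norm degrees are at least 2; this squeezes the degree
      -- for h between 2 and d - 2.
      2≤degrees : ∀ x₁ y₁ .(e₁ : 1ℚ * (y₁ * y₁) ≡ g x₁) Q {h k d} →
        κ (affine x₁ y₁ e₁) ⊙ κ (⊖ Q) ≐ ⟨ h ⟩ → κ Q ⊙ κ (⊖ affine x₁ y₁ e₁) ≐ ⟨ k ⟩ →
        HasDegree d (norm (X x₁ ✶ v Q)) →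
        ∃[ m ] HasDegree m (norm h) × 2 ℕ.≤ m × m ℕ.+ 2 ℕ.≤ d
      2≤degrees x₁ y₁ e₁ Q {h} {k} {d} eh ek D = bound (degrees P Q {h} {k} eh ek D)
        where
        P : Point (curve E)
        P = affine x₁ y₁ e₁
        h∈ : h ∈ κ P
        h∈ = ⊙-⊆ˡ {κ P} {κ (⊖ Q)} (self-mem {h} {κ P ⊙ κ (⊖ Q)} eh)
        k∈ : k ∈ κ (⊖ P)
        k∈ = ⊙-⊆ʳ {κ Q} {κ (⊖ P)} (self-mem {k} {κ Q ⊙ κ (⊖ P)} ek)
        bound : (∃[ m ] ∃[ n ] HasDegree m (norm h) × HasDegree n (norm k) × m ℕ.+ n ℕ.≤ d) →
          ∃[ m ] HasDegree m (norm h) × 2 ℕ.≤ m × m ℕ.+ 2 ℕ.≤ d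
        bound (m , n , Dₕ , Dₖ , m+n≤d) = m , Dₕ , 2≤degree (on-curve {x₁} {y₁} e₁) {h} h∈ Dₕ ,
          ℕₚ.≤-trans (ℕₚ.+-monoʳ-≤ m (2≤degree (on-curve-⊖ {x₁} {y₁} e₁) {k} k∈ Dₖ)) m+n≤d

    -- Here d = 2, which leaves no room for two generators of norm degree at least 2 each.
    affine≁O : ∀ x y .(e : 1ℚ * (y * y) ≡ g x) → ¬ κ (affine x y e) ∼ κ O
    affine≁O x y e P∼O = absurd (∼⇒principal P O P∼O) (∼⇒principal O P (∼-sym P∼O))
      where
      P : Point (curve E)
      P = affine x y e
      D : HasDegree 2 (norm (X x ✶ constant 1ℚ))
      D = degree-resp (norm-✶ (X x) (constant 1ℚ)) (degree-* (degree-X x) (Regular.norm-degree regular-1))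
      absurd : (∃[ h ] κ P ⊙ κ O ≐ ⟨ h ⟩) → (∃[ k ] κ O ⊙ κ (⊖ P) ≐ ⟨ k ⟩) → ⊥
      absurd (h , eh) (k , ek) =
        let (m , _ , 2≤m , m+2≤2) = 2≤degrees x y e O {h} {k} eh ek D in
        ℕₚ.<⇒≱ (ℕₚ.+-monoˡ-< 2 (ℕₚ.<-≤-trans (ℕ.s≤s ℕ.z≤n) 2≤m)) m+2≤2

    double≡2⇒≡1 : ∀ m → 2 ℕ.≤ m ℕ.+ m → m ℕ.+ m ℕ.≤ 2 → m ≡ 1
    double≡2⇒≡1 (suc zero)    _ _ = refl
    double≡2⇒≡1 (suc (suc m)) _ (ℕ.s≤s (ℕ.s≤s l)) with () ← ℕₚ.≤-trans (ℕₚ.m≤n+m (suc (suc m)) m) l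

    module _ (x₁ y₁ : ℚ) .(e₁ : 1ℚ * (y₁ * y₁) ≡ g x₁) (x₂ y₂ : ℚ) .(e₂ : 1ℚ * (y₂ * y₂) ≡ g x₂) where
      private
        P Q : Point (curve E)
        P = affine x₁ y₁ e₁
        Q = affine x₂ y₂ e₂

      -- Here d = 4, so the norm of h has degree exactly 2. Hence h has no y-part, and its even part
      -- has half that degree.
      linear-generator : ∀ {h k} → κ P ⊙ κ (⊖ Q) ≐ ⟨ h ⟩ → κ Q ⊙ κ (⊖ P) ≐ ⟨ k ⟩ →
        (∀ x → odd h x ≡ 0ℚ) × HasDegree 1 (even h)
      linear-generator {h} {k} eh ek =
        let (n , D , 2≤n , n+2≤4) = 2≤degrees x₁ y₁ e₁ Q {h} {k} eh ek
              (degree-resp (norm-✶ (X x₁) (X x₂)) (degree-* (degree-X x₁) (degree-X x₂)))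
            n≤2 = ℕₚ.+-cancelʳ-≤ 2 n 2 n+2≤4
            (odd≡0 , m , Dₘ , m+m≡n) = norm-degree≤2 h D n≤2 in
        odd≡0 , subst (λ m → HasDegree m (even h))
          (double≡2⇒≡1 m (subst (2 ℕ.≤_) (sym m+m≡n) 2≤n) (subst (ℕ._≤ 2) (sym m+m≡n) n≤2)) Dₘ

      module _ {h} (eh : κ P ⊙ κ (⊖ Q) ≐ ⟨ h ⟩) (odd≡0 : ∀ x → odd h x ≡ 0ℚ) (D : HasDegree 1 (even h)) where

        root₁ : even h x₁ ≡ 0ℚ
        root₁ = value-pure (on-curve {x₁} {y₁} e₁) {h}
          (⊙-⊆ˡ {κ P} {κ (⊖ Q)} (self-mem {h} {κ P ⊙ κ (⊖ Q)} eh)) odd≡0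

        root₂ : even h x₂ ≡ 0ℚ
        root₂ = value-pure (on-curve-⊖ {x₂} {y₂} e₂) {h}
          (⊙-⊆ʳ {κ P} {κ (⊖ Q)} (self-mem {h} {κ P ⊙ κ (⊖ Q)} eh)) odd≡0

        x₁≡x₂ : x₁ ≡ x₂
        x₁≡x₂ = degree₁-root-unique D root₁ root₂

        -- The odd part of (y − y₁)(y + y₂) is the constant y₂ − y₁.
        y₁≡y₂ : y₁ ≡ y₂
        y₁≡y₂ = sym (x-y≡0⇒x≡y (begin
          y₂ - y₁
            ≡⟨ solve 2 (λ s t → t :- s := (:- s) :* con 1ℚ :+ con 1ℚ :* (:- (:- t))) refl y₁ y₂ ⟩
          - y₁ * 1ℚ + 1ℚ * - (- y₂)
            ≡⟨ odd-≡ (proj₂ multiple) x₁ ⟩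
          even h x₁ * odd s x₁ + odd h x₁ * even s x₁
            ≡⟨ cong₂ (λ u w → u * odd s x₁ + w * even s x₁) root₁ (odd≡0 x₁) ⟩
          0ℚ * odd s x₁ + 0ℚ * even s x₁
            ≡⟨ solve 2 (λ s t → con 0ℚ :* s :+ con 0ℚ :* t := con 0ℚ) refl (odd s x₁) (even s x₁) ⟩
          0ℚ ∎))
          where
          open ≡-Reasoning
          open _≈_
          multiple : V y₁ ✶ V (- y₂) ∈ ⟨ h ⟩
          multiple = ⊆-to eh (⊙-mem {κ P} {κ (⊖ Q)} {V y₁} {V (- y₂)}
            (right-generator {X x₁} {V y₁}) (right-generator {X x₂} {V (- y₂)}))
          s = proj₁ multiple

      affine-injective : κ P ∼ κ Q → x₁ ≡ x₂ × y₁ ≡ y₂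
      affine-injective P∼Q = coordinates (∼⇒principal P Q P∼Q) (∼⇒principal Q P (∼-sym P∼Q))
        where
        coordinates : (∃[ h ] κ P ⊙ κ (⊖ Q) ≐ ⟨ h ⟩) → (∃[ k ] κ Q ⊙ κ (⊖ P) ≐ ⟨ k ⟩) → x₁ ≡ x₂ × y₁ ≡ y₂
        coordinates (h , eh) (k , ek) =
          let (odd≡0 , D) = linear-generator {h} {k} eh ek in x₁≡x₂ {h} eh odd≡0 D , y₁≡y₂ {h} eh odd≡0 D

    κ-injective : ∀ {P Q} → κ P ∼ κ Q → P ≡ Q
    κ-injective {O} {O} _ = refl
    κ-injective {affine x y e} {O} P∼O = ⊥-elim (affine≁O x y e P∼O)
    κ-injective {O} {affine x y e} O∼Q = ⊥-elim (affine≁O x y e (∼-sym O∼Q))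
    κ-injective {affine x₁ y₁ e₁} {affine x₂ y₂ e₂} P∼Q =
      coordinates (affine-injective x₁ y₁ e₁ x₂ y₂ e₂ P∼Q)
      where
      coordinates : ∀ {x₁ y₁ x₂ y₂} .{e₁ e₂} → x₁ ≡ x₂ × y₁ ≡ y₂ → _≡_ {A = Point (curve E)} (affine x₁ y₁ e₁) (affine x₂ y₂ e₂)
      coordinates (refl , refl) = refl

    ⊕-assoc : ∀ P Q S → (P ⊕ Q) ⊕ S ≡ P ⊕ (Q ⊕ S)
    ⊕-assoc P Q S = κ-injective (∼-trans (∼-sym (κ-⊕ (P ⊕ Q) S)) (∼-trans (∼-⊙ʳ (κ S) (∼-sym (κ-⊕ P Q)))
      (∼-trans (≐⇒∼ (⊙-assoc (κ P) (κ Q) (κ S))) (∼-trans (∼-⊙ˡ (κ P) (κ-⊕ Q S)) (κ-⊕ P (Q ⊕ S))))))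

    ⊕-comm : ∀ P Q → P ⊕ Q ≡ Q ⊕ P
    ⊕-comm P Q = κ-injective (∼-trans (∼-sym (κ-⊕ P Q)) (∼-trans (≐⇒∼ (⊙-comm (κ P) (κ Q))) (κ-⊕ Q P)))

    ⊕-inverseʳ : ∀ P → P ⊕ (⊖ P) ≡ O
    ⊕-inverseʳ P = κ-injective (∼-trans (∼-sym (κ-⊕ P (⊖ P))) (constant 1ℚ , v P , regular-1 , regular-v P ,
      ≐-trans (⊙-identityˡ (κ P ⊙ κ (⊖ P))) (≐-trans (κ-⊖ P)
        (≐-sym (≐-trans (⊙-comm ⟨ v P ⟩ ⟨ constant 1ℚ ⟩) (⊙-identityˡ ⟨ v P ⟩))))))

    pointGroup : AbelianGroup 0ℓ 0ℓ
    pointGroup = record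
      { Carrier = Point (curve E) ; _≈_ = _≡_ ; _∙_ = _⊕_ ; ε = O ; _⁻¹ = ⊖_
      ; isAbelianGroup = record
        { isGroup = record
          { isMonoid = record
            { isSemigroup = record
              { isMagma = record { isEquivalence = isEquivalence ; ∙-cong = cong₂ _⊕_ }
              ; assoc = ⊕-assoc
              }
            ; identity = (λ _ → refl) , (λ P → ⊕-comm P O)
            }
          ; inverse = (λ P → trans (⊕-comm (⊖ P) P) (⊕-inverseʳ P)) , ⊕-inverseʳ
          ; ⁻¹-cong = cong ⊖_
          }
        ; comm = ⊕-comm
        }
      }

-- Uniqueness of the rank

module _ (E : EllipticCurve) where
  open ChordTangent.GroupLaw E using (pointGroup)
  module Points = Independence pointGroup

  ·-agrees : ∀ n (P : Point (curve E)) → n · P ≡ n Points.· P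
  ·-agrees (+ n)    P = ≡.refl
  ·-agrees -[1+ n ] P = ≡.refl

  combination-agrees : ∀ {r} n (P : Vector (Point (curve E)) r) → combination n P ≡ Points.combination n P
  combination-agrees n P = CommutativeMonoidSum.sum-cong-≗ (AbelianGroup.commutativeMonoid pointGroup) (λ i → ·-agrees (n i) (P i))

  independent : ∀ {r} {P : Vector (Point (curve E)) r} → Independent P → Points.Independent P
  independent {P = P} indep n e = indep n (≡.trans (combination-agrees n P) e)

  dependent : ∀ {r} {P : Vector (Point (curve E)) r} → Dependent P → Points.Dependent P
  dependent {P = P} (n , e , i) = n , ≡.trans (≡.sym (combination-agrees n P)) e , i

  rank-unique : ∀ {r s} → HasRank (curve E) r → HasRank (curve E) s → r ≡ s
  rank-unique (P , indepP , spansP) (Q , indepQ , spansQ) = ℕₚ.≤-antisym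
    (Points.independent-≤ (independent indepQ) (λ x → dependent {P = x ∷ Q} (spansQ x)) (independent indepP))
    (Points.independent-≤ (independent indepP) (λ x → dependent {P = x ∷ P} (spansP x)) (independent indepQ))

-- Quadratic characters and congruences

open import Data.Bool using (Bool; true; false; if_then_else_)
open import Data.Integer using (_-_)
open import Data.Integer.Coprimality using (Coprime)
open import Data.Integer.Divisibility using (_∣_)
open import Data.Integer.Divisibility.Signed as ℤ∣ using (∣ᵤ⇒∣; ∣⇒∣ᵤ)
open import Data.Integer.DivMod using (_%ℕ_; _/ℕ_; n%ℕd<d; a≡a%ℕn+[a/ℕn]*n)
open import Data.List using (List; []; _∷_; map; foldr)
open import Data.List.Membership.Propositional using (_∈_; _∉_)
open import Data.List.Relation.Unary.All using (All; []; _∷_)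
open import Data.List.Relation.Unary.Any using (here; there)
import Data.Nat.Coprimality as ℕ
import Data.Nat.Divisibility as ℕ∣
open import Data.Nat.GCD using (module Bézout)
open import Data.Nat.ListAction.Properties using (∈⇒∣product)
open import Data.Nat.Primality using (Prime; euclidsLemma; prime⇒irreducible; prime⇒nonZero; prime⇒nonTrivial)
open import Data.Nat.Primality.Factorisation using (factorise; PrimeFactorisation)

residue-1 : ∀ {d k} .{{_ : NonZero k}} → 2 ℕ.≤ k → + k ℤ∣.∣ d - 1ℤ → d %ℕ k ≡ 1
residue-1 {d} {k} 2≤k k∣d-1 = conclude (d %ℕ k) (n%ℕd<d d k) (∣⇒∣ᵤ k∣r-1)
  where
  k∣r-1 : + k ℤ∣.∣ + (d %ℕ k) - 1ℤ
  k∣r-1 = ℤ∣.∣m+n∣n⇒∣m {n = (d /ℕ k) ℤ.* + k}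
    (subst (+ k ℤ∣.∣_) (trans (cong (_- 1ℤ) (a≡a%ℕn+[a/ℕn]*n d k))
      (solve 2 (λ r q → r :+ q :- con 1ℤ := r :- con 1ℤ :+ q) refl (+ (d %ℕ k)) ((d /ℕ k) ℤ.* + k))) k∣d-1)
    (ℤ∣.∣n⇒∣m*n (d /ℕ k) ℤ∣.∣-refl)
    where open ℤ-Solver
  conclude : ∀ r → r ℕ.< k → + k ∣ + r - 1ℤ → r ≡ 1
  conclude zero          _   k∣1 = ⊥-elim (ℕₚ.<⇒≱ 2≤k (ℕ∣.∣⇒≤ k∣1))
  conclude (suc zero)    _   _   = refl
  conclude (suc (suc r)) r<k k∣r = ⊥-elim (ℕₚ.<⇒≱ r<k (ℕₚ.≤-trans (ℕ∣.∣⇒≤ k∣r) (ℕₚ.n≤1+n (suc r))))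

coprime-of-≡1 : ∀ {d k} → + k ℤ∣.∣ d - 1ℤ → Coprime d (+ k)
coprime-of-≡1 {d} {k} k∣d-1 {e} (e∣d , e∣k) = ℕ∣.∣1⇒≡1 (∣⇒∣ᵤ e∣1)
  where
  e∣1 : + e ℤ∣.∣ 1ℤ
  e∣1 = subst (+ e ℤ∣.∣_) (solve 1 (λ d → d :- (d :- con 1ℤ) := con 1ℤ) refl d)
    (ℤ∣.∣m∣n⇒∣m-n (∣ᵤ⇒∣ {+ e} {d} e∣d) (ℤ∣.∣-trans (∣ᵤ⇒∣ {+ e} {+ k} e∣k) k∣d-1))
    where open ℤ-Solver

legendre-1 : ∀ {d q} → + suc (suc q) ℤ∣.∣ d - 1ℤ → legendre d (suc (suc q)) ≡ 1ℤ
-- The witness `suc zero` is the residue 1, since 1² ≡ d.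
legendre-1 {d} {q} q∣d-1 = branches (dec-false (suc (suc q) ℕ∣.∣? ∣ d ∣) q∤d) (dec-true (any? square?) (suc zero , ∣⇒∣ᵤ q∣1-d))
  where
  square? : (x : Fin (suc (suc q))) → Dec (suc (suc q) ℕ∣.∣ ∣ + (toℕ x ℕ.* toℕ x) - d ∣)
  square? x = suc (suc q) ℕ∣.∣? ∣ + (toℕ x ℕ.* toℕ x) - d ∣
  q∤d : ¬ suc (suc q) ℕ∣.∣ ∣ d ∣
  q∤d q∣d with () ← coprime-of-≡1 {d} q∣d-1 (q∣d , ℕ∣.∣-refl)
  q∣1-d : + suc (suc q) ℤ∣.∣ 1ℤ - d
  q∣1-d = subst (+ suc (suc q) ℤ∣.∣_) (solve 1 (λ d → :- (d :- con 1ℤ) := con 1ℤ :- d) refl d) (ℤ∣.∣m⇒∣-m q∣d-1)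
    where open ℤ-Solver
  branches : ∀ {b c : Bool} → b ≡ false → c ≡ true →
    (if b then 0ℤ else if c then 1ℤ else -1ℤ) ≡ 1ℤ
  branches refl refl = refl

kronecker₂-1 : ∀ {d} → + 8 ℤ∣.∣ d - 1ℤ → kronecker₂ d ≡ 1ℤ
kronecker₂-1 {d} 8∣d-1 rewrite residue-1 {d} {8} (ℕ.s≤s (ℕ.s≤s ℕ.z≤n)) 8∣d-1 = refl

module _ {d : ℤ} {N : ℕ} .{{_ : NonZero N}} (8N∣d-1 : + (8 ℕ.* N) ℤ∣.∣ d - 1ℤ) where

  divisor∣d-1 : ∀ {k} → k ℕ∣.∣ 8 ℕ.* N → + k ℤ∣.∣ d - 1ℤ
  divisor∣d-1 k∣8N = ℤ∣.∣-trans (∣ᵤ⇒∣ k∣8N) 8N∣d-1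

  -- An odd prime factor of N needs only d ≡ 1 modulo itself. The prime 2 needs d modulo 8, which is
  -- the origin of the factor 8.
  kroneckerPrime-1 : ∀ {q} → Prime q → q ℕ∣.∣ N → kroneckerPrime d q ≡ 1ℤ
  kroneckerPrime-1 {0} q-prime _ = ⊥-elim (ℕ.≢-nonZero⁻¹ 0 {{prime⇒nonZero q-prime}} refl)
  kroneckerPrime-1 {1} q-prime _ = ⊥-elim (ℕ.nonTrivial⇒≢1 {{prime⇒nonTrivial q-prime}} refl)
  kroneckerPrime-1 {2} _ _ = kronecker₂-1 {d} (divisor∣d-1 (ℕ∣.m∣m*n N))
  kroneckerPrime-1 {suc (suc (suc q))} _ q∣N = legendre-1 {d} (divisor∣d-1 (ℕ∣.∣-trans q∣N (ℕ∣.n∣m*n 8)))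

  kroneckerPositive-1 : kroneckerPositive d N ≡ 1ℤ
  kroneckerPositive-1 = go factors factorsPrime (λ q∈ → subst (_ ℕ∣.∣_) (sym isFactorisation) (∈⇒∣product q∈))
    where
    open PrimeFactorisation (factorise N)
    go : ∀ qs → All Prime qs → (∀ {q} → q ∈ qs → q ℕ∣.∣ N) → foldr ℤ._*_ 1ℤ (map (kroneckerPrime d) qs) ≡ 1ℤ
    go []       _              _   = refl
    go (q ∷ qs) (q-prime ∷ ps) all∣ = cong₂ ℤ._*_ (kroneckerPrime-1 q-prime (all∣ (here refl))) (go qs ps (λ q∈ → all∣ (there q∈)))

  fieldDiscriminant-≡1 : fieldDiscriminant d ≡ d
  fieldDiscriminant-≡1 = cong (λ b → if b then d else + 4 ℤ.* d) (dec-true (d %ℕ 4 ℕ.≟ 1)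
    (residue-1 {d} {4} (ℕ.s≤s (ℕ.s≤s ℕ.z≤n)) (divisor∣d-1 (ℕ∣.∣-trans (ℕ∣.divides 2 refl) (ℕ∣.m∣m*n N)))))

χ-negative : ∀ {d N} → + (8 ℕ.* suc N) ℤ∣.∣ d - 1ℤ → χ d (ℤ.- (+ suc N)) ≡ kroneckerUnit d
χ-negative {d} {N} 8N∣d-1 = begin
  χ d (ℤ.- (+ suc N))
    ≡⟨ cong (λ D → kronecker D (ℤ.- (+ suc N))) (fieldDiscriminant-≡1 {d} {suc N} 8N∣d-1) ⟩
  kroneckerUnit d ℤ.* kroneckerPositive d (suc N)
    ≡⟨ cong (kroneckerUnit d ℤ.*_) (kroneckerPositive-1 {d} {suc N} 8N∣d-1) ⟩
  kroneckerUnit d ℤ.* 1ℤ                          ≡⟨ ℤₚ.*-identityʳ (kroneckerUnit d) ⟩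
  kroneckerUnit d                                 ∎
  where open ≡-Reasoning

-- Simultaneous congruences and squarefree representatives

unit-mod : ∀ {C p} → ℕ.Coprime C p → ∃[ u ] + p ℤ∣.∣ + C ℤ.* u - 1ℤ
unit-mod {C} {p} coprime with ℕ.coprime-Bézout coprime
... | Bézout.+- x y eq = + x , ℤ∣.divides (+ y) (begin
  + C ℤ.* + x - 1ℤ          ≡⟨ cong (_- 1ℤ) (trans (ℤₚ.*-comm (+ C) (+ x)) (sym (ℤₚ.pos-* x C))) ⟩
  + (x ℕ.* C) - 1ℤ          ≡⟨ cong (λ t → + t - 1ℤ) eq ⟨
  + (1 ℕ.+ y ℕ.* p) - 1ℤ    ≡⟨⟩
  + (y ℕ.* p)               ≡⟨ ℤₚ.pos-* y p ⟩
  + y ℤ.* + p               ∎)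
  where open ≡-Reasoning
... | Bézout.-+ x y eq = ℤ.- + x , ℤ∣.divides (ℤ.- + y) (begin
  + C ℤ.* ℤ.- + x - 1ℤ      ≡⟨ solve 2 (λ C x → C :* (:- x) :- con 1ℤ := :- (con 1ℤ :+ x :* C)) refl (+ C) (+ x) ⟩
  ℤ.- (1ℤ ℤ.+ + x ℤ.* + C)  ≡⟨ cong (λ t → ℤ.- (1ℤ ℤ.+ t)) (ℤₚ.pos-* x C) ⟨
  ℤ.- + (1 ℕ.+ x ℕ.* C)     ≡⟨ cong (λ t → ℤ.- + t) eq ⟩
  ℤ.- + (y ℕ.* p)           ≡⟨ cong ℤ.-_ (ℤₚ.pos-* y p) ⟩
  ℤ.- (+ y ℤ.* + p)         ≡⟨ ℤₚ.neg-distribˡ-* (+ y) (+ p) ⟩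
  ℤ.- + y ℤ.* + p           ∎)
  where
  open ≡-Reasoning
  open ℤ-Solver

simultaneous : ∀ {C p} → ℕ.Coprime C p → ∀ m → ∃[ z ] (+ C ℤ∣.∣ z - 1ℤ) × (+ p ℤ∣.∣ z - m)
simultaneous {C} {p} coprime m with unit-mod coprime
... | u , p∣Cu-1 = z , ℤ∣.divides (u ℤ.* (m - 1ℤ))
        (solve 3 (λ C u m → con 1ℤ :+ C :* u :* (m :- con 1ℤ) :- con 1ℤ := u :* (m :- con 1ℤ) :* C) refl (+ C) u m) ,
      subst (+ p ℤ∣.∣_)
        (solve 3 (λ C u m → (m :- con 1ℤ) :* (C :* u :- con 1ℤ) := con 1ℤ :+ C :* u :* (m :- con 1ℤ) :- m) refl (+ C) u m)
        (ℤ∣.∣n⇒∣m*n (m - 1ℤ) p∣Cu-1)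
  where
  open ℤ-Solver
  -- Modulo C this is 1; modulo p, where C u ≡ 1, it is 1 + (m - 1).
  z = 1ℤ ℤ.+ + C ℤ.* u ℤ.* (m - 1ℤ)

coprime-resp : ∀ {w x M} → + M ℤ∣.∣ x - w → Coprime w (+ M) → Coprime x (+ M)
coprime-resp {w} {x} {M} M∣x-w coprime {e} (e∣x , e∣M) = coprime (∣⇒∣ᵤ e∣w , e∣M)
  where
  e∣w : + e ℤ∣.∣ w
  e∣w = subst (+ e ℤ∣.∣_) (solve 2 (λ x w → x :- (x :- w) := w) refl x w)
    (ℤ∣.∣m∣n⇒∣m-n (∣ᵤ⇒∣ {+ e} {x} e∣x) (ℤ∣.∣-trans (∣ᵤ⇒∣ {+ e} {+ M} e∣M) M∣x-w))
    where open ℤ-Solver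

squarefree-≡ : ∀ w M .{{_ : NonZero M}} → 2 ℕ∣.∣ M → Coprime w (+ M) → ∀ B →
  ∃[ x ] B ℕ.≤ x × (+ M ℤ∣.∣ + x - w) × (∀ k → k ℕ.* k ℕ∣.∣ x → k ≡ 1)
squarefree-≡ w M 2∣M coprime B =
  let (n , squarefree) = Sieve.squarefree-in-progression a M coprime-a 2∣M in
  a ℕ.+ n ℕ.* M ,
  ℕₚ.≤-trans (ℕₚ.m≤m*n B M) (ℕₚ.≤-trans (ℕₚ.m≤n+m (B ℕ.* M) r) (ℕₚ.m≤m+n a (n ℕ.* M))) ,
  congruent n , squarefree
  where
  open ℤ-Solver
  r a : ℕ
  r = w %ℕ M
  -- Starting the progression at r + B M makes all its terms at least B without changing their
  -- residue.
  a = r ℕ.+ B ℕ.* M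
  congruent : ∀ n → + M ℤ∣.∣ + (a ℕ.+ n ℕ.* M) - w
  congruent n = ℤ∣.divides (+ B ℤ.+ + n - w /ℕ M) (begin
    + (r ℕ.+ B ℕ.* M ℕ.+ n ℕ.* M) - w
      ≡⟨ cong₂ _-_ (cong₂ (λ s t → + r ℤ.+ s ℤ.+ t) (ℤₚ.pos-* B M) (ℤₚ.pos-* n M)) (a≡a%ℕn+[a/ℕn]*n w M) ⟩
    + r ℤ.+ + B ℤ.* + M ℤ.+ + n ℤ.* + M - (+ r ℤ.+ (w /ℕ M) ℤ.* + M)
      ≡⟨ solve 5 (λ r B n M q → r :+ B :* M :+ n :* M :- (r :+ q :* M) := (B :+ n :- q) :* M) refl
           (+ r) (+ B) (+ n) (+ M) (w /ℕ M) ⟩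
    (+ B ℤ.+ + n - w /ℕ M) ℤ.* + M ∎)
    where open ≡-Reasoning
  coprime-a : ℕ.Coprime a M
  coprime-a = coprime-resp {w} {+ a} (subst (λ t → + M ℤ∣.∣ + t - w) (ℕₚ.+-identityʳ a) (congruent 0)) coprime

squarefree-abs : ∀ {x} → x ≢ 0 → (∀ k → k ℕ.* k ℕ∣.∣ x → k ≡ 1) → ∀ d → ∣ d ∣ ≡ x → Squarefree d
squarefree-abs x≢0 sf d refl = (λ d≡0 → x≢0 (cong ∣_∣ d≡0)) ,
  λ k k²∣d → sf ∣ k ∣ (subst (ℕ∣._∣ ∣ d ∣) (ℤₚ.abs-* k k) k²∣d)

bound : List ℤ → ℕ
bound = foldr (λ d B → ∣ d ∣ ℕ.+ B) 0

bounded : ∀ {d} L → d ∈ L → ∣ d ∣ ℕ.≤ bound L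
bounded (d ∷ L) (here refl) = ℕₚ.m≤m+n ∣ d ∣ (bound L)
bounded (d ∷ L) (there d∈)  = ℕₚ.≤-trans (bounded L d∈) (ℕₚ.m≤n+m (bound L) ∣ d ∣)

-- The parity conjecture for a positive and a negative d

module _ (E : EllipticCurve) {n : ℕ} (conductor : IsConductor E (suc n)) (parity : ParityConjecture) where

  private
    N = suc n

  -- d ≡ 1 (mod 8N) settles both coprimality conditions: d is prime to 2N, and the field
  -- discriminant, being d, is prime to N.
  twist-rank : ∀ {d} → Squarefree d → + (8 ℕ.* N) ℤ∣.∣ d - 1ℤ →
    ∃[ r′ ] ∃[ r ] HasRank (twist E d) r′ × HasRank (curve E) r × -1ℤ ℤ.^ r′ ≡ -1ℤ ℤ.^ r ℤ.* kroneckerUnit d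
  twist-rank {d} squarefree 8N∣d-1 =
    let (r′ , r , twisted , untwisted , eq) = parity E N conductor d squarefree
          (coprime-of-≡1 {d} (divisor∣d-1 {d} {N} 8N∣d-1 (ℕ∣.*-monoˡ-∣ {2} {8} N (ℕ∣.divides 4 refl))))
          (subst (λ D → Coprime D (+ N)) (sym (fieldDiscriminant-≡1 {d} {N} 8N∣d-1))
            (coprime-of-≡1 {d} (divisor∣d-1 {d} {N} 8N∣d-1 (ℕ∣.n∣m*n 8)))) in
    r′ , r , twisted , untwisted , trans eq (cong (-1ℤ ℤ.^ r ℤ.*_) (χ-negative {d} {n} 8N∣d-1))

  -- The case split is on the natural number r′ that comes with the conjecture, so nothing about the
  -- twist itself has to be decided.
  positive⊎zero : ∀ {d} → Squarefree d → + (8 ℕ.* N) ℤ∣.∣ d - 1ℤ →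
    PositiveRank (twist E d) ⊎ (∃[ r ] HasRank (curve E) r × 1ℤ ≡ -1ℤ ℤ.^ r ℤ.* kroneckerUnit d)
  positive⊎zero {d} squarefree 8N∣d-1 = split (twist-rank {d} squarefree 8N∣d-1)
    where
    split : (∃[ r′ ] ∃[ r ] HasRank (twist E d) r′ × HasRank (curve E) r × -1ℤ ℤ.^ r′ ≡ -1ℤ ℤ.^ r ℤ.* kroneckerUnit d) →
      PositiveRank (twist E d) ⊎ (∃[ r ] HasRank (curve E) r × 1ℤ ≡ -1ℤ ℤ.^ r ℤ.* kroneckerUnit d)
    split (suc r′ , _ , twisted , _ , _)  = inj₁ (suc r′ , twisted , ℕ.s≤s ℕ.z≤n)
    split (zero , r , _ , untwisted , eq) = inj₂ (r , untwisted , eq)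

  opposite-signs : ¬ ((∃[ r ] HasRank (curve E) r × 1ℤ ≡ -1ℤ ℤ.^ r ℤ.* 1ℤ) ×
                      (∃[ s ] HasRank (curve E) s × 1ℤ ≡ -1ℤ ℤ.^ s ℤ.* -1ℤ))
  opposite-signs ((r , rank-r , eq₊) , (s , rank-s , eq₋)) = clash (rank-unique E rank-r rank-s)
    where
    clash : r ≢ s
    clash r≡s = contradiction (begin
      1ℤ                ≡⟨ eq₋ ⟩
      -1ℤ ℤ.^ s ℤ.* -1ℤ ≡⟨ cong (λ t → -1ℤ ℤ.^ t ℤ.* -1ℤ) r≡s ⟨
      -1ℤ ℤ.^ r ℤ.* -1ℤ ≡⟨ cong (ℤ._* -1ℤ) (trans eq₊ (ℤₚ.*-identityʳ (-1ℤ ℤ.^ r))) ⟨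
      -1ℤ               ∎) (λ ())
      where open ≡-Reasoning

  one-positive : ∀ x y → Squarefree (+ x) → + (8 ℕ.* N) ℤ∣.∣ + x - 1ℤ →
    Squarefree -[1+ y ] → + (8 ℕ.* N) ℤ∣.∣ -[1+ y ] - 1ℤ →
    PositiveRank (twist E (+ x)) ⊎ PositiveRank (twist E -[1+ y ])
  one-positive x y sf₊ ≡₊ sf₋ ≡₋ =
    [ inj₁ , (λ even → [ inj₂ , (λ odd → ⊥-elim (opposite-signs (even , odd))) ]′ (positive⊎zero { -[1+ y ]} sf₋ ≡₋)) ]′
    (positive⊎zero {+ x} sf₊ ≡₊)

  module _ {p M : ℕ} .{{_ : NonZero M}} (8N∣M : 8 ℕ.* N ℕ∣.∣ M) (p∣M : p ℕ∣.∣ M)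
    {z m : ℤ} (8N∣z-1 : + (8 ℕ.* N) ℤ∣.∣ z - 1ℤ) (p∣z-m : + p ℤ∣.∣ z - m) (z⊥M : Coprime z (+ M)) where

    open ℤ-Solver

    ≡1 : ∀ {d} → + M ℤ∣.∣ d - z → + (8 ℕ.* N) ℤ∣.∣ d - 1ℤ
    ≡1 {d} M∣d-z = subst (+ (8 ℕ.* N) ℤ∣.∣_) (solve 2 (λ d z → d :- z :+ (z :- con 1ℤ) := d :- con 1ℤ) refl d z)
      (ℤ∣.∣m∣n⇒∣m+n (ℤ∣.∣-trans (∣ᵤ⇒∣ {+ (8 ℕ.* N)} {+ M} 8N∣M) M∣d-z) 8N∣z-1)

    ≡m : ∀ {d} → + M ℤ∣.∣ d - z → + p ∣ d - m
    ≡m {d} M∣d-z = ∣⇒∣ᵤ (subst (+ p ℤ∣.∣_) (solve 3 (λ d z m → d :- z :+ (z :- m) := d :- m) refl d z m)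
      (ℤ∣.∣m∣n⇒∣m+n (ℤ∣.∣-trans (∣ᵤ⇒∣ {+ p} {+ M} p∣M) M∣d-z) p∣z-m))

    infinitely-many : Infinite (λ d → Squarefree d × (+ p ∣ d - m) × PositiveRank (twist E d))
    -- The negative candidate is -y for a squarefree y ≡ -z (mod M).
    infinitely-many L = conclude (squarefree-≡ z M 2∣M z⊥M B) (squarefree-≡ (ℤ.- z) M 2∣M -z⊥M B)
      where
      B : ℕ
      B = suc (bound L)

      2∣M : 2 ℕ∣.∣ M
      2∣M = ℕ∣.∣-trans (ℕ∣.∣-trans (ℕ∣.divides 4 refl) (ℕ∣.m∣m*n N)) 8N∣M

      -z⊥M : Coprime (ℤ.- z) (+ M)
      -z⊥M {e} (e∣z , e∣M) = z⊥M (subst (e ℕ∣.∣_) (ℤₚ.∣-i∣≡∣i∣ z) e∣z , e∣M)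

      Witness : Set
      Witness = ∃[ d ] d ∉ L × Squarefree d × (+ p ∣ d - m) × PositiveRank (twist E d)

      witness : ∀ d → B ℕ.≤ ∣ d ∣ → Squarefree d → + M ℤ∣.∣ d - z → PositiveRank (twist E d) → Witness
      witness d B≤d squarefree M∣d-z positive =
        d , (λ d∈L → ℕₚ.<⇒≱ B≤d (bounded L d∈L)) , squarefree , ≡m {d} M∣d-z , positive

      negate : ∀ y → + M ℤ∣.∣ + suc y - ℤ.- z → + M ℤ∣.∣ -[1+ y ] - z
      negate y M∣y+z = subst (+ M ℤ∣.∣_) (solve 2 (λ y z → :- (y :- (:- z)) := :- y :- z) refl (+ suc y) z) (ℤ∣.∣m⇒∣-m M∣y+z)

      choose : ∀ x y → B ℕ.≤ x → B ℕ.≤ suc y → Squarefree (+ x) → Squarefree -[1+ y ] →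
        + M ℤ∣.∣ + x - z → + M ℤ∣.∣ -[1+ y ] - z → Witness
      choose x y B≤x B≤y sf₊ sf₋ M∣x-z M∣-y-z =
        [ witness (+ x) B≤x sf₊ M∣x-z , witness -[1+ y ] B≤y sf₋ M∣-y-z ]′
        (one-positive x y sf₊ (≡1 {+ x} M∣x-z) sf₋ (≡1 { -[1+ y ]} M∣-y-z))

      conclude : (∃[ x ] B ℕ.≤ x × (+ M ℤ∣.∣ + x - z) × (∀ k → k ℕ.* k ℕ∣.∣ x → k ≡ 1)) →
        (∃[ y ] B ℕ.≤ y × (+ M ℤ∣.∣ + y - ℤ.- z) × (∀ k → k ℕ.* k ℕ∣.∣ y → k ≡ 1)) → Witness
      -- `B` is a successor, so x and y are positive and the zero cases are absurd.
      conclude (suc x , B≤x , M∣x-z , sf-x) (suc y , B≤y , M∣y+z , sf-y) =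
        choose (suc x) y B≤x B≤y
          (squarefree-abs (λ ()) sf-x (+ suc x) refl) (squarefree-abs (λ ()) sf-y -[1+ y ] refl) M∣x-z (negate y M∣y+z)

prime∤2^ : ∀ {p} → Prime p → p ≢ 2 → ∀ k → ¬ p ℕ∣.∣ 2 ℕ.^ k
prime∤2^ p-prime p≢2 zero    p∣1 = ℕ.nonTrivial⇒≢1 {{prime⇒nonTrivial p-prime}} (ℕ∣.∣1⇒≡1 p∣1)
prime∤2^ p-prime p≢2 (suc k) p∣  = [ p∤2 , prime∤2^ p-prime p≢2 k ]′ (euclidsLemma 2 (2 ℕ.^ k) p-prime p∣)
  where
  p∤2 : ¬ _ ℕ∣.∣ 2
  p∤2 p∣2 = p≢2 (ℕₚ.≤-antisym (ℕ∣.∣⇒≤ p∣2) (ℕ.nonTrivial⇒n>1 _ {{prime⇒nonTrivial p-prime}}))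

prime⇒coprime : ∀ {C p} → Prime p → ¬ p ℕ∣.∣ C → ℕ.Coprime C p
prime⇒coprime p-prime p∤C (e∣C , e∣p) =
  [ (λ e≡1 → e≡1) , (λ { refl → ⊥-elim (p∤C e∣C) }) ]′ (prime⇒irreducible p-prime e∣p)

-- A common divisor e of z and C p is prime to C because z ≡ 1 (mod C), so it divides p; modulo p, z
-- may be replaced by m.
coprime-product : ∀ {z m C p} → + C ℤ∣.∣ z - 1ℤ → + p ℤ∣.∣ z - m → Coprime m (+ p) → Coprime z (+ (C ℕ.* p))
coprime-product {z} {m} C∣z-1 p∣z-m m⊥p (e∣z , e∣Cp) = coprime-resp {m} {z} p∣z-m m⊥p
  (e∣z , ℕ.coprime-divisor (λ (f∣e , f∣C) → coprime-of-≡1 {z} C∣z-1 (ℕ∣.∣-trans f∣e e∣z , f∣C)) e∣Cp)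

lemma3p6 : (E : EllipticCurve) (N : ℕ) → IsConductor E N →
    (p : ℕ) → Prime p → p ≢ 2 → ¬ (+ p ∣ + N) →
    (m : ℤ) → Coprime m (+ p) →
    ParityConjecture →
    Infinite (λ d → Squarefree d × (+ p ∣ d - m) × PositiveRank (twist E d))
-- p divides 0, so p ∤ N excludes N = 0.
lemma3p6 E zero    _         p _       _   p∤N m _ _ = ⊥-elim (p∤N (p ℕ∣.∣0))
lemma3p6 E (suc n) conductor p p-prime p≢2 p∤N m m⊥p parity =
  let (z , C∣z-1 , p∣z-m) = simultaneous (prime⇒coprime p-prime p∤C) m in
  infinitely-many E conductor parity {p} {C ℕ.* p} (ℕ∣.m∣m*n p) (ℕ∣.n∣m*n C) {z} {m} C∣z-1 p∣z-m
    (coprime-product {z} {m} {C} {p} C∣z-1 p∣z-m m⊥p)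
  where
  C : ℕ
  C = 8 ℕ.* suc n
  p∤C : ¬ p ℕ∣.∣ C
  -- The exponent 3 is that of 8 = 2³.
  p∤C p∣C = [ prime∤2^ p-prime p≢2 3 , p∤N ]′ (euclidsLemma 8 (suc n) p-prime p∣C)
  instance
    _ = ℕₚ.m*n≢0 C p {{_}} {{prime⇒nonZero p-prime}}
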